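{- Let $\varepsilon>0$ be fixed and $p=\frac{1+\varepsilon}{m}$. Then with high probability (as $m\to\infty$) the random subgraph $Q^m_p$ contains a cycle of length at least $\frac{2^{m}}{4m^{32}}=2^{(1-o(1))m}$.
   Context: $Q^m$ is the $m$-dimensional hypercube (vertex set $\{0,1\}^m$, adjacency when differing in exactly one coordinate). For a graph $G$ and $p\in[0,1]$, $G_p$ is the random spanning subgraph obtained by keeping each edge independently with probability $p$.
   Formalization: Here ε (and hence p = (1+ε)/m) is rational rather than an arbitrary positive real; the reformulation of the bound as 2^{(1-o(1))m} is not stated separately. -}

module Defs where

open import Data.Bool using (Bool; true; false; not; T; if_then_else_)
open import Data.Bool.Properties using (T?) renaming (_≟_ to _≟B_)
open import Data.Nat using (ℕ; zero; suc; _+_; _*_; _^_; _≤_; _≤?_; z≤n; s≤s)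
open import Data.Nat.Properties using (≤-refl; m≤n⇒m<n∨m≡n; +-suc; ≤-step)
open import Data.Fin using (Fin; zero; suc)
open import Data.Vec using (Vec; []; _∷_; lookup; toList)
open import Data.Vec.Properties using (≡-dec)
open import Data.List using (List; []; _∷_; [_]; _++_; length; zip; filter; cartesianProduct; cartesianProductWith; allFin; foldr)
open import Data.List.Properties using (length-++)
open import Data.List.Relation.Unary.Any using (Any; here; there; any?; satisfied)
open import Data.List.Relation.Unary.All using (All; []; _∷_)
import Data.List.Relation.Unary.All as All
open import Data.List.Relation.Unary.AllPairs using (AllPairs; []; _∷_)
open import Data.List.Relation.Unary.Linked using (Linked; linked?)
open import Data.List.Membership.Propositional using (_∈_; lose)
open import Data.List.Membership.Propositional.Properties
  using (∈-∃++; ∈-++⁻; ∈-++⁺ˡ; ∈-++⁺ʳ; ∈-cartesianProductWith⁺; ∈-filter⁺; ∈-cartesianProduct⁺; ∈-allFin)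
open import Data.Product using (Σ; ∃; ∃₂; _×_; _,_; proj₁; proj₂)
open import Data.Product.Properties using () 
open import Data.Sum using (_⊎_; inj₁; inj₂)
open import Data.Integer using (+_)
open import Data.Rational using (ℚ; 0ℚ; 1ℚ; _/_) renaming (_+_ to _+ℚ_; _*_ to _*ℚ_; _-_ to _-ℚ_)
open import Relation.Binary.PropositionalEquality using (_≡_; refl; sym; trans; cong; subst)
open import Relation.Binary.Definitions using (DecidableEquality)
open import Relation.Nullary using (Dec; yes; no; ¬_; does; contradiction)
open import Relation.Nullary.Decidable using (map′; _×-dec_; _⊎-dec_)
import Data.List.Relation.Unary.Unique.DecPropositional as UniqueDec

Vertex : ℕ → Set
Vertex m = Vec Bool m

_≟V_ : ∀ {m} → DecidableEquality (Vertex m)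
_≟V_ = ≡-dec _≟B_

flipAt : ∀ {m} → Vertex m → Fin m → Vertex m
flipAt (b ∷ v) zero    = not b ∷ v
flipAt (b ∷ v) (suc i) = b ∷ flipAt v i

allVec : ∀ {A : Set} → List A → (m : ℕ) → List (Vec A m)
allVec xs zero    = [ [] ]
allVec xs (suc m) = cartesianProductWith _∷_ xs (allVec xs m)

allVec-complete : ∀ {A : Set} (xs : List A) (complete : ∀ a → a ∈ xs) {m} (v : Vec A m) → v ∈ allVec xs m
allVec-complete xs c []      = here refl
allVec-complete xs c (a ∷ v) = ∈-cartesianProductWith⁺ _∷_ (c a) (allVec-complete xs c v)

bools : List Bool
bools = true ∷ false ∷ []

vertices : (m : ℕ) → List (Vertex m)
vertices m = allVec bools m

-- An edge of Q^m is given by a pair (v , i) with v_i = 0 (false);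
-- it joins v and flipAt v i.  Every edge of Q^m arises from exactly one such pair.
edges : (m : ℕ) → List (Vertex m × Fin m)
edges m = filter (λ e → T? (not (lookup (proj₁ e) (proj₂ e)))) (cartesianProduct (vertices m) (allFin m))

Joins : ∀ {m} → Vertex m × Fin m → Vertex m → Vertex m → Set
Joins (v , i) u w = (u ≡ v × w ≡ flipAt v i) ⊎ (u ≡ flipAt v i × w ≡ v)

numEdges : ℕ → ℕ
numEdges m = length (edges m)

-- An outcome of Q^m_p: one bit per edge of Q^m (true = edge kept).
record Outcome (m : ℕ) : Set where
  constructor mkOutcome
  field
    bits : Vec Bool (numEdges m)
open Outcome public

outcomes : (m : ℕ) → List (Outcome m)
outcomes m = Data.List.map mkOutcome (allVec bools (numEdges m))
  where import Data.List

Adj : ∀ {m} → Outcome m → Vertex m → Vertex m → Set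
Adj {m} ω u w = Any (λ eb → T (proj₂ eb) × Joins (proj₁ eb) u w) (zip (edges m) (toList (bits ω)))

weight : ∀ {m} → ℚ → Outcome m → ℚ
weight p ω = foldr (λ b r → (if b then p else (1ℚ -ℚ p)) *ℚ r) 1ℚ (toList (bits ω))

Prob : ∀ (m : ℕ) (p : ℚ) {P : Outcome m → Set} → (∀ ω → Dec (P ω)) → ℚ
Prob m p P? = foldr (λ ω r → (if does (P? ω) then weight p ω else 0ℚ) +ℚ r) 0ℚ (outcomes m)

ClosedWalk : ∀ {m} → Outcome m → List (Vertex m) → Set
ClosedWalk ω []       = Data.Empty.⊥
  where import Data.Empty
ClosedWalk ω (v ∷ vs) = Linked (Adj ω) (v ∷ vs ++ [ v ])

IsCycle : ∀ {m} → Outcome m → List (Vertex m) → Set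
IsCycle {m} ω vs = 3 ≤ length vs × UniqueDec.Unique (_≟V_ {m}) vs × ClosedWalk ω vs

-- the subgraph ω contains a cycle of length ℓ with ℓ ≥ 2^m / (4 m^32),
-- written without division as 2^m ≤ 4 * m^32 * ℓ
HasLongCycle : ∀ {m} → Outcome m → Set
HasLongCycle {m} ω = Σ (List (Vertex m)) λ vs → IsCycle ω vs × 2 ^ m ≤ 4 * m ^ 32 * length vs

Joins? : ∀ {m} e (u w : Vertex m) → Dec (Joins e u w)
Joins? (v , i) u w = ((u ≟V v) ×-dec (w ≟V flipAt v i)) ⊎-dec ((u ≟V flipAt v i) ×-dec (w ≟V v))

Adj? : ∀ {m} (ω : Outcome m) u w → Dec (Adj ω u w)
Adj? {m} ω u w = any? (λ eb → T? (proj₂ eb) ×-dec Joins? (proj₁ eb) u w) (zip (edges m) (toList (bits ω)))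

ClosedWalk? : ∀ {m} (ω : Outcome m) vs → Dec (ClosedWalk ω vs)
ClosedWalk? ω []       = no (λ ())
ClosedWalk? ω (v ∷ vs) = linked? (Adj? ω) (v ∷ vs ++ [ v ])

IsCycle? : ∀ {m} (ω : Outcome m) vs → Dec (IsCycle ω vs)
IsCycle? {m} ω vs = (3 ≤? length vs) ×-dec (UniqueDec.unique? (_≟V_ {m}) vs ×-dec ClosedWalk? ω vs)

unique-length : ∀ {A : Set} {xs ys : List A} → AllPairs (λ x y → ¬ x ≡ y) xs →
                (∀ {x} → x ∈ xs → x ∈ ys) → length xs ≤ length ys
unique-length {xs = []} _ _ = z≤n
unique-length {xs = x ∷ xs} {ys} (x∉ ∷ u) sub with ∈-∃++ (sub (here refl))
... | as , bs , refl =
  subst (_ ≤_) (sym eq) (s≤s (unique-length u sub'))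
  where
  eq : length (as ++ x ∷ bs) ≡ suc (length (as ++ bs))
  eq = trans (length-++ as) (trans (+-suc (length as) (length bs)) (cong suc (sym (length-++ as))))
  sub' : ∀ {y} → y ∈ xs → y ∈ as ++ bs
  sub' {y} y∈ with ∈-++⁻ as (sub (there y∈))
  ... | inj₁ p = ∈-++⁺ˡ p
  ... | inj₂ (here refl) = contradiction refl (All.lookup x∉ y∈)
  ... | inj₂ (there p) = ∈-++⁺ʳ as p

allLen : ∀ {A : Set} → List A → ℕ → List (List A)
allLen xs zero    = [ [] ]
allLen xs (suc k) = cartesianProductWith _∷_ xs (allLen xs k)

allUpTo : ∀ {A : Set} → List A → ℕ → List (List A)
allUpTo xs zero    = allLen xs zero
allUpTo xs (suc n) = allLen xs (suc n) ++ allUpTo xs n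

allLen-complete : ∀ {A : Set} {xs : List A} (vs : List A) → (∀ {x} → x ∈ vs → x ∈ xs) → vs ∈ allLen xs (length vs)
allLen-complete []       _   = here refl
allLen-complete (v ∷ vs) sub = ∈-cartesianProductWith⁺ _∷_ (sub (here refl)) (allLen-complete vs (λ p → sub (there p)))

allUpTo-complete : ∀ {A : Set} {xs : List A} n (vs : List A) → (∀ {x} → x ∈ vs → x ∈ xs) → length vs ≤ n → vs ∈ allUpTo xs n
allUpTo-complete {xs = xs} zero vs sub le =
  subst (λ k → vs ∈ allLen xs k) (Data.Nat.Properties.n≤0⇒n≡0 le) (allLen-complete vs sub)
  where import Data.Nat.Properties
allUpTo-complete {xs = xs} (suc n) vs sub le with m≤n⇒m<n∨m≡n le
... | inj₁ (s≤s lt) = ∈-++⁺ʳ (allLen xs (suc n)) (allUpTo-complete n vs sub lt)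
... | inj₂ eq = ∈-++⁺ˡ (subst (λ k → vs ∈ allLen xs k) eq (allLen-complete vs sub))

length-cpw : ∀ {A B C : Set} (f : A → B → C) (xs : List A) (ys : List B) →
             length (cartesianProductWith f xs ys) ≡ length xs * length ys
length-cpw f []       ys = refl
length-cpw f (x ∷ xs) ys =
  trans (length-++ (Data.List.map (f x) ys))
        (trans (cong (λ k → k + length (cartesianProductWith f xs ys)) (length-map (f x) ys))
               (cong (λ k → length ys + k) (length-cpw f xs ys)))
  where import Data.List; open import Data.List.Properties using (length-map)

length-vertices : ∀ m → length (vertices m) ≡ 2 ^ m
length-vertices zero = refl
length-vertices (suc m) = trans (length-cpw _∷_ bools (vertices m)) (cong (2 *_) (length-vertices m))

bool-complete : ∀ b → b ∈ bools
bool-complete true  = here refl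
bool-complete false = there (here refl)

HasLongCycle? : ∀ {m} (ω : Outcome m) → Dec (HasLongCycle ω)
HasLongCycle? {m} ω =
  map′ satisfied back (any? (λ vs → IsCycle? ω vs ×-dec (2 ^ m ≤? 4 * m ^ 32 * length vs)) (allUpTo (vertices m) (2 ^ m)))
  where
  back : HasLongCycle ω → Any _ _
  back (vs , cyc@(_ , u , _) , le) = lose (allUpTo-complete (2 ^ m) vs (λ _ → allVec-complete bools bool-complete _)
          (subst (length vs ≤_) (length-vertices m) (unique-length u (λ _ → allVec-complete bools bool-complete _)))) (cyc , le)

-- p = (1+ε)/m  (for m = 0 we set 1/m := 0; irrelevant asymptotically)

recipℕ : ℕ → ℚ
recipℕ zero    = 0ℚ
recipℕ (suc n) = + 1 / suc n

pOf : ℚ → ℕ → ℚ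
pOf ε m = (1ℚ +ℚ ε) *ℚ recipℕ m

ProbLongCycle : ℚ → ℕ → ℚ
ProbLongCycle ε m = Prob m (pOf ε m) (HasLongCycle? {m})

{-# OPTIONS --safe #-}

-- Expose the edges in two rounds with probabilities p₁ = (1 + σ)/m and p₂ ≥ σ/m, where 2σ ≤ ε.
--
-- First round.  A set S of at most 2^k vertices of the cube has at least (m − 2k)|S| boundary edges, so
-- an exploration of the components of the m neighbours of a vertex x dies out before reaching size
-- m·m⁹ only if an atypically large share of its queries fails; this has probability at most z^m with
-- z < 1 fixed.  Hence almost every vertex is adjacent to a component with at least m⁹ vertices.
--
-- A depth-first search, stopped as soon as the finished part X hanging from the top of the stack contains
-- many vertices of large components (it then contains at most two thirds of them), gives either a cycle
-- longer than ℓ or a set P of at most ℓ vertices separating X from the rest: X is only adjacent to the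
-- stack, and the lowest stack vertex adjacent to X closes a cycle through the whole stack above it.
--
-- Second round.  Given P, the large components of the first-round graph without P are split into two
-- classes A and B, which leaves few possibilities as these components are large.  Almost every vertex is
-- within distance 1 of A ∪ B, so the isoperimetric inequality |∂S| ≥ min(|S|, |Sᶜ|) yields many
-- edge-disjoint A–B paths of length at most 3 avoiding P, each of which is open with probability at
-- least (σ/m)³.  All of them are closed with a probability that beats the number of choices of P, A and B.

module Submission where

open import Defs

-- The depth-first search runs in the union of both rounds, so the sets that it returns depend on
-- the second round and cannot be fixed before that round is exposed. What can be fixed is a
-- certificate `(P , Z , Z′ , i)`, where `Z` and `Z′` pick one vertex from each large component.
-- Together with the first round it determines `A`, `B` and a family of paths in direction `i`, and
-- it takes only about 2^(m(ℓ + 2N)) values; enumerating `A` and `B` directly could cost as much as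
-- 2^(2^m).
--
-- The sizes come from this balance. About D = 2^m/m³ disjoint paths are all closed with probability
-- about exp(-σ³2^m/m⁶), so the number N = 2^m/r of large components must be far below 2^m/m⁷, which
-- r = m⁹ ensures. Deleting `P` then costs up to ℓ·m·r = ℓm¹⁰ vertices, and this loss, not the union
-- bound, is what limits ℓ to 2^m/m¹⁵.
--
-- Exploring from all m neighbours of x, instead of from x, turns a constant probability of early
-- extinction into z^m. Bad vertices thus become rarer than any power of 1/m, while the argument
-- tolerates a share of m⁻⁴.

-- Sums over the cube and edge isoperimetry.

module Cubes where

  open import Data.Bool using (Bool; true; false; not; _∧_)
  open import Data.Nat using (ℕ; zero; suc; _+_; _*_; _^_; _≤_; z≤n; s≤s)
  open import Data.Nat.Properties
  open import Data.Fin using (Fin; zero; suc)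
  open import Data.Vec using ([]; _∷_)
  open import Data.List using (List; []; _∷_; _++_; length; map; allFin; cartesianProduct)
  open import Data.List.Properties using (map-tabulate; length-tabulate)
  open import Data.List.Membership.Propositional using (_∈_)
  open import Data.List.Relation.Unary.Any using (here; there)
  open import Data.Product using (_×_; _,_)
  open import Data.Sum using (_⊎_; inj₁; inj₂)
  open import Function using (_∘_)
  open import Relation.Binary.PropositionalEquality
  open import Relation.Nullary using (contradiction)
  open import Data.Nat.Solver using (module +-*-Solver)
  open +-*-Solver using (solve; _:+_; _:*_; con; _:=_)

  ⟦_⟧ : Bool → ℕ
  ⟦ true  ⟧ = 1
  ⟦ false ⟧ = 0

  ∑ : {A : Set} → List A → (A → ℕ) → ℕ
  ∑ []       f = 0
  ∑ (x ∷ xs) f = f x + ∑ xs f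

  module _ {A : Set} where

    ∑-cong : ∀ (xs : List A) {f g} → (∀ x → f x ≡ g x) → ∑ xs f ≡ ∑ xs g
    ∑-cong []       e = refl
    ∑-cong (x ∷ xs) e = cong₂ _+_ (e x) (∑-cong xs e)

    ∑-mono : ∀ (xs : List A) {f g} → (∀ x → f x ≤ g x) → ∑ xs f ≤ ∑ xs g
    ∑-mono []       e = z≤n
    ∑-mono (x ∷ xs) e = +-mono-≤ (e x) (∑-mono xs e)

    ∑-++ : ∀ (xs ys : List A) f → ∑ (xs ++ ys) f ≡ ∑ xs f + ∑ ys f
    ∑-++ []       ys f = refl
    ∑-++ (x ∷ xs) ys f = trans (cong (f x +_) (∑-++ xs ys f)) (sym (+-assoc (f x) _ _))

    ∑-+ : ∀ (xs : List A) f g → ∑ xs (λ x → f x + g x) ≡ ∑ xs f + ∑ xs g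
    ∑-+ []       f g = refl
    ∑-+ (x ∷ xs) f g = trans (cong (f x + g x +_) (∑-+ xs f g))
      (solve 4 (λ a b c d → a :+ b :+ (c :+ d) := a :+ c :+ (b :+ d)) refl (f x) (g x) (∑ xs f) (∑ xs g))

    ∑-const : ∀ (xs : List A) c → ∑ xs (λ _ → c) ≡ length xs * c
    ∑-const []       c = refl
    ∑-const (x ∷ xs) c = cong (c +_) (∑-const xs c)

    ∑-∈ : ∀ {xs : List A} f {x} → x ∈ xs → f x ≤ ∑ xs f
    ∑-∈ f (here refl) = m≤m+n _ _
    ∑-∈ f (there p)   = ≤-trans (∑-∈ f p) (m≤n+m _ _)

    ∑-* : ∀ (xs : List A) c f → ∑ xs (λ x → c * f x) ≡ c * ∑ xs f
    ∑-* []       c f = sym (*-zeroʳ c)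
    ∑-* (x ∷ xs) c f = trans (cong (c * f x +_) (∑-* xs c f)) (sym (*-distribˡ-+ c (f x) _))

  ∑-map : ∀ {A B : Set} (h : A → B) xs f → ∑ (map h xs) f ≡ ∑ xs (f ∘ h)
  ∑-map h []       f = refl
  ∑-map h (x ∷ xs) f = cong (f (h x) +_) (∑-map h xs f)

  ∑-swap : ∀ {A B : Set} (xs : List A) (ys : List B) (f : A → B → ℕ) →
           ∑ xs (λ x → ∑ ys (f x)) ≡ ∑ ys (λ y → ∑ xs (λ x → f x y))
  ∑-swap []       ys f = sym (trans (∑-const ys 0) (*-zeroʳ (length ys)))
  ∑-swap (x ∷ xs) ys f = trans (cong (∑ ys (f x) +_) (∑-swap xs ys f)) (sym (∑-+ ys (f x) _))

  ∑-cartesianProduct : ∀ {A B : Set} (xs : List A) (ys : List B) (f : A × B → ℕ) →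
                       ∑ (cartesianProduct xs ys) f ≡ ∑ xs (λ x → ∑ ys (λ y → f (x , y)))
  ∑-cartesianProduct []       ys f = refl
  ∑-cartesianProduct (x ∷ xs) ys f = trans (∑-++ (map (x ,_) ys) _ f)
    (cong₂ _+_ (∑-map (x ,_) ys f) (∑-cartesianProduct xs ys f))

  ∑V : ∀ {m} → (Vertex m → ℕ) → ℕ
  ∑V {m} = ∑ (vertices m)

  ∑F : ∀ {m} → (Fin m → ℕ) → ℕ
  ∑F {m} = ∑ (allFin m)

  ∈-vertices : ∀ {m} (x : Vertex m) → x ∈ vertices m
  ∈-vertices = allVec-complete bools bool-complete

  ∑V-suc : ∀ {m} (f : Vertex (suc m) → ℕ) → ∑V f ≡ ∑V (f ∘ (true ∷_)) + ∑V (f ∘ (false ∷_))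
  ∑V-suc {m} f = trans (∑-++ (map (true ∷_) (vertices m)) _ f) (cong₂ _+_ (∑-map _ (vertices m) f)
    (trans (∑-++ (map (false ∷_) (vertices m)) [] f)
           (trans (+-identityʳ _) (∑-map _ (vertices m) f))))

  ∑F-suc : ∀ {m} (f : Fin (suc m) → ℕ) → ∑F f ≡ f zero + ∑F (f ∘ suc)
  ∑F-suc {m} f = cong (f zero +_)
    (trans (cong (λ l → ∑ l f) (sym (map-tabulate {n = m} (λ i → i) suc))) (∑-map suc (allFin m) f))

  ∑F-const : ∀ {m} c → ∑F {m} (λ _ → c) ≡ m * c
  ∑F-const {m} c = trans (∑-const (allFin m) c) (cong (_* c) (length-tabulate {n = m} (λ i → i)))

  ∑V-const : ∀ {m} c → ∑V {m} (λ _ → c) ≡ 2 ^ m * c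
  ∑V-const {m} c = trans (∑-const (vertices m) c) (cong (_* c) (length-vertices m))

  VSet : ℕ → Set
  VSet m = Vertex m → Bool

  ∣_∣ : ∀ {m} → VSet m → ℕ
  ∣ S ∣ = ∑V (λ x → ⟦ S x ⟧)

  ∣∣-suc : ∀ {m} (S : VSet (suc m)) → ∣ S ∣ ≡ ∣ S ∘ (true ∷_) ∣ + ∣ S ∘ (false ∷_) ∣
  ∣∣-suc S = ∑V-suc (λ x → ⟦ S x ⟧)

  ∑-∑F-suc : ∀ {m} (f : Vertex m → Fin (suc m) → ℕ) →
    ∑V (λ x → ∑F (f x)) ≡ ∑V (λ x → f x zero) + ∑V (λ x → ∑F (λ i → f x (suc i)))
  ∑-∑F-suc {m} f = trans (∑-cong (vertices m) (λ x → ∑F-suc (f x))) (∑-+ (vertices m) _ _)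

  -- Counts every edge inside S twice, once from each end.
  inner : ∀ {m} → VSet m → ℕ
  inner S = ∑V λ x → ∑F λ i → ⟦ S x ∧ S (flipAt x i) ⟧

  boundary : ∀ {m} → VSet m → ℕ
  boundary S = ∑V λ x → ∑F λ i → ⟦ S x ∧ not (S (flipAt x i)) ⟧

  ⟦∧⟧+⟦∧not⟧ : ∀ a b → ⟦ a ∧ b ⟧ + ⟦ a ∧ not b ⟧ ≡ ⟦ a ⟧
  ⟦∧⟧+⟦∧not⟧ true  true  = refl
  ⟦∧⟧+⟦∧not⟧ true  false = refl
  ⟦∧⟧+⟦∧not⟧ false b     = refl

  ⟦∧⟧≤ˡ : ∀ a b → ⟦ a ∧ b ⟧ ≤ ⟦ a ⟧
  ⟦∧⟧≤ˡ a b = subst (⟦ a ∧ b ⟧ ≤_) (⟦∧⟧+⟦∧not⟧ a b) (m≤m+n _ _)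

  ⟦∧⟧≤ʳ : ∀ a b → ⟦ a ∧ b ⟧ ≤ ⟦ b ⟧
  ⟦∧⟧≤ʳ true  b = ≤-refl
  ⟦∧⟧≤ʳ false b = z≤n

  inner+boundary : ∀ {m} (S : VSet m) → inner S + boundary S ≡ m * ∣ S ∣
  inner+boundary {m} S = begin
    inner S + boundary S
      ≡⟨ sym (∑-+ (vertices m) _ _) ⟩
    ∑V (λ x → ∑F (λ i → ⟦ S x ∧ S (flipAt x i) ⟧) + ∑F (λ i → ⟦ S x ∧ not (S (flipAt x i)) ⟧))
      ≡⟨ ∑-cong (vertices m) (λ x → trans (sym (∑-+ (allFin m) _ _))
           (trans (∑-cong (allFin m) (λ i → ⟦∧⟧+⟦∧not⟧ (S x) (S (flipAt x i)))) (∑F-const {m} ⟦ S x ⟧))) ⟩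
    ∑V (λ x → m * ⟦ S x ⟧)
      ≡⟨ ∑-* (vertices m) m _ ⟩
    m * ∣ S ∣ ∎
    where open ≡-Reasoning

  module _ {m} (S : VSet (suc m)) where
    private
      S₁ = S ∘ (true ∷_)
      S₀ = S ∘ (false ∷_)

    inner-suc : inner S ≡ (∑V (λ x → ⟦ S₁ x ∧ S₀ x ⟧) + inner S₁) + (∑V (λ x → ⟦ S₀ x ∧ S₁ x ⟧) + inner S₀)
    inner-suc = trans (∑V-suc {m} _) (cong₂ _+_ (∑-∑F-suc {m} (λ x i → ⟦ S₁ x ∧ S (flipAt (true ∷ x) i) ⟧))
                                            (∑-∑F-suc {m} (λ x i → ⟦ S₀ x ∧ S (flipAt (false ∷ x) i) ⟧)))

    boundary-suc : boundary S ≡ (∑V (λ x → ⟦ S₁ x ∧ not (S₀ x) ⟧) + boundary S₁)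
                              + (∑V (λ x → ⟦ S₀ x ∧ not (S₁ x) ⟧) + boundary S₀)
    boundary-suc = trans (∑V-suc {m} _)
      (cong₂ _+_ (∑-∑F-suc {m} (λ x i → ⟦ S₁ x ∧ not (S (flipAt (true ∷ x) i)) ⟧))
                 (∑-∑F-suc {m} (λ x i → ⟦ S₀ x ∧ not (S (flipAt (false ∷ x) i)) ⟧)))

  -- The smaller half of a set of size at most 2^(k+1) has size at most 2^k.
  inner-step : ∀ k {a b c c′ I J} → a ≤ b → c ≤ a → c′ ≤ a → a + b ≤ 2 ^ k →
    (∀ k → a ≤ 2 ^ k → I ≤ 2 * k * a) → (∀ k → b ≤ 2 ^ k → J ≤ 2 * k * b) →
    (c + I) + (c′ + J) ≤ 2 * k * (a + b)
  inner-step zero {suc a} {suc b} a≤b c≤a c′≤a (s≤s le) iI iJ =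
    contradiction (subst (_≤ 0) (+-suc a b) le) λ ()
  inner-step zero {zero} {b} a≤b z≤n z≤n le iI iJ =
    +-mono-≤ (iI 0 z≤n) (iJ 0 le)
  inner-step (suc k) {a} {b} {c} {c′} {I} {J} a≤b c≤a c′≤a le iI iJ = begin
    (c + I) + (c′ + J)
      ≤⟨ +-mono-≤ (+-mono-≤ c≤a (iI k half)) (+-mono-≤ c′≤a (iJ (suc k) (≤-trans (m≤n+m b a) le))) ⟩
    (a + 2 * k * a) + (a + 2 * suc k * b)
      ≡⟨ solve 3 (λ a b k → (a :+ con 2 :* k :* a) :+ (a :+ con 2 :* (con 1 :+ k) :* b)
                          := con 2 :* (con 1 :+ k) :* (a :+ b)) refl a b k ⟩
    2 * suc k * (a + b) ∎
    where
    open ≤-Reasoning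
    half : a ≤ 2 ^ k
    half = *-cancelˡ-≤ 2 (≤-trans (+-monoʳ-≤ a (subst (_≤ b) (sym (+-identityʳ a)) a≤b)) le)

  -- Induction on the dimension. The edges between the two halves of `S` are at most as many as the
  -- vertices of the smaller half, and that half fits under half the bound on `∣ S ∣`, which saves 2
  -- per vertex on its own inner edges. The saving pays for the cross edges, each counted from both
  -- ends. The factor 2, absent from the sharp bound, lets the induction run over integers `k`.
  inner-small : ∀ {m} (S : VSet m) k → ∣ S ∣ ≤ 2 ^ k → inner S ≤ 2 * k * ∣ S ∣
  inner-small {zero}  S k le = z≤n
  inner-small {suc m} S k le = subst₂ _≤_ (sym (inner-suc S)) (cong (2 * k *_) (sym (∣∣-suc S))) main
    where
    S₁ = S ∘ (true ∷_)
    S₀ = S ∘ (false ∷_)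
    x₁ = ∑V (λ x → ⟦ S₁ x ∧ S₀ x ⟧)
    x₀ = ∑V (λ x → ⟦ S₀ x ∧ S₁ x ⟧)
    le′ : ∣ S₁ ∣ + ∣ S₀ ∣ ≤ 2 ^ k
    le′ = subst (_≤ 2 ^ k) (∣∣-suc S) le
    main : (x₁ + inner S₁) + (x₀ + inner S₀) ≤ 2 * k * (∣ S₁ ∣ + ∣ S₀ ∣)
    main with ≤-total ∣ S₁ ∣ ∣ S₀ ∣
    ... | inj₁ p = inner-step k p (∑-mono (vertices m) (λ x → ⟦∧⟧≤ˡ (S₁ x) (S₀ x)))
                     (∑-mono (vertices m) (λ x → ⟦∧⟧≤ʳ (S₀ x) (S₁ x))) le′ (inner-small S₁) (inner-small S₀)
    ... | inj₂ p = subst₂ _≤_ (+-comm (x₀ + inner S₀) _) (cong (2 * k *_) (+-comm ∣ S₀ ∣ _))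
                     (inner-step k p (∑-mono (vertices m) (λ x → ⟦∧⟧≤ˡ (S₀ x) (S₁ x)))
                       (∑-mono (vertices m) (λ x → ⟦∧⟧≤ʳ (S₁ x) (S₀ x)))
                       (subst (_≤ 2 ^ k) (+-comm ∣ S₁ ∣ _) le′) (inner-small S₀) (inner-small S₁))

  -- Each vertex of `S` has `m` edge ends, and inner edges use at most `2 * k` of them on average.
  boundary-small : ∀ {m} (S : VSet m) k d → d + 2 * k ≤ m → ∣ S ∣ ≤ 2 ^ k → d * ∣ S ∣ ≤ boundary S
  boundary-small {m} S k d ≤m le = +-cancelˡ-≤ (2 * k * ∣ S ∣) _ _ (begin
    2 * k * ∣ S ∣ + d * ∣ S ∣     ≡⟨ sym (*-distribʳ-+ ∣ S ∣ (2 * k) d) ⟩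
    (2 * k + d) * ∣ S ∣           ≤⟨ *-monoˡ-≤ ∣ S ∣ (subst (_≤ m) (+-comm d _) ≤m) ⟩
    m * ∣ S ∣                     ≡⟨ sym (inner+boundary S) ⟩
    inner S + boundary S          ≤⟨ +-monoˡ-≤ (boundary S) (inner-small S k le) ⟩
    2 * k * ∣ S ∣ + boundary S    ∎)
    where open ≤-Reasoning

  ∣∣-≤-∖ : ∀ {m} (S T : VSet m) → ∣ S ∣ ≤ ∑V (λ x → ⟦ S x ∧ not (T x) ⟧) + ∣ T ∣
  ∣∣-≤-∖ {m} S T = subst (∣ S ∣ ≤_) (∑-+ (vertices m) _ _) (∑-mono (vertices m) (λ x → lem (S x) (T x)))
    where
    lem : ∀ a b → ⟦ a ⟧ ≤ ⟦ a ∧ not b ⟧ + ⟦ b ⟧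
    lem true  true  = s≤s z≤n
    lem true  false = s≤s z≤n
    lem false b     = z≤n

  -- The minimum of `S` and its complement is written as a disjunction. In the induction, two halves
  -- that satisfy the same alternative simply add up; `mixed` treats the others.
  isoperimetry : ∀ {m} (S : VSet m) → ∣ S ∣ ≤ boundary S ⊎ 2 ^ m ≤ ∣ S ∣ + boundary S
  isoperimetry {zero} S with S []
  ... | true  = inj₂ (s≤s z≤n)
  ... | false = inj₁ z≤n
  isoperimetry {suc m} S
    rewrite ∣∣-suc S | boundary-suc S =
    combine (isoperimetry S₁) (isoperimetry S₀) (∣∣-≤-∖ S₁ S₀) (∣∣-≤-∖ S₀ S₁)
    where
    S₁ = S ∘ (true ∷_)
    S₀ = S ∘ (false ∷_)

    -- Here `a`, `b` are the sizes of the two halves, `B`, `C` their boundaries, `u`, `v` the cross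
    -- edges leaving them, and `q` the number of vertices of a half cube. The cross edges make up
    -- for `b` exceeding `a`, so the boundary has at least `q` edges, and `q` is at least one of
    -- `a + b` and its complement in `q + q`.
    large : ∀ {a b u v B C q} → a ≤ B → q ≤ b + C → b ≤ v + a → q ≤ (u + B) + (v + C)
    large {a} {b} {u} {v} {B} {C} {q} a≤B q≤ b≤ = begin
      q                  ≤⟨ q≤ ⟩
      b + C              ≤⟨ +-monoˡ-≤ C b≤ ⟩
      v + a + C          ≤⟨ +-monoˡ-≤ C (+-monoʳ-≤ v (≤-trans a≤B (m≤n+m B u))) ⟩
      v + (u + B) + C    ≡⟨ solve 3 (λ v x c → v :+ x :+ c := x :+ (v :+ c)) refl v (u + B) C ⟩
      (u + B) + (v + C)  ∎
      where open ≤-Reasoning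

    mixed : ∀ {a b u v B C q} → a ≤ B → q ≤ b + C → b ≤ v + a →
            a + b ≤ (u + B) + (v + C) ⊎ q + q ≤ (a + b) + ((u + B) + (v + C))
    mixed {a} {b} {u} {v} {B} {C} {q} a≤B q≤ b≤ with ≤-total (a + b) q
    ... | inj₁ p = inj₁ (≤-trans p (large {u = u} a≤B q≤ b≤))
    ... | inj₂ p = inj₂ (+-mono-≤ p (large {u = u} a≤B q≤ b≤))

    combine : ∀ {a b u v B C q} → a ≤ B ⊎ q ≤ a + B → b ≤ C ⊎ q ≤ b + C → a ≤ u + b → b ≤ v + a →
              a + b ≤ (u + B) + (v + C) ⊎ q + (q + 0) ≤ (a + b) + ((u + B) + (v + C))
    combine {a} {b} {u} {v} {B} {C} {q} p r a≤ b≤ rewrite +-identityʳ q with p | r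
    ... | inj₁ x | inj₁ y = inj₁ (+-mono-≤ (≤-trans x (m≤n+m B u)) (≤-trans y (m≤n+m C v)))
    ... | inj₁ x | inj₂ y = mixed {u = u} x y b≤
    ... | inj₂ x | inj₁ y
      rewrite +-comm a b | +-comm (u + B) (v + C) = mixed {u = v} y x a≤
    ... | inj₂ x | inj₂ y = inj₂ (≤-trans (+-mono-≤ x y) (begin
        (a + B) + (b + C)                ≤⟨ +-mono-≤ (+-monoʳ-≤ a (m≤n+m B u)) (+-monoʳ-≤ b (m≤n+m C v)) ⟩
        (a + (u + B)) + (b + (v + C))    ≡⟨ solve 4 (λ a x b y → (a :+ x) :+ (b :+ y) := (a :+ b) :+ (x :+ y)) refl a (u + B) b (v + C) ⟩
        (a + b) + ((u + B) + (v + C))    ∎))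
      where open ≤-Reasoning

-- Edges, subgraphs and reachable sets of the cube.

module Subgraphs where

  open Cubes
  open import Data.Bool using (Bool; true; false; not; _∧_; _∨_; T)
  open import Data.Bool.Properties using (not-involutive) renaming (_≟_ to _≟ᵇ_)
  open import Data.Nat using (ℕ; zero; suc; _+_; _≤_; z≤n; s≤s)
  open import Data.Nat.Properties
  open import Data.Fin using (Fin; zero; suc)
  import Data.Fin.Properties as Fin
  open import Data.Vec using (Vec; []; _∷_; lookup; toList)
  open import Data.List using (List; []; _∷_; length; map; allFin; cartesianProduct; cartesianProductWith; zip; filter)
  import Data.List as List
  open import Data.List.Membership.Propositional using (_∈_)
  open import Data.List.Membership.Propositional.Properties using (∈-cartesianProductWith⁺; ∈-cartesianProduct⁺; ∈-filter⁺; ∈-filter⁻; ∈-allFin; ∈-map⁻)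
  open import Data.List.Relation.Unary.Any using (Any; here; there; index)
  open import Data.List.Relation.Unary.Any.Properties using (lookup-index)
  open import Data.List.Relation.Unary.All as All using (All; []; _∷_; all?)
  open import Data.List.Relation.Unary.AllPairs using ([]; _∷_)
  open import Data.List.Relation.Unary.Unique.Propositional using (Unique)
  import Data.List.Relation.Unary.Unique.Propositional.Properties as Unique
  open import Data.Product using (∃; ∃₂; _×_; _,_; proj₁; proj₂)
  open import Data.Sum using (_⊎_; inj₁; inj₂)
  open import Data.Empty using (⊥; ⊥-elim)
  open import Data.Unit using (tt)
  open import Axiom.UniquenessOfIdentityProofs.WithK using (uip)
  open import Data.List.Properties using (length-map)
  open import Function using (_∘_)
  open import Relation.Binary.PropositionalEquality
  open import Relation.Nullary using (Dec; yes; does)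
  open import Relation.Nullary.Decidable using (map′; _→-dec_; dec-true)

  true? : ∀ b → b ≡ true ⊎ b ≡ false
  true? true  = inj₁ refl
  true? false = inj₂ refl

  true≢false : ∀ {b} {X : Set} → b ≡ true → b ≡ false → X
  true≢false refl ()

  ∧-intro : ∀ {a b} → a ≡ true → b ≡ true → a ∧ b ≡ true
  ∧-intro refl refl = refl

  ∧-elimˡ : ∀ {a b} → a ∧ b ≡ true → a ≡ true
  ∧-elimˡ {true} _ = refl

  ∧-elimʳ : ∀ {a b} → a ∧ b ≡ true → b ≡ true
  ∧-elimʳ {true} p = p

  ∨-introˡ : ∀ {a b} → a ≡ true → a ∨ b ≡ true
  ∨-introˡ refl = refl

  ∨-introʳ : ∀ {a b} → b ≡ true → a ∨ b ≡ true
  ∨-introʳ {true}  _ = refl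
  ∨-introʳ {false} p = p

  ∨-elim : ∀ {a b} → a ∨ b ≡ true → a ≡ true ⊎ b ≡ true
  ∨-elim {true}  _ = inj₁ refl
  ∨-elim {false} p = inj₂ p

  not-intro : ∀ {a} → (a ≡ true → ⊥) → not a ≡ true
  not-intro {true}  f = ⊥-elim (f refl)
  not-intro {false} f = refl

  not-elim : ∀ {a} → not a ≡ true → a ≡ true → ⊥
  not-elim {true} () _

  false-intro : ∀ {a} → (a ≡ true → ⊥) → a ≡ false
  false-intro {true}  f = ⊥-elim (f refl)
  false-intro {false} f = refl

  does-true : ∀ {P : Set} (d : Dec P) → does d ≡ true → P
  does-true (yes p) _ = p

  ⟦⟧-mono : ∀ {a b} → (a ≡ true → b ≡ true) → ⟦ a ⟧ ≤ ⟦ b ⟧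
  ⟦⟧-mono {true}  f rewrite f refl = ≤-refl
  ⟦⟧-mono {false} f = z≤n

  ⟦⟧-true : ∀ {a} → a ≡ true → ⟦ a ⟧ ≡ 1
  ⟦⟧-true refl = refl

  ⟦⟧≤1 : ∀ a → ⟦ a ⟧ ≤ 1
  ⟦⟧≤1 true  = ≤-refl
  ⟦⟧≤1 false = z≤n

  ⟦⟧≤ : ∀ {a n} → (a ≡ true → 1 ≤ n) → ⟦ a ⟧ ≤ n
  ⟦⟧≤ {true}  f = f refl
  ⟦⟧≤ {false} f = z≤n

  ⟦∨⟧≤ : ∀ a b → ⟦ a ∨ b ⟧ ≤ ⟦ a ⟧ + ⟦ b ⟧
  ⟦∨⟧≤ true  b = s≤s z≤n
  ⟦∨⟧≤ false b = ≤-refl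

  search : ∀ {A : Set} (f : A → Bool) xs → (∃ λ x → x ∈ xs × f x ≡ true) ⊎ (∀ {x} → x ∈ xs → f x ≡ false)
  search f []       = inj₂ λ ()
  search f (x ∷ xs) with true? (f x) | search f xs
  ... | inj₁ p | _                  = inj₁ (x , here refl , p)
  ... | inj₂ _ | inj₁ (y , y∈ , q)  = inj₁ (y , there y∈ , q)
  ... | inj₂ n | inj₂ none          = inj₂ λ { (here refl) → n ; (there y∈) → none y∈ }

  searchV : ∀ {m} (f : Vertex m → Bool) → (∃ λ x → f x ≡ true) ⊎ (∀ x → f x ≡ false)
  searchV {m} f with search f (vertices m)
  ... | inj₁ (x , _ , p) = inj₁ (x , p)
  ... | inj₂ none        = inj₂ λ x → none (∈-vertices x)

  searchF : ∀ {m} (f : Fin m → Bool) → (∃ λ i → f i ≡ true) ⊎ (∀ i → f i ≡ false)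
  searchF {m} f with search f (allFin m)
  ... | inj₁ (i , _ , p) = inj₁ (i , p)
  ... | inj₂ none        = inj₂ λ i → none (∈-allFin i)

  searchVF : ∀ {m} (f : Vertex m → Fin m → Bool) → (∃₂ λ x i → f x i ≡ true) ⊎ (∀ x i → f x i ≡ false)
  searchVF {m} f with search (λ xi → f (proj₁ xi) (proj₂ xi)) (cartesianProduct (vertices m) (allFin m))
  ... | inj₁ ((x , i) , _ , p) = inj₁ (x , i , p)
  ... | inj₂ none              = inj₂ λ x i → none (∈-cartesianProduct⁺ (∈-vertices x) (∈-allFin i))

  allV? : ∀ {m} {P : Vertex m → Set} → (∀ x → Dec (P x)) → Dec (∀ x → P x)
  allV? {m} P? = map′ (λ ps x → All.lookup ps (∈-vertices x)) (λ f → All.tabulate (λ {x} _ → f x)) (all? P? (vertices m))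

  flipAt-involutive : ∀ {m} (x : Vertex m) i → flipAt (flipAt x i) i ≡ x
  flipAt-involutive (b ∷ x) zero    = cong (_∷ x) (not-involutive b)
  flipAt-involutive (b ∷ x) (suc i) = cong (b ∷_) (flipAt-involutive x i)

  flipAt-injective : ∀ {m} (x : Vertex m) {i j} → flipAt x i ≡ flipAt x j → i ≡ j
  flipAt-injective (b ∷ x) {zero}  {zero}  e = refl
  flipAt-injective (b ∷ x) {suc i} {suc j} e = cong suc (flipAt-injective x (cong Data.Vec.tail e))
  flipAt-injective (true  ∷ x) {zero} {suc j} ()
  flipAt-injective (false ∷ x) {zero} {suc j} ()
  flipAt-injective (true  ∷ x) {suc i} {zero} ()
  flipAt-injective (false ∷ x) {suc i} {zero} ()

  lower : ∀ {m} → Vertex m → Fin m → Vertex m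
  lower (b ∷ x) zero    = false ∷ x
  lower (b ∷ x) (suc i) = b ∷ lower x i

  lower-flipAt : ∀ {m} (x : Vertex m) i → lower (flipAt x i) i ≡ lower x i
  lower-flipAt (b ∷ x) zero    = refl
  lower-flipAt (b ∷ x) (suc i) = cong (b ∷_) (lower-flipAt x i)

  lower-case : ∀ {m} (x : Vertex m) i → x ≡ lower x i ⊎ x ≡ flipAt (lower x i) i
  lower-case (true  ∷ x) zero = inj₂ refl
  lower-case (false ∷ x) zero = inj₁ refl
  lower-case (b ∷ x) (suc i) with lower-case x i
  ... | inj₁ e = inj₁ (cong (b ∷_) e)
  ... | inj₂ e = inj₂ (cong (b ∷_) e)

  lower-lookup : ∀ {m} (x : Vertex m) i → lookup (lower x i) i ≡ false
  lower-lookup (b ∷ x) zero    = refl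
  lower-lookup (b ∷ x) (suc i) = lower-lookup x i

  lower-≡ : ∀ {m} {x y : Vertex m} {i} → lower x i ≡ lower y i → y ≡ x ⊎ y ≡ flipAt x i
  lower-≡ {x = x} {y} {i} e with lower-case x i | lower-case y i
  ... | inj₁ p | inj₁ q = inj₁ (trans q (trans (sym e) (sym p)))
  ... | inj₂ p | inj₂ q = inj₁ (trans q (trans (cong (λ z → flipAt z i) (sym e)) (sym p)))
  ... | inj₁ p | inj₂ q = inj₂ (trans q (trans (cong (λ z → flipAt z i) (sym e)) (cong (λ z → flipAt z i) (sym p))))
  ... | inj₂ p | inj₁ q = inj₂ (trans q (trans (sym e) (trans (sym (flipAt-involutive _ i)) (cong (λ z → flipAt z i) (sym p)))))

  ∈edges : ∀ {m} (x : Vertex m) i → lookup x i ≡ false → (x , i) ∈ edges m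
  ∈edges x i e = ∈-filter⁺ _ (∈-cartesianProduct⁺ (∈-vertices x) (∈-allFin i)) (subst (T ∘ not) (sym e) tt)

  abstract
    edge : ∀ {m} → Vertex m → Fin m → Fin (numEdges m)
    edge x i = index (∈edges (lower x i) i (lower-lookup x i))

    lookup-edge : ∀ {m} (x : Vertex m) i → List.lookup (edges m) (edge x i) ≡ (lower x i , i)
    lookup-edge x i = sym (lookup-index (∈edges (lower x i) i (lower-lookup x i)))

    edge-flipAt : ∀ {m} (x : Vertex m) i → edge (flipAt x i) i ≡ edge x i
    edge-flipAt {m} x i = same (lower-flipAt x i) _ _
      where
      -- `edge` is computed from a membership proof, so besides the lower ends the two proofs of
      -- `lookup y i ≡ false` have to be identified.
      same : ∀ {y z : Vertex m} → y ≡ z → (p : lookup y i ≡ false) (q : lookup z i ≡ false) →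
             index (∈edges y i p) ≡ index (∈edges z i q)
      same refl p q = cong (λ r → index (∈edges _ i r)) (uip p q)

  edge-injective : ∀ {m} {x y : Vertex m} {i j} → edge x i ≡ edge y j → i ≡ j × (y ≡ x ⊎ y ≡ flipAt x i)
  edge-injective {m} {x} {y} {i} {j} e
    with trans (sym (lookup-edge x i)) (trans (cong (List.lookup (edges m)) e) (lookup-edge y j))
  ... | eq with cong proj₂ eq
  ... | refl = refl , lower-≡ (cong proj₁ eq)

  zip-any : ∀ {A : Set} (xs : List A) (v : Vec Bool (length xs)) k {P : A → Set} →
            lookup v k ≡ true → P (List.lookup xs k) → Any (λ eb → T (proj₂ eb) × P (proj₁ eb)) (zip xs (toList v))
  zip-any (x ∷ xs) (b ∷ v) zero    refl p = here (tt , p)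
  zip-any (x ∷ xs) (b ∷ v) (suc k) e    p = there (zip-any xs v k e p)

  Bits : ℕ → Set
  Bits m = Vec Bool (numEdges m)

  -- A subgraph of the cube: H x i tells whether it contains the edge from x in direction i.
  Graph : ℕ → Set
  Graph m = Vertex m → Fin m → Bool

  Symmetric : ∀ {m} → Graph m → Set
  Symmetric H = ∀ x i → H x i ≡ true → H (flipAt x i) i ≡ true

  graph : ∀ {m} → Bits m → Graph m
  graph v x i = lookup v (edge x i)

  graph-sym : ∀ {m} (v : Bits m) → Symmetric {m} (graph v)
  graph-sym {m} v x i p = trans (cong (lookup v) (edge-flipAt x i)) p

  graph⇒Adj : ∀ {m} (v : Bits m) x i → graph v x i ≡ true → Adj (mkOutcome v) x (flipAt x i)
  graph⇒Adj {m} v x i p = zip-any (edges m) v (edge x i) p (subst (λ e → Joins e x (flipAt x i)) (sym (lookup-edge x i)) joins)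
    where
    joins : Joins (lower x i , i) x (flipAt x i)
    joins with lower-case x i
    ... | inj₁ e = inj₁ (e , cong (λ z → flipAt z i) e)
    ... | inj₂ e = inj₂ (e , trans (cong (λ z → flipAt z i) e) (flipAt-involutive _ i))

  _⊆_ : ∀ {m} → VSet m → VSet m → Set
  S ⊆ T = ∀ x → S x ≡ true → T x ≡ true

  Closed : ∀ {m} → Graph m → VSet m → Set
  Closed H T = ∀ x i → T x ≡ true → H x i ≡ true → T (flipAt x i) ≡ true

  ∣∣-mono : ∀ {m} {S T : VSet m} → S ⊆ T → ∣ S ∣ ≤ ∣ T ∣
  ∣∣-mono {m} S⊆T = ∑-mono (vertices m) (λ x → ⟦⟧-mono (S⊆T x))

  glue : ∀ {m} → VSet m → VSet m → VSet (suc m)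
  glue f g (true  ∷ x) = f x
  glue f g (false ∷ x) = g x

  allSets : ∀ m → List (VSet m)
  allSets zero    = (λ _ → true) ∷ (λ _ → false) ∷ []
  allSets (suc m) = cartesianProductWith glue (allSets m) (allSets m)

  -- Sets are functions, so the enumeration meets each of them only up to pointwise equality. This
  -- is enough to transfer inclusion and closedness in `reach-min`.
  allSets-complete : ∀ {m} (S : VSet m) → ∃ λ S′ → S′ ∈ allSets m × (∀ x → S′ x ≡ S x)
  allSets-complete {zero} S with S [] in eq
  ... | true  = (λ _ → true) , here refl , λ { [] → sym eq }
  ... | false = (λ _ → false) , there (here refl) , λ { [] → sym eq }
  allSets-complete {suc m} S with allSets-complete (S ∘ (true ∷_)) | allSets-complete (S ∘ (false ∷_))
  ... | f , f∈ , f≗ | g , g∈ , g≗ =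
    glue f g , ∈-cartesianProductWith⁺ glue f∈ g∈ , λ { (true ∷ x) → f≗ x ; (false ∷ x) → g≗ x }

  module _ {m} (H : Graph m) (Z : VSet m) where

    private
      In : Vertex m → VSet m → Set
      In x T = Z ⊆ T → Closed H T → T x ≡ true

      In? : ∀ x T → Dec (In x T)
      In? x T = allV? (λ y → (Z y ≟ᵇ true) →-dec (T y ≟ᵇ true))
        →-dec (allV? (λ y → Fin.all? (λ i → (T y ≟ᵇ true) →-dec ((H y i ≟ᵇ true) →-dec (T (flipAt y i) ≟ᵇ true))))
        →-dec (T x ≟ᵇ true))

    abstract
      -- The intersection of all `H`-closed sets containing `Z`, decided by running through
      -- `allSets`. Connectivity is thus handled by a universal property instead of walks.
      reach : VSet m
      reach x = does (all? (In? x) (allSets m))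

      reach-min : ∀ {T} → Z ⊆ T → Closed H T → reach ⊆ T
      reach-min {T} Z⊆T cl x p with allSets-complete T
      ... | T′ , T′∈ , eq = trans (sym (eq x)) (All.lookup (does-true (all? (In? x) (allSets m)) p) T′∈
            (λ y q → trans (eq y) (Z⊆T y q))
            (λ y i q r → trans (eq _) (cl y i (trans (sym (eq y)) q) r)))

      reach-⊇ : Z ⊆ reach
      reach-⊇ x z = dec-true (all? (In? x) (allSets m)) (All.tabulate (λ _ Z⊆T _ → Z⊆T x z))

      reach-closed : Closed H reach
      reach-closed x i p h = dec-true (all? (In? (flipAt x i)) (allSets m))
        (All.tabulate (λ T∈ Z⊆T cl → cl x i (All.lookup (does-true (all? (In? x) (allSets m)) p) T∈ Z⊆T cl) h))

  infix 4 _==_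
  _==_ : ∀ {m} → Vertex m → Vertex m → Bool
  x == y = does (x ≟V y)

  ==-refl : ∀ {m} (x : Vertex m) → (x == x) ≡ true
  ==-refl x = dec-true (x ≟V x) refl

  ==⇒≡ : ∀ {m} {x y : Vertex m} → (x == y) ≡ true → x ≡ y
  ==⇒≡ {x = x} {y} = does-true (x ≟V y)

  component : ∀ {m} → Graph m → Vertex m → VSet m
  component H x = reach H (_== x)

  ∈component : ∀ {m} (H : Graph m) x → component H x x ≡ true
  ∈component H x = reach-⊇ H _ x (==-refl x)

  component-min : ∀ {m} (H : Graph m) {x T} → T x ≡ true → Closed H T → component H x ⊆ T
  component-min H {x} {T} tx = reach-min H _ (λ y e → subst (λ z → T z ≡ true) (sym (==⇒≡ e)) tx)

  -- Since `H` is symmetric, the complement of the component of `y` is closed. If `x` were in it,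
  -- the whole component of `x` would be, and with it `y`.
  component-sym : ∀ {m} {H : Graph m} → Symmetric H → ∀ {x y} → component H x y ≡ true → component H y x ≡ true
  component-sym {H = H} H-sym {x} {y} y∈ with true? (component H y x)
  ... | inj₁ p = p
  ... | inj₂ n = ⊥-elim (not-elim (component-min H {T = not ∘ component H y} (cong not n) closed y y∈) (∈component H y))
    where
    closed : Closed H (not ∘ component H y)
    closed z i z∉ h = not-intro λ q → not-elim z∉
      (subst (λ w → component H y w ≡ true) (flipAt-involutive z i) (reach-closed H _ (flipAt z i) i q (H-sym z i h)))

  vertices-unique : ∀ m → Unique (vertices m)
  vertices-unique zero    = [] ∷ []
  vertices-unique (suc m) = Unique.cartesianProductWith⁺ _∷_ (λ { refl → refl , refl })
    (((λ ()) ∷ []) ∷ ([] ∷ [])) (vertices-unique m)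

  ∑-filter : ∀ {A : Set} (f : A → Bool) xs → ∑ xs (λ x → ⟦ f x ⟧) ≡ length (filter (λ x → f x ≟ᵇ true) xs)
  ∑-filter f []       = refl
  ∑-filter f (x ∷ xs) with f x
  ... | true  = cong suc (∑-filter f xs)
  ... | false = ∑-filter f xs

  map-unique : ∀ {A B : Set} (g : A → B) {xs} → (∀ {x y} → x ∈ xs → y ∈ xs → g x ≡ g y → x ≡ y) → Unique xs → Unique (map g xs)
  map-unique g inj []       = []
  map-unique g {x ∷ xs} inj (x∉ ∷ u) =
    All.tabulate (λ y∈ → case-∈ (∈-map⁻ g y∈)) ∷ map-unique g (λ p q → inj (there p) (there q)) u
    where
    case-∈ : ∀ {y} → (∃ λ x′ → x′ ∈ xs × y ≡ g x′) → g x ≢ y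
    case-∈ (x′ , x′∈ , refl) e = All.lookup x∉ x′∈ (inj (here refl) (there x′∈) e)

  ∑-injection : ∀ {A B : Set} (f : A → Bool) (g : A → B) {xs ys} → Unique xs →
    (∀ {x y} → f x ≡ true → f y ≡ true → g x ≡ g y → x ≡ y) → (∀ {x} → f x ≡ true → g x ∈ ys) →
    ∑ xs (λ x → ⟦ f x ⟧) ≤ length ys
  ∑-injection f g {xs} {ys} u inj sub = subst (_≤ length ys) (sym (trans (∑-filter f xs) (sym (length-map g (filter (λ x → f x ≟ᵇ true) xs)))))
    (unique-length (map-unique g (λ p q → inj (proj₂ (∈-filter⁻ f? {xs = xs} p)) (proj₂ (∈-filter⁻ f? {xs = xs} q))) (Unique.filter⁺ f? u)) sub′)
    where
    f? = λ x → f x ≟ᵇ true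
    sub′ : ∀ {y} → y ∈ map g (filter f? xs) → y ∈ ys
    sub′ y∈ with ∈-map⁻ g y∈
    ... | x , x∈ , refl = sub (proj₂ (∈-filter⁻ f? {xs = xs} x∈))

  unique⇒length≤ : ∀ {m} (S : VSet m) {xs} → Unique xs → (∀ {x} → x ∈ xs → S x ≡ true) → length xs ≤ ∣ S ∣
  unique⇒length≤ {m} S u sub = subst (_ ≤_) (sym (∑-filter S (vertices m)))
    (unique-length u (λ x∈ → ∈-filter⁺ (λ x → S x ≟ᵇ true) (∈-vertices _) (sub x∈)))

  covers⇒≤length : ∀ {m} (S : VSet m) {xs} → (∀ {x} → S x ≡ true → x ∈ xs) → ∣ S ∣ ≤ length xs
  covers⇒≤length {m} S sub = ∑-injection S (λ x → x) (vertices-unique m) (λ _ _ e → e) sub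

-- Expectation over independent bits.

module Expectation where

  open import Data.Bool using (Bool; true; false; not; _∧_; _∨_; if_then_else_)
  open import Data.Nat using (ℕ; zero; suc)
  open import Data.Fin using (Fin; zero; suc)
  open import Data.Vec using (Vec; []; _∷_; lookup; toList; _[_]≔_; zipWith)
  open import Data.List using (List; []; _∷_; _++_; length; map; foldr)
  open import Data.List.Membership.Propositional using (_∈_)
  open import Data.List.Relation.Unary.Any using (here; there)
  open import Data.List.Relation.Unary.All as All using (All; []; _∷_)
  open import Data.List.Relation.Unary.AllPairs using (AllPairs; []; _∷_)
  open import Data.Rational using (ℚ; 0ℚ; 1ℚ; _+_; _*_; _-_; -_; _≤_; nonNegative)
  open import Data.Rational.Properties
  open import Data.Rational.Solver using (module +-*-Solver)
  open +-*-Solver using (solve; _:+_; _:*_; _:-_; :-_; con; _:=_)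
  open import Function using (_∘_)
  open import Relation.Binary.PropositionalEquality
  open import Relation.Nullary using (Dec; does; yes; no; ¬_)
  open import Data.Fin.Properties using () renaming (_≟_ to _≟ᶠ_)
  open import Data.Vec.Properties using (lookup∘update; lookup∘update′)

  *-monoˡ : ∀ {r p q} → 0ℚ ≤ r → p ≤ q → r * p ≤ r * q
  *-monoˡ {r} 0≤r = *-monoˡ-≤-nonNeg r {{nonNegative 0≤r}}

  *-monoʳ : ∀ {r p q} → 0ℚ ≤ r → p ≤ q → p * r ≤ q * r
  *-monoʳ {r} 0≤r = *-monoʳ-≤-nonNeg r {{nonNegative 0≤r}}

  *-mono : ∀ {p q r s} → 0ℚ ≤ p → 0ℚ ≤ s → p ≤ q → r ≤ s → p * r ≤ q * s
  *-mono 0≤p 0≤s p≤q r≤s = ≤-trans (*-monoˡ 0≤p r≤s) (*-monoʳ 0≤s p≤q)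

  0≤* : ∀ {p q} → 0ℚ ≤ p → 0ℚ ≤ q → 0ℚ ≤ p * q
  0≤* {p} 0≤p 0≤q = ≤-trans (≤-reflexive (sym (*-zeroʳ p))) (*-monoˡ 0≤p 0≤q)

  0≤+ : ∀ {p q} → 0ℚ ≤ p → 0ℚ ≤ q → 0ℚ ≤ p + q
  0≤+ = +-mono-≤

  ≤⇒0≤- : ∀ {p q} → p ≤ q → 0ℚ ≤ q - p
  ≤⇒0≤- {p} {q} p≤q = ≤-trans (≤-reflexive (sym (+-inverseʳ p))) (+-monoˡ-≤ (- p) p≤q)

  0≤-⇒≤ : ∀ {p q} → 0ℚ ≤ q - p → p ≤ q
  0≤-⇒≤ {p} {q} h = ≤-trans (≤-reflexive (sym (+-identityˡ p))) (≤-trans (+-monoˡ-≤ p h)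
    (≤-reflexive (solve 2 (λ p q → q :- p :+ p := q) refl p q)))

  0≤1 : 0ℚ ≤ 1ℚ
  0≤1 = nonNegative⁻¹ 1ℚ

  infixr 8 _^_
  _^_ : ℚ → ℕ → ℚ
  p ^ zero  = 1ℚ
  p ^ suc n = p * p ^ n

  0≤^ : ∀ {p} n → 0ℚ ≤ p → 0ℚ ≤ p ^ n
  0≤^ zero    h = 0≤1
  0≤^ (suc n) h = 0≤* h (0≤^ n h)

  ^-mono : ∀ {p q} n → 0ℚ ≤ p → p ≤ q → p ^ n ≤ q ^ n
  ^-mono zero    0≤p p≤q = ≤-refl
  ^-mono (suc n) 0≤p p≤q = *-mono 0≤p (0≤^ n (≤-trans 0≤p p≤q)) p≤q (^-mono n 0≤p p≤q)

  ^≤1 : ∀ {p} n → 0ℚ ≤ p → p ≤ 1ℚ → p ^ n ≤ 1ℚ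
  ^≤1 zero    0≤p p≤1 = ≤-refl
  ^≤1 (suc n) 0≤p p≤1 = ≤-trans (*-mono 0≤p 0≤1 p≤1 (^≤1 n 0≤p p≤1)) (≤-reflexive (*-identityˡ 1ℚ))

  1≤^ : ∀ {p} n → 1ℚ ≤ p → 1ℚ ≤ p ^ n
  1≤^ zero    h = ≤-refl
  1≤^ {p} (suc n) h = ≤-trans (≤-reflexive (sym (*-identityˡ 1ℚ))) (*-mono 0≤1 (0≤^ n (≤-trans 0≤1 h)) h (1≤^ n h))

  ind : Bool → ℚ
  ind true  = 1ℚ
  ind false = 0ℚ

  0≤ind : ∀ b → 0ℚ ≤ ind b
  0≤ind true  = 0≤1
  0≤ind false = ≤-refl

  ind≤1 : ∀ b → ind b ≤ 1ℚ
  ind≤1 true  = ≤-refl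
  ind≤1 false = 0≤1

  ind-mono : ∀ {a b} → (a ≡ true → b ≡ true) → ind a ≤ ind b
  ind-mono {true}  f rewrite f refl = ≤-refl
  ind-mono {false} {b} f = 0≤ind b

  sumℚ : {A : Set} → List A → (A → ℚ) → ℚ
  sumℚ []       f = 0ℚ
  sumℚ (x ∷ xs) f = f x + sumℚ xs f

  module _ {A : Set} where

    sumℚ-cong : ∀ (xs : List A) {f g} → (∀ x → f x ≡ g x) → sumℚ xs f ≡ sumℚ xs g
    sumℚ-cong []       e = refl
    sumℚ-cong (x ∷ xs) e = cong₂ _+_ (e x) (sumℚ-cong xs e)

    sumℚ-++ : ∀ (xs ys : List A) f → sumℚ (xs ++ ys) f ≡ sumℚ xs f + sumℚ ys f
    sumℚ-++ []       ys f = sym (+-identityˡ _)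
    sumℚ-++ (x ∷ xs) ys f = trans (cong (f x +_) (sumℚ-++ xs ys f)) (sym (+-assoc (f x) _ _))

    sumℚ-* : ∀ (xs : List A) c f → sumℚ xs (λ x → c * f x) ≡ c * sumℚ xs f
    sumℚ-* []       c f = sym (*-zeroʳ c)
    sumℚ-* (x ∷ xs) c f = trans (cong (c * f x +_) (sumℚ-* xs c f)) (sym (*-distribˡ-+ c (f x) _))

    0≤sumℚ : ∀ (xs : List A) {f} → (∀ x → 0ℚ ≤ f x) → 0ℚ ≤ sumℚ xs f
    0≤sumℚ []       h = ≤-refl
    0≤sumℚ (x ∷ xs) h = 0≤+ (h x) (0≤sumℚ xs h)

    ∈⇒≤sumℚ : ∀ {xs : List A} {f x} → (∀ x → 0ℚ ≤ f x) → x ∈ xs → f x ≤ sumℚ xs f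
    ∈⇒≤sumℚ {_ ∷ xs} {f} {x} h (here refl) = ≤-trans (≤-reflexive (sym (+-identityʳ (f x)))) (+-monoʳ-≤ (f x) (0≤sumℚ xs h))
    ∈⇒≤sumℚ {y ∷ xs} {f} {x} h (there x∈) = ≤-trans (≤-reflexive (sym (+-identityˡ (f x)))) (+-mono-≤ (h y) (∈⇒≤sumℚ h x∈))

  sumℚ-map : ∀ {A B : Set} (h : A → B) xs f → sumℚ (map h xs) f ≡ sumℚ xs (f ∘ h)
  sumℚ-map h []       f = refl
  sumℚ-map h (x ∷ xs) f = cong (f (h x) +_) (sumℚ-map h xs f)

  -- Expectation over `n` independent bits, each `true` with probability `p`. `Prob≡E` identifies it
  -- with the weighted sum over outcomes; the recursive form gives linearity and conditioning by
  -- induction on the bits.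
  E : ∀ {n} → ℚ → (Vec Bool n → ℚ) → ℚ
  E {zero}  p f = f []
  E {suc n} p f = p * E p (λ v → f (true ∷ v)) + (1ℚ - p) * E p (λ v → f (false ∷ v))

  E-cong : ∀ {n} p {f g : Vec Bool n → ℚ} → (∀ v → f v ≡ g v) → E p f ≡ E p g
  E-cong {zero}  p e = e []
  E-cong {suc n} p e = cong₂ (λ a b → p * a + (1ℚ - p) * b) (E-cong {n} p (λ v → e (true ∷ v))) (E-cong {n} p (λ v → e (false ∷ v)))

  E-const : ∀ {n} p c → E {n} p (λ _ → c) ≡ c
  E-const {zero}  p c = refl
  E-const {suc n} p c rewrite E-const {n} p c = solve 2 (λ p c → p :* c :+ (con 1ℚ :- p) :* c := c) refl p c

  E-+ : ∀ {n} p (f g : Vec Bool n → ℚ) → E p (λ v → f v + g v) ≡ E p f + E p g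
  E-+ {zero}  p f g = refl
  E-+ {suc n} p f g rewrite E-+ p (λ v → f (true ∷ v)) (λ v → g (true ∷ v)) | E-+ p (λ v → f (false ∷ v)) (λ v → g (false ∷ v)) =
    solve 5 (λ p a b c d → p :* (a :+ b) :+ (con 1ℚ :- p) :* (c :+ d)
                        := p :* a :+ (con 1ℚ :- p) :* c :+ (p :* b :+ (con 1ℚ :- p) :* d)) refl p _ _ _ _

  E-* : ∀ {n} p c (f : Vec Bool n → ℚ) → E p (λ v → c * f v) ≡ c * E p f
  E-* {zero}  p c f = refl
  E-* {suc n} p c f rewrite E-* p c (λ v → f (true ∷ v)) | E-* p c (λ v → f (false ∷ v)) =
    solve 4 (λ p c a b → p :* (c :* a) :+ (con 1ℚ :- p) :* (c :* b) := c :* (p :* a :+ (con 1ℚ :- p) :* b)) refl p c _ _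

  E-sumℚ : ∀ {n} {A : Set} p (xs : List A) (f : A → Vec Bool n → ℚ) →
           E p (λ v → sumℚ xs (λ x → f x v)) ≡ sumℚ xs (λ x → E p (f x))
  E-sumℚ {n} p []       f = E-const {n} p 0ℚ
  E-sumℚ p (x ∷ xs) f = trans (E-+ p (f x) _) (cong (E p (f x) +_) (E-sumℚ p xs f))

  module _ {p} (0≤p : 0ℚ ≤ p) (p≤1 : p ≤ 1ℚ) where

    E-mono : ∀ {n} {f g : Vec Bool n → ℚ} → (∀ v → f v ≤ g v) → E p f ≤ E p g
    E-mono {zero}  h = h []
    E-mono {suc n} h = +-mono-≤ (*-monoˡ 0≤p (E-mono {n} (λ v → h (true ∷ v))))
                                (*-monoˡ (≤⇒0≤- p≤1) (E-mono {n} (λ v → h (false ∷ v))))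

    E-≤const : ∀ {n} {f : Vec Bool n → ℚ} {c} → (∀ v → f v ≤ c) → E p f ≤ c
    E-≤const {n} {c = c} h = ≤-trans (E-mono h) (≤-reflexive (E-const {n} p c))

  -- Conditioning on bit `e`. Once the bit is overwritten, averaging over its original value changes
  -- nothing, so the expectations on the right may still run over all bits.
  E-split : ∀ {n} p (f : Vec Bool n → ℚ) e →
            E p f ≡ p * E p (λ v → f (v [ e ]≔ true)) + (1ℚ - p) * E p (λ v → f (v [ e ]≔ false))
  E-split {suc n} p f zero =
    sym (cong₂ (λ a b → p * a + (1ℚ - p) * b) (E-const′ (λ v → f (true ∷ v))) (E-const′ (λ v → f (false ∷ v))))
    where
    E-const′ : ∀ (g : Vec Bool n → ℚ) → p * E p g + (1ℚ - p) * E p g ≡ E p g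
    E-const′ g = solve 2 (λ p c → p :* c :+ (con 1ℚ :- p) :* c := c) refl p (E p g)
  E-split {suc n} p f (suc e)
    rewrite E-split p (λ v → f (true ∷ v)) e | E-split p (λ v → f (false ∷ v)) e =
    solve 5 (λ p a b c d → p :* (p :* a :+ (con 1ℚ :- p) :* b) :+ (con 1ℚ :- p) :* (p :* c :+ (con 1ℚ :- p) :* d)
                        := p :* (p :* a :+ (con 1ℚ :- p) :* c) :+ (con 1ℚ :- p) :* (p :* b :+ (con 1ℚ :- p) :* d)) refl p _ _ _ _

  -- The sprinkling identity: a bit is `false` in the union of two independent rounds exactly when
  -- it is `false` in both.
  E-∨ : ∀ {n} p₁ p₂ (f : Vec Bool n → ℚ) →
        E (1ℚ - (1ℚ - p₁) * (1ℚ - p₂)) f ≡ E p₁ (λ v → E p₂ (λ w → f (zipWith _∨_ v w)))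
  E-∨ {zero}  p₁ p₂ f = refl
  E-∨ {suc n} p₁ p₂ f = begin
    p * E p fₜ + (1ℚ - p) * E p f₀
      ≡⟨ cong₂ (λ a b → p * a + (1ℚ - p) * b) (E-∨ p₁ p₂ fₜ) (E-∨ p₁ p₂ f₀) ⟩
    p * X + (1ℚ - p) * Y
      ≡⟨ solve 4 (λ p₁ p₂ X Y → let p = con 1ℚ :- (con 1ℚ :- p₁) :* (con 1ℚ :- p₂) in
           p :* X :+ (con 1ℚ :- p) :* Y
           := p₁ :* (p₂ :* X :+ (con 1ℚ :- p₂) :* X) :+ (con 1ℚ :- p₁) :* (p₂ :* X :+ (con 1ℚ :- p₂) :* Y)) refl p₁ p₂ X Y ⟩
    -- A bit that is open in the first round stays open whatever the second round does, hence `X`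
    -- twice in the first bracket.
    p₁ * (p₂ * X + (1ℚ - p₂) * X) + (1ℚ - p₁) * (p₂ * X + (1ℚ - p₂) * Y)
      ≡⟨ sym (cong₂ (λ a b → p₁ * a + (1ℚ - p₁) * b) (lin fₜ fₜ) (lin fₜ f₀)) ⟩
    E p₁ (λ v → E p₂ (λ w → f (zipWith _∨_ v w))) ∎
    where
    open ≡-Reasoning
    p = 1ℚ - (1ℚ - p₁) * (1ℚ - p₂)
    fₜ f₀ : Vec Bool n → ℚ
    fₜ v = f (true ∷ v)
    f₀ v = f (false ∷ v)
    EE : (Vec Bool n → ℚ) → ℚ
    EE g = E p₁ (λ v → E p₂ (λ w → g (zipWith _∨_ v w)))
    X = EE fₜ
    Y = EE f₀
    lin : ∀ g h → E p₁ (λ v → p₂ * E p₂ (λ w → g (zipWith _∨_ v w)) + (1ℚ - p₂) * E p₂ (λ w → h (zipWith _∨_ v w)))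
                ≡ p₂ * EE g + (1ℚ - p₂) * EE h
    lin g h = trans (E-+ {n} p₁ _ _) (cong₂ _+_ (E-* {n} p₁ p₂ _) (E-* {n} p₁ (1ℚ - p₂) _))

  wt : ∀ {n} → ℚ → Vec Bool n → ℚ
  wt p v = foldr (λ b r → (if b then p else (1ℚ - p)) * r) 1ℚ (toList v)

  sumℚ-wt : ∀ {n} p (f : Vec Bool n → ℚ) → sumℚ (allVec bools n) (λ v → wt p v * f v) ≡ E p f
  sumℚ-wt {zero}  p f = trans (+-identityʳ _) (*-identityˡ _)
  sumℚ-wt {suc n} p f = begin
    sumℚ (map (true ∷_) vs ++ (map (false ∷_) vs ++ [])) F
      ≡⟨ sumℚ-++ (map (true ∷_) vs) _ F ⟩
    sumℚ (map (true ∷_) vs) F + sumℚ (map (false ∷_) vs ++ []) F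
      ≡⟨ cong (sumℚ (map (true ∷_) vs) F +_) (trans (sumℚ-++ (map (false ∷_) vs) [] F) (+-identityʳ _)) ⟩
    sumℚ (map (true ∷_) vs) F + sumℚ (map (false ∷_) vs) F
      ≡⟨ cong₂ _+_ (half true p refl) (half false (1ℚ - p) refl) ⟩
    p * E p (λ v → f (true ∷ v)) + (1ℚ - p) * E p (λ v → f (false ∷ v)) ∎
    where
    open ≡-Reasoning
    vs = allVec bools n
    F : Vec Bool (suc n) → ℚ
    F v = wt p v * f v
    half : ∀ b q → (if b then p else (1ℚ - p)) ≡ q → sumℚ (map (b ∷_) vs) F ≡ q * E p (λ v → f (b ∷ v))
    half b q refl = trans (sumℚ-map (b ∷_) vs F) (trans (sumℚ-cong vs (λ v → *-assoc q (wt p v) _))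
      (trans (sumℚ-* vs q _) (cong (q *_) (sumℚ-wt p (λ v → f (b ∷ v))))))

  Prob≡E : ∀ m p {P : Outcome m → Set} (P? : ∀ ω → Dec (P ω)) →
           Prob m p P? ≡ E p (λ v → ind (does (P? (mkOutcome v))))
  Prob≡E m p P? = trans (go (allVec bools (numEdges m))) (sumℚ-wt {numEdges m} p _)
    where
    if-ind : ∀ b w → (if b then w else 0ℚ) ≡ w * ind b
    if-ind true  w = sym (*-identityʳ w)
    if-ind false w = sym (*-zeroʳ w)
    go : ∀ vs → foldr (λ ω r → (if does (P? ω) then weight p ω else 0ℚ) + r) 0ℚ (map mkOutcome vs)
              ≡ sumℚ vs (λ v → wt p v * ind (does (P? (mkOutcome v))))
    go []       = refl
    go (v ∷ vs) = cong₂ _+_ (if-ind (does (P? (mkOutcome v))) (wt p v)) (go vs)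

  allOpen : ∀ {n} → List (Fin n) → Vec Bool n → Bool
  allOpen []       v = true
  allOpen (e ∷ es) v = lookup v e ∧ allOpen es v

  noneOpen : ∀ {n} → List (List (Fin n)) → Vec Bool n → Bool
  noneOpen []         v = true
  noneOpen (es ∷ ess) v = not (allOpen es v) ∧ noneOpen ess v

  lookup-≔-true : ∀ {n} (v : Vec Bool n) e j → lookup v j ≡ true → lookup (v [ e ]≔ true) j ≡ true
  lookup-≔-true v e j p with e ≟ᶠ j
  ... | yes refl = lookup∘update e v true
  ... | no  e≢j  = trans (lookup∘update′ (e≢j ∘ sym) v true) p

  allOpen-≔-true : ∀ {n} es (v : Vec Bool n) e → allOpen es v ≡ true → allOpen es (v [ e ]≔ true) ≡ true
  allOpen-≔-true []       v e p = refl
  allOpen-≔-true (j ∷ es) v e p with lookup v j in eq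
  ... | true rewrite lookup-≔-true v e j eq = allOpen-≔-true es v e p

  allOpen-≔-∉ : ∀ {n} es (v : Vec Bool n) e b → ¬ e ∈ es → allOpen es (v [ e ]≔ b) ≡ allOpen es v
  allOpen-≔-∉ []       v e b e∉ = refl
  allOpen-≔-∉ (j ∷ es) v e b e∉ = cong₂ _∧_ (lookup∘update′ (λ j≡e → e∉ (here (sym j≡e))) v b) (allOpen-≔-∉ es v e b (e∉ ∘ there))

  noneOpen-≔-∉ : ∀ {n} ess (v : Vec Bool n) e b → All (λ es → ¬ e ∈ es) ess → noneOpen ess (v [ e ]≔ b) ≡ noneOpen ess v
  noneOpen-≔-∉ []         v e b []        = refl
  noneOpen-≔-∉ (es ∷ ess) v e b (e∉ ∷ r) = cong₂ (λ x y → not x ∧ y) (allOpen-≔-∉ es v e b e∉) (noneOpen-≔-∉ ess v e b r)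

  ind-∧ : ∀ a b → ind (a ∧ b) ≡ ind a * ind b
  ind-∧ true  b = sym (*-identityˡ (ind b))
  ind-∧ false b = sym (*-zeroˡ (ind b))

  Disjoint : ∀ {n} → List (Fin n) → List (Fin n) → Set
  Disjoint es fs = ∀ {e} → e ∈ es → ¬ e ∈ fs

  module _ {p} (0≤p : 0ℚ ≤ p) (p≤1 : p ≤ 1ℚ) where

    -- Expose the edges of `es` one at a time: if the first is closed the event has occurred,
    -- otherwise it must occur among the rest. Setting an edge open can only help the others to be
    -- all open; this covers repetitions in `es` and is why the claim is an inequality. The factor
    -- `g` stands for events on other edges, which the exposure does not affect.
    E-notAllOpen : ∀ {n} es (g : Vec Bool n → ℚ) → (∀ v → 0ℚ ≤ g v) → (∀ {e} b v → e ∈ es → g (v [ e ]≔ b) ≡ g v) →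
                   E p (λ v → ind (not (allOpen es v)) * g v) ≤ (1ℚ - p ^ length es) * E p g
    E-notAllOpen {n} [] g 0≤g inv = ≤-reflexive (E-* {n} p 0ℚ g)
    E-notAllOpen {n} (e ∷ es) g 0≤g inv = begin
      E p f
        ≡⟨ E-split p f e ⟩
      p * E p (λ v → f (v [ e ]≔ true)) + (1ℚ - p) * E p (λ v → f (v [ e ]≔ false))
        ≤⟨ +-mono-≤ (*-monoˡ 0≤p (E-mono 0≤p p≤1 {n} on)) (*-monoˡ (≤⇒0≤- p≤1) (E-mono 0≤p p≤1 {n} off)) ⟩
      p * E p (λ v → ind (not (allOpen es v)) * g v) + (1ℚ - p) * E p g
        ≤⟨ +-monoˡ-≤ _ (*-monoˡ 0≤p (E-notAllOpen es g 0≤g (λ b v e∈ → inv b v (there e∈)))) ⟩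
      p * ((1ℚ - p ^ length es) * E p g) + (1ℚ - p) * E p g
        ≡⟨ solve 3 (λ p x g → p :* ((con 1ℚ :- x) :* g) :+ (con 1ℚ :- p) :* g := (con 1ℚ :- p :* x) :* g) refl p (p ^ length es) (E p g) ⟩
      (1ℚ - p ^ length (e ∷ es)) * E p g ∎
      where
      open ≤-Reasoning
      f : Vec Bool n → ℚ
      f v = ind (not (lookup v e ∧ allOpen es v)) * g v
      not-anti : ∀ {a b} → (a ≡ true → b ≡ true) → not b ≡ true → not a ≡ true
      not-anti {true}  h q rewrite h refl = q
      not-anti {false} h q = refl
      on : ∀ v → f (v [ e ]≔ true) ≤ ind (not (allOpen es v)) * g v
      on v rewrite inv true v (here refl) | lookup∘update e v true =
        *-monoʳ (0≤g v) (ind-mono (not-anti (allOpen-≔-true es v e)))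
      off : ∀ v → f (v [ e ]≔ false) ≤ g v
      off v rewrite inv false v (here refl) | lookup∘update e v false = ≤-reflexive (*-identityˡ (g v))

    -- Disjoint lists behave independently: the first one is split off with the indicator of the
    -- remaining ones in the role of `g`.
    E-noneOpen : ∀ {n q} (ess : List (List (Fin n))) → q ≤ 1ℚ → All (λ es → q ≤ p ^ length es) ess → AllPairs Disjoint ess →
                 E p (λ v → ind (noneOpen ess v)) ≤ (1ℚ - q) ^ length ess
    E-noneOpen {n} [] q≤1 [] [] = ≤-reflexive (E-const {n} p 1ℚ)
    E-noneOpen {n} {q} (es ∷ ess) q≤1 (q≤ ∷ qs) (d ∷ ds) = begin
      E p (λ v → ind (not (allOpen es v) ∧ noneOpen ess v))
        ≡⟨ E-cong {n} p (λ v → ind-∧ (not (allOpen es v)) (noneOpen ess v)) ⟩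
      E p (λ v → ind (not (allOpen es v)) * ind (noneOpen ess v))
        ≤⟨ E-notAllOpen es _ (λ v → 0≤ind (noneOpen ess v))
             (λ b v e∈ → cong ind (noneOpen-≔-∉ ess v _ b (All.map (λ disj → disj e∈) d))) ⟩
      (1ℚ - p ^ length es) * E p (λ v → ind (noneOpen ess v))
        ≤⟨ *-mono (≤⇒0≤- (^≤1 (length es) 0≤p p≤1)) (0≤^ (length ess) (≤⇒0≤- q≤1))
             (+-monoʳ-≤ 1ℚ (neg-antimono-≤ q≤)) (E-noneOpen ess q≤1 qs ds) ⟩
      (1ℚ - q) * (1ℚ - q) ^ length ess ∎
      where open ≤-Reasoning

-- Exploration from a vertex set, and the bound on early extinction.

module Exploring where

  open Cubes
  open Subgraphs
  open Expectation
  open import Data.Bool using (Bool; true; false; not; _∧_; _∨_)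
  open import Data.Nat as ℕ using (ℕ; zero; suc)
  import Data.Nat.Properties as ℕ
  open import Data.Fin using (Fin; zero; suc)
  open import Data.Fin.Properties using () renaming (_≟_ to _≟ᶠ_)
  import Data.Fin.Properties as Fin
  open import Data.Vec using (Vec; []; _∷_; lookup; _[_]≔_)
  open import Data.Vec.Properties using (lookup∘update; lookup∘update′)
  open import Data.List using (List; []; _∷_; length; map; allFin)
  open import Data.List.Properties using (length-map; length-tabulate)
  open import Data.List.Membership.Propositional using (_∈_)
  open import Data.List.Membership.Propositional.Properties using (∈-map⁻)
  open import Data.List.Relation.Unary.Any using (here; there; any?)
  open import Data.List.Relation.Unary.AllPairs using ([]; _∷_)
  open import Data.List.Relation.Unary.All using ([]; _∷_)
  import Data.List.Relation.Unary.Unique.Propositional.Properties as Unique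
  open import Data.Rational using (ℚ; 0ℚ; 1ℚ; _+_; _*_; _-_; _≤_)
  open import Data.Rational.Properties
  open import Data.Rational.Solver using (module +-*-Solver)
  open +-*-Solver using (solve; _:+_; _:*_; _:-_; con; _:=_)
  open import Data.Product using (∃₂; _×_; _,_; proj₁; proj₂)
  open import Data.Sum using (inj₁; inj₂)
  open import Data.Empty using (⊥-elim)
  open import Relation.Binary.PropositionalEquality
  open import Relation.Nullary using (does; yes; no; ¬_)
  open import Relation.Nullary.Decidable using (dec-true; dec-false)

  ^-+ : ∀ x a b → x ^ (a ℕ.+ b) ≡ x ^ a * x ^ b
  ^-+ x zero    b = sym (*-identityˡ _)
  ^-+ x (suc a) b = trans (cong (x *_) (^-+ x a b)) (sym (*-assoc x _ _))

  ^-monoʳ : ∀ {x a b} → 1ℚ ≤ x → a ℕ.≤ b → x ^ a ≤ x ^ b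
  ^-monoʳ {x} {a} 1≤x a≤b with ℕ.m≤n⇒∃[o]m+o≡n a≤b
  ... | r , refl = ≤-trans (≤-reflexive (sym (*-identityʳ _)))
    (≤-trans (*-monoˡ (0≤^ a (≤-trans 0≤1 1≤x)) (1≤^ r 1≤x)) (≤-reflexive (sym (^-+ x a r))))

  ^-antimonoʳ : ∀ {x a b} → 0ℚ ≤ x → x ≤ 1ℚ → a ℕ.≤ b → x ^ b ≤ x ^ a
  ^-antimonoʳ {x} {a} 0≤x x≤1 a≤b with ℕ.m≤n⇒∃[o]m+o≡n a≤b
  ... | r , refl = ≤-trans (≤-reflexive (^-+ x a r))
    (≤-trans (*-monoˡ (0≤^ a 0≤x) (^≤1 r 0≤x x≤1)) (≤-reflexive (*-identityʳ _)))

  mem : ∀ {n} → Fin n → List (Fin n) → Bool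
  mem e F = does (any? (e ≟ᶠ_) F)

  insert : ∀ {m} → VSet m → Vertex m → VSet m
  insert S u x = S x ∨ (x == u)

  ∣singleton∣ : ∀ {m} (u : Vertex m) → ∣ (_== u) ∣ ≡ 1
  ∣singleton∣ u = ℕ.≤-antisym
    (covers⇒≤length (_== u) {u ∷ []} (λ e → here (==⇒≡ e)))
    (unique⇒length≤ (_== u) {u ∷ []} ([] ∷ []) (λ { (here refl) → ==-refl u }))

  ∣insert∣ : ∀ {m} (S : VSet m) u → S u ≡ false → ∣ insert S u ∣ ≡ suc ∣ S ∣
  ∣insert∣ {m} S u u∉ = trans (∑-cong (vertices m) pt) (trans (∑-+ (vertices m) _ _)
    (trans (cong (∣ S ∣ ℕ.+_) (∣singleton∣ u)) (ℕ.+-comm ∣ S ∣ 1)))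
    where
    pt : ∀ x → ⟦ S x ∨ (x == u) ⟧ ≡ ⟦ S x ⟧ ℕ.+ ⟦ x == u ⟧
    pt x with true? (x == u)
    ... | inj₁ e rewrite ==⇒≡ {x = x} e | u∉ = refl
    ... | inj₂ e rewrite e with S x
    ...   | true  = refl
    ...   | false = refl

  avoid : ∀ {m} → Bits m → List (Fin (numEdges m)) → Graph m
  avoid v F x i = lookup v (edge x i) ∧ not (mem (edge x i) F)

  -- A boundary edge is recorded from its end inside `S`, so distinct pairs give distinct edges. If
  -- all of them were in `F`, the boundary would have at most `length F` edges.
  boundary-edge : ∀ {m} (S : VSet m) F → length F ℕ.< boundary S →
    ∃₂ λ x i → S x ≡ true × S (flipAt x i) ≡ false × mem (edge x i) F ≡ false
  boundary-edge {m} S F lt with searchVF (λ x i → (S x ∧ not (S (flipAt x i))) ∧ not (mem (edge x i) F))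
  ... | inj₁ (x , i , p) = x , i , ∧-elimˡ (∧-elimˡ p) , false-intro (not-elim (∧-elimʳ {S x} (∧-elimˡ p)))
                         , false-intro (not-elim (∧-elimʳ {S x ∧ not (S (flipAt x i))} p))
  ... | inj₂ none = ⊥-elim (ℕ.<⇒≱ lt (subst (ℕ._≤ length F)
          (∑-cartesianProduct (vertices m) (allFin m) _)
          (∑-injection f (λ xi → edge (proj₁ xi) (proj₂ xi))
            (Unique.cartesianProduct⁺ (vertices-unique m) (Unique.allFin⁺ m)) inj sub)))
    where
    f : Vertex m × Fin m → Bool
    f (x , i) = S x ∧ not (S (flipAt x i))
    inj : ∀ {a b : Vertex m × Fin m} → f a ≡ true → f b ≡ true → edge (proj₁ a) (proj₂ a) ≡ edge (proj₁ b) (proj₂ b) → a ≡ b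
    inj {x , i} {y , j} p q e with edge-injective e
    ... | refl , inj₁ refl = refl
    ... | refl , inj₂ refl = ⊥-elim (not-elim (∧-elimʳ {S x} p) (∧-elimˡ q))
    sub : ∀ {a} → f a ≡ true → edge (proj₁ a) (proj₂ a) ∈ F
    sub {x , i} p with true? (mem (edge x i) F)
    ... | inj₁ e = does-true (any? (edge x i ≟ᶠ_) F) e
    ... | inj₂ e = true≢false (∧-intro p (cong not e)) (none x i)

  -- After f queried edges were found closed and s vertices were reached, y^f z^s bounds the probability
  -- that fewer than R vertices are reached in total: super makes it a supermartingale, and drift makes it
  -- at least 1 once all boundary edges are closed.
  module Exploration {m} {R k d : ℕ} (R≤ : R ℕ.≤ 2 ℕ.^ k) (d≤ : d ℕ.+ 2 ℕ.* k ℕ.≤ m)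
    {p y z : ℚ} (0≤p : 0ℚ ≤ p) (p≤1 : p ≤ 1ℚ) (1≤y : 1ℚ ≤ y) (0≤z : 0ℚ ≤ z) (z≤1 : z ≤ 1ℚ)
    (super : p * z + (1ℚ - p) * y ≤ 1ℚ) (drift : 1ℚ ≤ y ^ d * z) where

    private
      n = numEdges m
      0≤y = ≤-trans 0≤1 1≤y

    small : VSet m → Graph m → Bool
    small S H = does (∣ reach H S ∣ ℕ.<? R)

    small-mono : ∀ {S T H K} → (∀ x → reach K T x ≡ true → reach H S x ≡ true) → small S H ≡ true → small T K ≡ true
    small-mono {S} {T} {H} {K} sub q =
      dec-true (∣ reach K T ∣ ℕ.<? R) (ℕ.≤-<-trans (∣∣-mono {m} sub) (does-true (∣ reach H S ∣ ℕ.<? R) q))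

    Φ : ℕ → ℕ → ℚ
    Φ f s = y ^ f * z ^ s

    0≤Φ : ∀ f s → 0ℚ ≤ Φ f s
    0≤Φ f s = 0≤* (0≤^ f 0≤y) (0≤^ s 0≤z)

    1≤Φ : ∀ f s → d ℕ.* s ℕ.≤ f → 1ℚ ≤ Φ f s
    1≤Φ f s le = ≤-trans (go s) (*-monoʳ (0≤^ s 0≤z) (^-monoʳ 1≤y (subst (ℕ._≤ f) (ℕ.*-comm d s) le)))
      where
      go : ∀ s → 1ℚ ≤ y ^ (s ℕ.* d) * z ^ s
      go zero    = ≤-refl
      go (suc s) = begin
        1ℚ                                    ≡⟨ sym (*-identityˡ 1ℚ) ⟩
        1ℚ * 1ℚ                               ≤⟨ *-mono 0≤1 (0≤Φ (s ℕ.* d) s) drift (go s) ⟩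
        y ^ d * z * (y ^ (s ℕ.* d) * z ^ s)   ≡⟨ solve 4 (λ a b c e → a :* b :* (c :* e) := a :* c :* (b :* e)) refl (y ^ d) z (y ^ (s ℕ.* d)) (z ^ s) ⟩
        y ^ d * y ^ (s ℕ.* d) * (z * z ^ s)   ≡⟨ cong (_* (z * z ^ s)) (sym (^-+ y d (s ℕ.* d))) ⟩
        y ^ (suc s ℕ.* d) * z ^ suc s         ∎
        where open ≤-Reasoning

    -- `S` is the set reached so far and `F` the list of edges queried and found closed; an open
    -- query leaves no trace but the larger `S`. While `∣ S ∣ < R` and `length F < d * ∣ S ∣`, an
    -- unqueried boundary edge exists. Each query raises `∣ S ∣ + length F`, which these
    -- inequalities keep below `suc d * R`, so the fuel suffices.
    explore : ∀ fuel S F → suc d ℕ.* R ℕ.≤ fuel ℕ.+ (∣ S ∣ ℕ.+ length F) →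
              E {n} p (λ v → ind (small S (avoid v F))) ≤ Φ (length F) ∣ S ∣
    explore fuel S F le with R ℕ.≤? ∣ S ∣
    ... | yes R≤S = ≤-trans (E-≤const 0≤p p≤1 {n} (λ v → ≤-reflexive (cong ind
            (dec-false (∣ reach (avoid v F) S ∣ ℕ.<? R) (ℕ.≤⇒≯ (ℕ.≤-trans R≤S (∣∣-mono {m} (reach-⊇ _ S))))))))
            (0≤Φ (length F) ∣ S ∣)
    ... | no R≰S with d ℕ.* ∣ S ∣ ℕ.≤? length F
    ... | yes dS≤F = ≤-trans (E-≤const 0≤p p≤1 {n} (λ v → ind≤1 (small S (avoid v F)))) (1≤Φ (length F) ∣ S ∣ dS≤F)
    ... | no dS≰F = query fuel le (boundary-edge S F (ℕ.<-≤-trans F<dS (boundary-small S k d d≤ (ℕ.≤-trans (ℕ.<⇒≤ S<R) R≤))))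
      where
      S<R = ℕ.≰⇒> R≰S
      F<dS = ℕ.≰⇒> dS≰F
      query : ∀ fuel → suc d ℕ.* R ℕ.≤ fuel ℕ.+ (∣ S ∣ ℕ.+ length F) →
        (∃₂ λ x i → S x ≡ true × S (flipAt x i) ≡ false × mem (edge x i) F ≡ false) →
        E {n} p (λ v → ind (small S (avoid v F))) ≤ Φ (length F) ∣ S ∣
      query zero le _ = ⊥-elim (ℕ.<⇒≱ (ℕ.+-mono-<-≤ S<R (ℕ.≤-trans (ℕ.<⇒≤ F<dS) (ℕ.*-monoʳ-≤ d (ℕ.<⇒≤ S<R)))) le)
      query (suc fuel) le (x , i , x∈ , u∉ , e∉) = begin
        E {n} p f
          ≡⟨ E-split {n} p f e ⟩
        p * E {n} p (λ v → f (v [ e ]≔ true)) + (1ℚ - p) * E {n} p (λ v → f (v [ e ]≔ false))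
          ≤⟨ +-mono-≤ (*-monoˡ 0≤p (E-mono 0≤p p≤1 {n} on)) (*-monoˡ (≤⇒0≤- p≤1) (E-mono 0≤p p≤1 {n} off)) ⟩
        p * E {n} p (λ v → ind (small (insert S u) (avoid v F))) + (1ℚ - p) * E {n} p (λ v → ind (small S (avoid v (e ∷ F))))
          ≤⟨ +-mono-≤ (*-monoˡ 0≤p (≤-trans (explore fuel (insert S u) F le₁) (≤-reflexive (cong (Φ (length F)) size))))
                      (*-monoˡ (≤⇒0≤- p≤1) (explore fuel S (e ∷ F) le₀)) ⟩
        p * (y ^ length F * (z * z ^ ∣ S ∣)) + (1ℚ - p) * (y * y ^ length F * z ^ ∣ S ∣)
          ≡⟨ solve 5 (λ p y z a b → p :* (a :* (z :* b)) :+ (con 1ℚ :- p) :* (y :* a :* b)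
                                := (p :* z :+ (con 1ℚ :- p) :* y) :* (a :* b)) refl p y z (y ^ length F) (z ^ ∣ S ∣) ⟩
        (p * z + (1ℚ - p) * y) * Φ (length F) ∣ S ∣
          ≤⟨ *-monoʳ (0≤Φ (length F) ∣ S ∣) super ⟩
        1ℚ * Φ (length F) ∣ S ∣
          ≡⟨ *-identityˡ _ ⟩
        Φ (length F) ∣ S ∣ ∎
        where
        open ≤-Reasoning
        e = edge x i
        u = flipAt x i
        f : Bits m → ℚ
        f v = ind (small S (avoid v F))
        size : ∣ insert S u ∣ ≡ suc ∣ S ∣
        size = ∣insert∣ S u u∉
        le₁ : suc d ℕ.* R ℕ.≤ fuel ℕ.+ (∣ insert S u ∣ ℕ.+ length F)
        le₁ rewrite size = subst (suc d ℕ.* R ℕ.≤_) (sym (ℕ.+-suc fuel _)) le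
        le₀ : suc d ℕ.* R ℕ.≤ fuel ℕ.+ (∣ S ∣ ℕ.+ suc (length F))
        le₀ rewrite ℕ.+-suc ∣ S ∣ (length F) = subst (suc d ℕ.* R ℕ.≤_) (sym (ℕ.+-suc fuel _)) le
        -- With `e` open, `u` is within reach of `S`. Making `e` random again can only shrink what
        -- is reached from `insert S u`, so the recursive call may use a fresh outcome.
        on : ∀ v → f (v [ e ]≔ true) ≤ ind (small (insert S u) (avoid v F))
        on v = ind-mono (small-mono (reach-min _ _ sub closed))
          where
          K = avoid (v [ e ]≔ true) F
          open-e : K x i ≡ true
          open-e = ∧-intro (lookup∘update e v true) (cong not e∉)
          sub : insert S u ⊆ reach K S
          sub w q with ∨-elim {S w} q
          ... | inj₁ w∈ = reach-⊇ K S w w∈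
          ... | inj₂ w≡ rewrite ==⇒≡ {x = w} w≡ = reach-closed K S x i (reach-⊇ K S x x∈) open-e
          closed : Closed (avoid v F) (reach K S)
          closed w j w∈ h = reach-closed K S w j w∈ (∧-intro (lookup-≔-true v e (edge w j) (∧-elimˡ h)) (∧-elimʳ {lookup v (edge w j)} h))
        off : ∀ v → f (v [ e ]≔ false) ≤ ind (small S (avoid v (e ∷ F)))
        off v = ind-mono (small-mono (reach-min _ _ (reach-⊇ K S) closed))
          where
          K = avoid (v [ e ]≔ false) F
          closed : Closed (avoid v (e ∷ F)) (reach K S)
          closed w j w∈ h = reach-closed K S w j w∈ (∧-intro (trans (lookup∘update′ j≢e v false) (∧-elimˡ h)) j∉F)
            where
            j∉ : ¬ edge w j ∈ e ∷ F
            j∉ q = not-elim (∧-elimʳ {lookup v (edge w j)} h) (dec-true (any? (edge w j ≟ᶠ_) (e ∷ F)) q)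
            j≢e : edge w j ≢ e
            j≢e eq = j∉ (here eq)
            j∉F : not (mem (edge w j) F) ≡ true
            j∉F = not-intro (λ q → j∉ (there (does-true (any? (edge w j ≟ᶠ_) F) q)))

    E-small : ∀ S s → s ℕ.≤ ∣ S ∣ → E {n} p (λ v → ind (small S (graph v))) ≤ z ^ s
    E-small S s s≤ = begin
      E {n} p (λ v → ind (small S (graph v)))
        ≤⟨ E-mono 0≤p p≤1 {n} (λ v → ind-mono (small-mono (reach-min _ S (reach-⊇ _ S)
             (λ x i x∈ h → reach-closed (graph v) S x i x∈ (∧-elimˡ h))))) ⟩
      E {n} p (λ v → ind (small S (avoid v [])))
        ≤⟨ explore (suc d ℕ.* R) S [] (ℕ.m≤m+n _ _) ⟩
      1ℚ * z ^ ∣ S ∣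
        ≡⟨ *-identityˡ _ ⟩
      z ^ ∣ S ∣
        ≤⟨ ^-antimonoʳ 0≤z z≤1 s≤ ⟩
      z ^ s ∎
      where open ≤-Reasoning

  neighbours : ∀ {m} → Vertex m → VSet m
  neighbours v x = does (Fin.any? (λ i → x ≟V flipAt v i))

  ∣neighbours∣ : ∀ {m} (v : Vertex m) → m ℕ.≤ ∣ neighbours v ∣
  ∣neighbours∣ {m} v = subst (ℕ._≤ ∣ neighbours v ∣) (trans (length-map (flipAt v) (allFin m)) (length-tabulate {n = m} (λ i → i)))
    (unique⇒length≤ (neighbours v) (Unique.map⁺ (flipAt-injective v) (Unique.allFin⁺ m)) sub)
    where
    sub : ∀ {x} → x ∈ map (flipAt v) (allFin m) → neighbours v x ≡ true
    sub x∈ with ∈-map⁻ (flipAt v) x∈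
    ... | i , _ , refl = dec-true (Fin.any? (λ j → flipAt v i ≟V flipAt v j)) (i , refl)

-- Depth-first search: a long cycle or a small separator.

module DepthFirstSearch where

  open Cubes
  open Subgraphs
  open Exploring using (insert; ∣insert∣; ∣singleton∣)
  open import Data.Bool using (true; false; not; _∧_; _∨_)
  open import Data.Nat using (ℕ; zero; suc; _+_; _^_; _≤_; _<_; z≤n; s≤s; _≤?_)
  open import Data.Nat.Properties
  open import Data.Fin using (zero; suc)
  open import Data.List using (List; []; _∷_; [_]; _++_; length)
  open import Data.List.Properties using (++-assoc; length-++)
  open import Data.List.Membership.Propositional using (_∈_)
  open import Data.List.Membership.Propositional.Properties using (∈-++⁻; ∈-++⁺ˡ; ∈-++⁺ʳ)
  open import Data.List.Relation.Unary.Any using (here; there)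
  open import Data.List.Relation.Unary.All as All using (All; []; _∷_)
  import Data.List.Relation.Unary.All.Properties as All
  open import Data.List.Relation.Unary.AllPairs using ([]; _∷_)
  open import Data.List.Relation.Unary.Linked using (Linked; []; [-]; _∷_)
  open import Data.List.Relation.Unary.Unique.Propositional using (Unique)
  import Data.List.Relation.Unary.Unique.Propositional.Properties as Unique
  open import Data.Product using (∃; ∃₂; _×_; _,_)
  open import Data.Sum using (_⊎_; inj₁; inj₂)
  open import Data.Empty using (⊥-elim)
  open import Relation.Binary.PropositionalEquality using (_≡_; refl; sym; trans; cong; subst)
  open import Relation.Nullary using (yes; no; ¬_)

  module _ {A : Set} where

    linked-++ : ∀ {R : A → A → Set} xs {v ys} → Linked R (xs ++ [ v ]) → Linked R (v ∷ ys) → Linked R (xs ++ v ∷ ys)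
    linked-++ []           l       l′ = l′
    linked-++ (a ∷ [])     (r ∷ _) l′ = r ∷ l′
    linked-++ (a ∷ b ∷ xs) (r ∷ l) l′ = r ∷ linked-++ (b ∷ xs) l l′

    linked-prefix : ∀ {R : A → A → Set} xs {v ys} → Linked R (xs ++ v ∷ ys) → Linked R (xs ++ [ v ])
    linked-prefix []           l       = [-]
    linked-prefix (a ∷ [])     (r ∷ _) = r ∷ [-]
    linked-prefix (a ∷ b ∷ xs) (r ∷ l) = r ∷ linked-prefix (b ∷ xs) l

    unique-prefix : ∀ (xs : List A) {ys} → Unique (xs ++ ys) → Unique xs
    unique-prefix []       u        = []
    unique-prefix (x ∷ xs) (x∉ ∷ u) = All.++⁻ˡ xs x∉ ∷ unique-prefix xs u

    data Top (v : A) : List A → Set where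
      top : ∀ {vs} → Top v (v ∷ vs)

  ∅ : ∀ {m} → VSet m
  ∅ _ = false

  _∪_ : ∀ {m} → VSet m → VSet m → VSet m
  (S ∪ T) x = S x ∨ T x

  _∩_ : ∀ {m} → VSet m → VSet m → VSet m
  (S ∩ T) x = S x ∧ T x

  delete : ∀ {m} → VSet m → Vertex m → VSet m
  delete S u x = S x ∧ not (x == u)

  ∣∪∣≤ : ∀ {m} (S T : VSet m) → ∣ S ∪ T ∣ ≤ ∣ S ∣ + ∣ T ∣
  ∣∪∣≤ {m} S T = ≤-trans (∑-mono (vertices m) (λ x → ⟦∨⟧≤ (S x) (T x))) (≤-reflexive (∑-+ (vertices m) _ _))

  ∣∅∣ : ∀ {m} → ∣ ∅ {m} ∣ ≡ 0
  ∣∅∣ {m} = trans (∑V-const {m} 0) (*-zeroʳ (2 ^ m))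

  ∣delete∣ : ∀ {m} (S : VSet m) u → S u ≡ true → ∣ delete S u ∣ < ∣ S ∣
  ∣delete∣ {m} S u u∈ = subst (_≤ ∣ S ∣) (∣insert∣ (delete S u) u u∉) (∣∣-mono {m} sub)
    where
    u∉ : delete S u u ≡ false
    u∉ = false-intro (λ q → not-elim (∧-elimʳ {S u} q) (==-refl u))
    sub : insert (delete S u) u ⊆ S
    sub x q with ∨-elim {delete S u x} q
    ... | inj₁ r = ∧-elimˡ r
    ... | inj₂ e rewrite ==⇒≡ {x = x} e = u∈

  delete-case : ∀ {m} (S : VSet m) u {x} → S x ≡ true → x ≡ u ⊎ delete S u x ≡ true
  delete-case S u {x} x∈ with true? (x == u)
  ... | inj₁ e = inj₁ (==⇒≡ e)
  ... | inj₂ e = inj₂ (∧-intro x∈ (cong not e))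

  module DFS {m} (H : Graph m) (H-sym : Symmetric H) (W : VSet m) (thr : ℕ) where

    infix 4 _~_
    _~_ : Vertex m → Vertex m → Set
    x ~ y = ∃ λ i → flipAt x i ≡ y × H x i ≡ true

    ~-sym : ∀ {x y} → x ~ y → y ~ x
    ~-sym {x} (i , refl , h) = i , flipAt-involutive x i , H-sym x i h

    weightOf : VSet m → ℕ
    weightOf D = ∣ D ∩ W ∣

    -- A simple path inside `D` from `x` to a neighbour of `v`. With `v` the top of the stack, it is
    -- the piece that closes a cycle from the finished part back to the stack.
    Attached : VSet m → Vertex m → Vertex m → Set
    Attached D v x = ∃ λ π → Linked _~_ (x ∷ π ++ [ v ]) × Unique (x ∷ π) × All (λ y → D y ≡ true) (x ∷ π)

    -- A state of the search: anc is the stack (top first), D the finished part hanging from the top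
    -- of the stack, T the unvisited part that is still relevant.
    record State (anc : List (Vertex m)) (D T : VSet m) : Set where
      field
        D-closed   : ∀ {x y} → D x ≡ true → x ~ y → D y ≡ true ⊎ y ∈ anc
        T-closed   : ∀ {x y} → T x ≡ true → x ~ y → T y ≡ true ⊎ y ∈ anc
        top-closed : ∀ {v y} → Top v anc → v ~ y → (D y ≡ true ⊎ T y ≡ true) ⊎ y ∈ anc
        D∩anc      : ∀ {x} → D x ≡ true → ¬ x ∈ anc
        T∩anc      : ∀ {x} → T x ≡ true → ¬ x ∈ anc
        unique     : Unique anc
        linked     : Linked _~_ anc
        attached   : ∀ {v x} → Top v anc → D x ≡ true → Attached D v x
    open State

    -- For an empty stack the second condition is void, so that any unvisited vertex may start a new
    -- tree.
    Candidate : List (Vertex m) → VSet m → Vertex m → Set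
    Candidate anc T u = T u ≡ true × (∀ {v} → Top v anc → v ~ u)

    candidate? : ∀ anc T → (∃ (Candidate anc T)) ⊎ (∀ {u} → ¬ Candidate anc T u)
    candidate? [] T with searchV T
    ... | inj₁ (u , p) = inj₁ (u , p , λ ())
    ... | inj₂ none    = inj₂ λ { {u} (p , _) → true≢false p (none u) }
    candidate? (v ∷ anc) T with searchF (λ i → H v i ∧ T (flipAt v i))
    ... | inj₁ (i , p) = inj₁ (flipAt v i , ∧-elimʳ {H v i} p , λ { top → i , refl , ∧-elimˡ p })
    ... | inj₂ none    = inj₂ λ { (p , f) → absurd p (f top) }
      where
      absurd : ∀ {u} → T u ≡ true → ¬ v ~ u
      absurd p (i , refl , h) = true≢false (∧-intro h p) (none i)

    -- The parent's finished part is set aside and the child starts from `∅`. This is sound because,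
    -- by `T-closed`, the unvisited part has no neighbours outside itself and the stack. It also
    -- means that a finished part grows only by merging whole subtrees, as `weight-pop` exploits.
    push : ∀ {anc D T u} → State anc D T → Candidate anc T u → State (u ∷ anc) ∅ (delete T u)
    push {anc} {D} {T} {u} st (u∈ , adj) = record
      { D-closed   = λ ()
      ; T-closed   = λ x∈ → nbr (∧-elimˡ x∈)
      ; top-closed = λ { top r → inj-T (nbr u∈ r) }
      ; D∩anc      = λ ()
      ; T∩anc      = λ { {x} x∈ (here refl) → not-elim (∧-elimʳ {T x} x∈) (==-refl x)
                       ; x∈ (there q) → T∩anc st (∧-elimˡ x∈) q }
      ; unique     = All.tabulate (λ { q refl → T∩anc st u∈ q }) ∷ unique st
      ; linked     = link anc (linked st) adj
      ; attached   = λ _ ()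
      }
      where
      nbr : ∀ {x y} → T x ≡ true → x ~ y → delete T u y ≡ true ⊎ y ∈ u ∷ anc
      nbr x∈ r with T-closed st x∈ r
      ... | inj₂ q = inj₂ (there q)
      ... | inj₁ y∈ with delete-case T u y∈
      ...   | inj₁ e = inj₂ (here e)
      ...   | inj₂ q = inj₁ q
      inj-T : ∀ {y} → delete T u y ≡ true ⊎ y ∈ u ∷ anc → (∅ {m} y ≡ true ⊎ delete T u y ≡ true) ⊎ y ∈ u ∷ anc
      inj-T (inj₁ q) = inj₁ (inj₂ q)
      inj-T (inj₂ q) = inj₂ q
      link : ∀ anc → Linked _~_ anc → (∀ {v} → Top v anc → v ~ u) → Linked _~_ (u ∷ anc)
      link []      l f = [-]
      link (v ∷ _) l f = ~-sym (f top) ∷ l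

    -- By `none`, the vertex `u` has no unvisited neighbour left, so `u` and its subtree join the
    -- parent's finished part. Paths of the subtree ended next to `u`; prolonged by `u` they end
    -- next to the parent.
    pop : ∀ {anc D T u D′ T′} → State anc D T → Candidate anc T u → State (u ∷ anc) D′ T′ →
          (∀ {v} → ¬ Candidate (u ∷ anc) T′ v) → (∀ x → delete T u x ≡ true → D′ x ≡ true ⊎ T′ x ≡ true) →
          State anc (D ∪ insert D′ u) T′
    pop {anc} {D} {T} {u} {D′} {T′} st (u∈ , adj) st′ none part = record
      { D-closed   = closed
      ; T-closed   = T′-closed
      ; top-closed = top-cl
      ; D∩anc      = disj
      ; T∩anc      = λ x∈ q → T∩anc st′ x∈ (there q)
      ; unique     = unique st
      ; linked     = linked st
      ; attached   = att
      }
      where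
      D″ = D ∪ insert D′ u
      old : ∀ {x} → D x ≡ true → D″ x ≡ true
      old p = ∨-introˡ p
      new : ∀ {x} → D′ x ≡ true → D″ x ≡ true
      new {x} p = ∨-introʳ {D x} (∨-introˡ p)
      root : D″ u ≡ true
      root = ∨-introʳ {D u} (∨-introʳ {D′ u} (==-refl u))
      cases : ∀ {x} → D″ x ≡ true → D x ≡ true ⊎ (D′ x ≡ true ⊎ x ≡ u)
      cases {x} p with ∨-elim {D x} p
      ... | inj₁ q = inj₁ q
      ... | inj₂ q with ∨-elim {D′ x} q
      ...   | inj₁ r = inj₂ (inj₁ r)
      ...   | inj₂ r = inj₂ (inj₂ (==⇒≡ r))
      noT′ : ∀ {y} → u ~ y → ¬ T′ y ≡ true
      noT′ r y∈ = none (y∈ , λ { top → r })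
      fromAnc : ∀ {y} → y ∈ u ∷ anc → D″ y ≡ true ⊎ y ∈ anc
      fromAnc (here refl) = inj₁ root
      fromAnc (there q)   = inj₂ q
      closed : ∀ {x y} → D″ x ≡ true → x ~ y → D″ y ≡ true ⊎ y ∈ anc
      closed p r with cases p
      ... | inj₁ q with D-closed st q r
      ...   | inj₁ z = inj₁ (old z)
      ...   | inj₂ z = inj₂ z
      closed p r | inj₂ (inj₁ q) with D-closed st′ q r
      ...   | inj₁ z = inj₁ (new z)
      ...   | inj₂ z = fromAnc z
      closed p r | inj₂ (inj₂ refl) with top-closed st′ top r
      ...   | inj₁ (inj₁ z) = inj₁ (new z)
      ...   | inj₁ (inj₂ z) = ⊥-elim (noT′ r z)
      ...   | inj₂ z = fromAnc z
      T′-closed : ∀ {x y} → T′ x ≡ true → x ~ y → T′ y ≡ true ⊎ y ∈ anc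
      T′-closed p r with T-closed st′ p r
      ... | inj₁ z           = inj₁ z
      ... | inj₂ (here refl) = ⊥-elim (noT′ (~-sym r) p)
      ... | inj₂ (there z)   = inj₂ z
      top-cl : ∀ {v y} → Top v anc → v ~ y → (D″ y ≡ true ⊎ T′ y ≡ true) ⊎ y ∈ anc
      top-cl {v} {y} t r with top-closed st t r
      ... | inj₂ z = inj₂ z
      ... | inj₁ (inj₁ z) = inj₁ (inj₁ (old z))
      ... | inj₁ (inj₂ z) with delete-case T u z
      ...   | inj₁ refl = inj₁ (inj₁ root)
      ...   | inj₂ q with part y q
      ...     | inj₁ d = inj₁ (inj₁ (new d))
      ...     | inj₂ t′ = inj₁ (inj₂ t′)
      disj : ∀ {x} → D″ x ≡ true → ¬ x ∈ anc
      disj p q with cases p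
      ... | inj₁ z           = D∩anc st z q
      ... | inj₂ (inj₁ z)    = D∩anc st′ z (there q)
      ... | inj₂ (inj₂ refl) = T∩anc st u∈ q
      att : ∀ {v x} → Top v anc → D″ x ≡ true → Attached D″ v x
      att {v} {x} t p with cases p
      ... | inj₁ z with attached st t z
      ...   | π , l , uq , all = π , l , uq , All.map old all
      att {v} {x} t p | inj₂ (inj₁ z) with attached st′ top z
      ...   | π , l , uq , all = π ++ [ u ]
              , subst (Linked _~_) (cong (x ∷_) (sym (++-assoc π [ u ] [ v ])))
                  (linked-++ (x ∷ π) l (~-sym (adj t) ∷ [-]))
              , Unique.++⁺ uq ([] ∷ []) (λ { (q , here refl) → D∩anc st′ (All.lookup all q) (here refl) })
              , All.++⁺ (All.map new all) (root ∷ [])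
      att {v} {x} t p | inj₂ (inj₂ refl) = [] , ~-sym (adj t) ∷ [-] , [] ∷ [] , root ∷ []

    record Found : Set where
      field
        {anc} : List (Vertex m)
        {D T} : VSet m
        state : State anc D T
        lower≤ : thr ≤ weightOf D
        ≤upper : weightOf D ≤ thr + thr

    record Finished (anc : List (Vertex m)) (D T : VSet m) : Set where
      field
        {D′ T′} : VSet m
        state   : State anc D′ T′
        light   : weightOf D′ < thr
        none    : ∀ {u} → ¬ Candidate anc T′ u
        D⊆      : D ⊆ D′
        T⊆      : ∀ x → T x ≡ true → D′ x ≡ true ⊎ T′ x ≡ true
        T′⊆     : T′ ⊆ T

    -- A merge joins two parts of weight below `thr` and one vertex. Hence a finished part cannot
    -- jump from below `thr` to above `thr + thr`.
    weight-pop : ∀ D D′ u → weightOf D < thr → weightOf D′ < thr → weightOf (D ∪ insert D′ u) ≤ thr + thr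
    weight-pop D D′ u a b = begin
      weightOf (D ∪ insert D′ u)                   ≤⟨ ∣∣-mono {m} sub ⟩
      ∣ (D ∩ W) ∪ ((D′ ∩ W) ∪ (_== u)) ∣           ≤⟨ ∣∪∣≤ (D ∩ W) _ ⟩
      weightOf D + ∣ (D′ ∩ W) ∪ (_== u) ∣          ≤⟨ +-monoʳ-≤ (weightOf D) (∣∪∣≤ (D′ ∩ W) (_== u)) ⟩
      weightOf D + (weightOf D′ + ∣ (_== u) ∣)     ≡⟨ cong (λ k → weightOf D + (weightOf D′ + k)) (∣singleton∣ u) ⟩
      weightOf D + (weightOf D′ + 1)               ≤⟨ +-mono-≤ (<⇒≤ a) (subst (_≤ thr) (+-comm 1 (weightOf D′)) b) ⟩
      thr + thr                                    ∎
      where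
      open ≤-Reasoning
      sub : ((D ∪ insert D′ u) ∩ W) ⊆ ((D ∩ W) ∪ ((D′ ∩ W) ∪ (_== u)))
      sub x p with ∨-elim {D x} (∧-elimˡ p)
      ... | inj₁ q = ∨-introˡ (∧-intro q (∧-elimʳ {(D ∪ insert D′ u) x} p))
      ... | inj₂ q with ∨-elim {D′ x} q
      ...   | inj₁ r = ∨-introʳ {(D ∩ W) x} (∨-introˡ (∧-intro r (∧-elimʳ {(D ∪ insert D′ u) x} p)))
      ...   | inj₂ r = ∨-introʳ {(D ∩ W) x} (∨-introʳ {(D′ ∩ W) x} r)

    -- The first recursive call explores below the candidate `u`, the second goes on with what that
    -- call left unvisited; both have lost `u` from `T`, so `fuel` need only exceed `∣ T ∣`.
    dfs : ∀ fuel {anc D T} → State anc D T → weightOf D ≤ thr + thr → ∣ T ∣ < fuel → Found ⊎ Finished anc D T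
    dfs (suc fuel) {anc} {D} {T} st le (s≤s T≤) with thr ≤? weightOf D
    ... | yes p = inj₁ record { state = st ; lower≤ = p ; ≤upper = le }
    ... | no ¬heavy with candidate? anc T
    ... | inj₂ none = inj₂ record { state = st ; light = ≰⇒> ¬heavy ; none = none
                                  ; D⊆ = λ _ p → p ; T⊆ = λ _ → inj₂ ; T′⊆ = λ _ p → p }
    ... | inj₁ (u , c@(u∈ , _)) with dfs fuel (push st c) ∅-light (<-≤-trans (∣delete∣ T u u∈) T≤)
      where
      ∅-light : weightOf ∅ ≤ thr + thr
      ∅-light = subst (_≤ thr + thr) (sym (∣∅∣ {m})) z≤n
    ... | inj₁ found = inj₁ found
    ... | inj₂ child
      with dfs fuel (pop st c (state child) (none child) (T⊆ child)) (weight-pop D (D′ child) u (≰⇒> ¬heavy) (light child))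
                    (≤-<-trans (∣∣-mono {m} (T′⊆ child)) (<-≤-trans (∣delete∣ T u u∈) T≤))
      where
      open Finished
    ... | inj₁ found = inj₁ found
    ... | inj₂ fin = inj₂ record
          { state = state fin ; light = light fin ; none = none fin
          ; D⊆ = λ x p → D⊆ fin x (∨-introˡ p)
          ; T⊆ = cover
          ; T′⊆ = λ x p → ∧-elimˡ (T′⊆ child x (T′⊆ fin x p)) }
      where
      open Finished
      cover : ∀ x → T x ≡ true → D′ fin x ≡ true ⊎ T′ fin x ≡ true
      cover x p with delete-case T u p
      ... | inj₁ refl = inj₁ (D⊆ fin x (∨-introʳ {D x} (∨-introʳ {D′ child x} (==-refl x))))
      ... | inj₂ q with T⊆ child x q
      ...   | inj₁ d = inj₁ (D⊆ fin x (∨-introʳ {D x} (∨-introˡ d)))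
      ...   | inj₂ t = T⊆ fin x t

    search-finds : thr ≤ ∣ W ∣ → Found
    search-finds thr≤ with dfs (suc ∣ (λ (_ : Vertex m) → true) ∣) start (subst (_≤ thr + thr) (sym (∣∅∣ {m})) z≤n) ≤-refl
      where
      start : State [] ∅ (λ _ → true)
      start = record { D-closed = λ () ; T-closed = λ _ _ → inj₁ refl ; top-closed = λ () ; D∩anc = λ () ; T∩anc = λ _ ()
                     ; unique = [] ; linked = [] ; attached = λ () }
    ... | inj₁ found = found
    -- Over an empty stack, finishing means that nothing is left unvisited; the finished part then
    -- contains all of `W` and cannot be light.
    ... | inj₂ fin = ⊥-elim (<⇒≱ light (≤-trans thr≤ (∣∣-mono {m} (λ x p → ∧-intro (all x) p))))
      where
      open Finished fin
      all : ∀ x → D′ x ≡ true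
      all x with T⊆ x refl
      ... | inj₁ d = d
      ... | inj₂ t = ⊥-elim (none (t , λ ()))

    LongCycle : ℕ → Set
    LongCycle ℓ = ∃₂ λ x vs → Unique (x ∷ vs) × Linked _~_ (x ∷ vs ++ [ x ]) × ℓ < length (x ∷ vs)

    record Separation (ℓ : ℕ) : Set where
      field
        X : VSet m
        P : List (Vertex m)
        P-short  : length P ≤ ℓ
        X-closed : ∀ {x y} → X x ≡ true → x ~ y → X y ≡ true ⊎ y ∈ P
        X∩P      : ∀ {x} → X x ≡ true → ¬ x ∈ P
        lower≤   : thr ≤ weightOf X
        ≤upper   : weightOf X ≤ thr + thr

    Touches : VSet m → Vertex m → Set
    Touches X q = ∃ λ x → X x ≡ true × q ~ x

    touches? : ∀ X q → Touches X q ⊎ ¬ Touches X q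
    touches? X q with searchF (λ i → H q i ∧ X (flipAt q i))
    ... | inj₁ (i , p) = inj₁ (flipAt q i , ∧-elimʳ {H q i} p , i , refl , ∧-elimˡ p)
    ... | inj₂ none = inj₂ λ { (x , x∈ , i , refl , h) → true≢false (∧-intro h x∈) (none i) }

    lastTouching : ∀ X anc → (∀ {q} → q ∈ anc → ¬ Touches X q) ⊎
      (∃₂ λ pre q → ∃ λ rest → anc ≡ pre ++ q ∷ rest × Touches X q × (∀ {q′} → q′ ∈ rest → ¬ Touches X q′))
    lastTouching X [] = inj₁ λ ()
    lastTouching X (a ∷ anc) with lastTouching X anc
    ... | inj₂ (pre , q , rest , refl , t , n) = inj₂ (a ∷ pre , q , rest , refl , t , n)
    ... | inj₁ n with touches? X a
    ...   | inj₁ t = inj₂ ([] , a , anc , refl , t , n)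
    ...   | inj₂ f = inj₁ λ { (here refl) → f ; (there q) → n q }

    -- The ancestor furthest from the top that has a neighbour in the finished part closes a cycle
    -- through the whole stack between them; if it is near, then few ancestors separate that part.
    cycleOrSeparation : ∀ ℓ → thr ≤ ∣ W ∣ → LongCycle ℓ ⊎ Separation ℓ
    cycleOrSeparation ℓ thr≤ with search-finds thr≤
    ... | record { anc = anc ; D = X ; state = st ; lower≤ = lo ; ≤upper = up } with lastTouching X anc
    ... | inj₁ n = inj₂ record { X = X ; P = [] ; P-short = z≤n ; X-closed = closed ; X∩P = λ _ () ; lower≤ = lo ; ≤upper = up }
      where
      closed : ∀ {x y} → X x ≡ true → x ~ y → X y ≡ true ⊎ y ∈ []
      closed p r with D-closed st p r
      ... | inj₁ z = inj₁ z
      ... | inj₂ z = ⊥-elim (n z (_ , p , ~-sym r))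
    ... | inj₂ (pre , q , rest , refl , (x , x∈ , q~x) , n) with length (pre ++ [ q ]) ≤? ℓ
    ... | yes short = inj₂ record { X = X ; P = pre ++ [ q ] ; P-short = short ; X-closed = closed
                                  ; X∩P = λ p z → D∩anc st p (embed z) ; lower≤ = lo ; ≤upper = up }
      where
      embed : ∀ {y} → y ∈ pre ++ [ q ] → y ∈ pre ++ q ∷ rest
      embed z with ∈-++⁻ pre z
      ... | inj₁ a = ∈-++⁺ˡ a
      ... | inj₂ (here e) = ∈-++⁺ʳ pre (here e)
      closed : ∀ {x y} → X x ≡ true → x ~ y → X y ≡ true ⊎ y ∈ pre ++ [ q ]
      closed p r with D-closed st p r
      ... | inj₁ z = inj₁ z
      ... | inj₂ z with ∈-++⁻ pre z
      ...   | inj₁ a = inj₂ (∈-++⁺ˡ a)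
      ...   | inj₂ (here e) = inj₂ (∈-++⁺ʳ pre (here e))
      ...   | inj₂ (there a) = ⊥-elim (n a (_ , p , ~-sym r))
    ... | no long = inj₁ (cyc (topOf pre))
      where
      -- The cycle goes from `x` through `X` to the top of the stack, along the stack to `q` and
      -- back to `x`. To apply `attached`, the top has to be exhibited as a head, whether it is `q`
      -- itself or the first vertex of `pre`.
      topOf : ∀ pre → ∃₂ λ v ys → (∀ zs → pre ++ q ∷ zs ≡ v ∷ ys ++ zs)
      topOf []        = q , [] , λ zs → refl
      topOf (a ∷ pre) = a , pre ++ [ q ] , λ zs → cong (a ∷_) (sym (++-assoc pre [ q ] zs))
      cyc : (∃₂ λ v ys → (∀ zs → pre ++ q ∷ zs ≡ v ∷ ys ++ zs)) → LongCycle ℓ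
      cyc (v , ys , eq) with attached st {v} (subst (Top v) (sym (eq rest)) top) x∈
      ... | π , l , uq , all = x , π ++ (pre ++ [ q ])
            , Unique.++⁺ uq (unique-prefix (pre ++ [ q ]) (subst Unique (sym (++-assoc pre [ q ] rest)) (unique st)))
                (λ { (a , b) → D∩anc st (All.lookup all a) (subst (_ ∈_) (++-assoc pre [ q ] rest) (∈-++⁺ˡ b)) })
            , subst (λ zs → Linked _~_ (x ∷ zs)) (trans (cong (π ++_) (trans (sym (eq [ x ])) (sym (++-assoc pre [ q ] [ x ]))))
                                                     (sym (++-assoc π (pre ++ [ q ]) [ x ])))
                (linked-++ (x ∷ π) l (subst (Linked _~_) (eq [ x ])
                  (linked-++ pre (linked-prefix pre (linked st)) (q~x ∷ [-]))))
            , <-≤-trans (≰⇒> long) (≤-trans (m≤n+m _ (length π)) (≤-trans (≤-reflexive (sym (length-++ π))) (n≤1+n _)))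

-- The loss caused by deleting `P`, and edge-disjoint short paths between two vertex sets.

module ShortPaths where

  open Cubes
  open Subgraphs
  open Expectation using (allOpen; noneOpen; Disjoint)
  open Exploring using (insert; ∣insert∣; ∣singleton∣; neighbours)
  open DepthFirstSearch
  open import Data.Bool using (Bool; true; false; not; _∧_; _∨_)
  open import Data.Bool.Properties using () renaming (_≟_ to _≟ᵇ_)
  open import Data.Nat using (ℕ; zero; suc; _+_; _*_; _^_; _≤_; z≤n; s≤s; _≤?_)
  open import Data.Nat.Properties
  open import Data.Fin using (Fin; zero; suc)
  open import Data.Vec using ([]; _∷_; lookup)
  open import Data.List using (List; []; _∷_; _++_; length; map; filter; allFin)
  open import Data.List.Properties using (length-++; length-map)
  open import Data.List.Membership.Propositional using (_∈_)
  open import Data.List.Membership.Propositional.Properties using (∈-++⁻; ∈-filter⁻; ∈-allFin)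
  open import Data.List.Relation.Unary.Any using (here; there; any?)
  open import Data.List.Relation.Unary.All as All using (All; []; _∷_)
  open import Data.List.Relation.Unary.AllPairs using (AllPairs; []; _∷_)
  import Data.List.Relation.Unary.AllPairs.Properties as AllPairs
  import Data.List.Relation.Unary.All.Properties as All
  open import Data.List.Relation.Unary.Unique.Propositional using (Unique)
  import Data.List.Relation.Unary.Unique.Propositional.Properties as Unique
  open import Data.Product using (∃; ∃₂; _×_; _,_; proj₂)
  open import Data.Sum using (_⊎_; inj₁; inj₂)
  open import Data.Empty using (⊥; ⊥-elim)
  open import Function using (_∘_)
  open import Relation.Binary.PropositionalEquality using (_≡_; _≢_; refl; sym; trans; cong; cong₂; subst; subst₂)
  open import Relation.Nullary using (¬_; does)
  open import Relation.Nullary.Decidable using (dec-true)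

  ∑V-flipAt : ∀ {m} (f : Vertex m → ℕ) i → ∑V (λ x → f (flipAt x i)) ≡ ∑V f
  ∑V-flipAt {suc m} f zero = trans (∑V-suc {m} _) (trans (+-comm (∑V (λ x → f (false ∷ x))) _) (sym (∑V-suc {m} f)))
  ∑V-flipAt {suc m} f (suc i) = trans (∑V-suc {m} _)
    (trans (cong₂ _+_ (∑V-flipAt (λ x → f (true ∷ x)) i) (∑V-flipAt (λ x → f (false ∷ x)) i)) (sym (∑V-suc {m} f)))

  ∑-∑-flipAt : ∀ {m} (S : VSet m) → ∑V (λ x → ∑F (λ i → ⟦ S (flipAt x i) ⟧)) ≡ m * ∣ S ∣
  ∑-∑-flipAt {m} S = trans (∑-swap (vertices m) (allFin m) _)
    (trans (∑-cong (allFin m) (λ i → ∑V-flipAt (λ x → ⟦ S x ⟧) i)) (∑F-const {m} ∣ S ∣))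

  pigeonhole : ∀ {m} (f : Fin m → ℕ) D → 1 ≤ m → m * D ≤ ∑F f → ∃ λ i → D ≤ f i
  pigeonhole {m} f D 1≤m le with searchF (λ i → does (D ≤? f i))
  ... | inj₁ (i , p) = i , does-true (D ≤? f i) p
  ... | inj₂ none = ⊥-elim (<⇒≱ (≤-trans (+-monoˡ-≤ (∑F f) 1≤m) sum<) le)
    where
    sum< : m + ∑F f ≤ m * D
    sum< = subst₂ _≤_ (trans (∑-+ (allFin m) (λ _ → 1) f) (cong (_+ ∑F f) (trans (∑F-const {m} 1) (*-identityʳ m))))
      (∑F-const {m} D) (∑-mono (allFin m) (λ i → ≰⇒> (λ q → true≢false (dec-true (D ≤? f i) q) (none i))))

  elem : ∀ {m} → List (Vertex m) → VSet m
  elem P x = does (any? (x ≟V_) P)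

  ∈⇒elem : ∀ {m} {P : List (Vertex m)} {x} → x ∈ P → elem P x ≡ true
  ∈⇒elem {P = P} {x} = dec-true (any? (x ≟V_) P)

  elem⇒∈ : ∀ {m} {P : List (Vertex m)} {x} → elem P x ≡ true → x ∈ P
  elem⇒∈ {P = P} {x} = does-true (any? (x ≟V_) P)

  remove : ∀ {m} → Graph m → List (Vertex m) → Graph m
  remove H P x i = H x i ∧ (not (elem P x) ∧ not (elem P (flipAt x i)))

  remove-sym : ∀ {m} {H : Graph m} P → Symmetric H → Symmetric (remove H P)
  remove-sym {H = H} P H-sym x i h rewrite flipAt-involutive x i =
    ∧-intro (H-sym x i (∧-elimˡ h)) (∧-intro (∧-elimʳ {not (elem P x)} r) (∧-elimˡ r))
    where r = ∧-elimʳ {H x i} h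

  big : ∀ {m} → ℕ → Graph m → VSet m
  big r H x = does (r ≤? ∣ component H x ∣)

  module Lost {m} {H : Graph m} (H-sym : Symmetric H) (P : List (Vertex m)) (r : ℕ) where

    K : Graph m
    K = remove H P

    lost : VSet m
    lost x = big r H x ∧ (not (elem P x) ∧ not (big r K x))

    smallComponent : Vertex m → VSet m
    smallComponent y x = component K y x ∧ not (big r K y)

    ∣smallComponent∣≤ : ∀ y → ∣ smallComponent y ∣ ≤ r
    ∣smallComponent∣≤ y with true? (big r K y)
    ... | inj₁ b = subst (_≤ r) (sym zero-sum) z≤n
      where
      zero-sum : ∣ smallComponent y ∣ ≡ 0
      zero-sum = trans (∑-cong (vertices m) (λ x → cong ⟦_⟧ (false-intro {smallComponent y x}
        (λ q → not-elim (∧-elimʳ {component K y x} q) b)))) (∣∅∣ {m})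
    ... | inj₂ b = ≤-trans (∣∣-mono {m} {T = component K y} (λ x q → ∧-elimˡ q))
        (<⇒≤ (≰⇒> (λ q → true≢false (dec-true (r ≤? ∣ component K y ∣) q) b)))

    -- The component of `x` in `K` is too small to be closed in `H`, so an edge of `H` leaves it.
    -- That edge is missing from `K` only because its far end is in `P`; `x` is charged to this end
    -- and the direction of the edge.
    lost-witness : ∀ {x} → lost x ≡ true → ∃₂ λ q i → q ∈ P × smallComponent (flipAt q i) x ≡ true
    lost-witness {x} p with searchVF (λ z i → component K x z ∧ (H z i ∧ not (component K x (flipAt z i))))
    ... | inj₂ none = ⊥-elim (not-elim (∧-elimʳ {not (elem P x)} (∧-elimʳ {big r H x} p))
          (dec-true (r ≤? ∣ component K x ∣) (≤-trans (does-true (r ≤? ∣ component H x ∣) (∧-elimˡ p))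
            (∣∣-mono {m} (component-min H (∈component K x) closed)))))
      where
      closed : Closed H (component K x)
      closed z i z∈ h with true? (component K x (flipAt z i))
      ... | inj₁ q = q
      ... | inj₂ q = true≢false (∧-intro z∈ (∧-intro h (cong not q))) (none z i)
    ... | inj₁ (z , i , q) = flipAt z i , i , q∈P
        , subst (λ w → smallComponent w x ≡ true) (sym (flipAt-involutive z i))
            (∧-intro (component-sym (remove-sym P H-sym) z∈) (not-intro notBig))
      where
      z∈ = ∧-elimˡ {component K x z} q
      h = ∧-elimˡ {H z i} (∧-elimʳ {component K x z} q)
      z′∉ = ∧-elimʳ {H z i} (∧-elimʳ {component K x z} q)
      x∉P : not (elem P x) ≡ true
      x∉P = ∧-elimˡ {not (elem P x)} (∧-elimʳ {big r H x} p)
      z∉P : not (elem P z) ≡ true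
      z∉P = component-min K {T = not ∘ elem P} x∉P
              (λ w j _ k → ∧-elimʳ {not (elem P w)} (∧-elimʳ {H w j} k)) z z∈
      q∈P : flipAt z i ∈ P
      q∈P with true? (elem P (flipAt z i))
      ... | inj₁ e = elem⇒∈ e
      ... | inj₂ e = ⊥-elim (not-elim z′∉ (reach-closed K _ z i z∈ (∧-intro h (∧-intro z∉P (cong not e)))))
      notBig : ¬ big r K z ≡ true
      notBig b = not-elim (∧-elimʳ {not (elem P x)} (∧-elimʳ {big r H x} p))
        (dec-true (r ≤? ∣ component K x ∣) (≤-trans (does-true (r ≤? ∣ component K z ∣) b)
          (∣∣-mono {m} (component-min K z∈ (reach-closed K _)))))

    -- A vertex of `P` has `m` neighbours, and each neighbour is charged only by the vertices of one
    -- small component.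
    ∣lost∣≤ : ∣ lost ∣ ≤ length P * (m * r)
    ∣lost∣≤ = begin
      ∣ lost ∣
        ≤⟨ ∑-mono (vertices m) (λ x → ⟦⟧≤ (λ p → charge (lost-witness p))) ⟩
      ∑V (λ x → ∑ P (λ q → ∑F (λ i → ⟦ smallComponent (flipAt q i) x ⟧)))
        ≡⟨ ∑-swap (vertices m) P _ ⟩
      ∑ P (λ q → ∑V (λ x → ∑F (λ i → ⟦ smallComponent (flipAt q i) x ⟧)))
        ≡⟨ ∑-cong P (λ q → ∑-swap (vertices m) (allFin m) _) ⟩
      ∑ P (λ q → ∑F (λ i → ∣ smallComponent (flipAt q i) ∣))
        ≤⟨ ∑-mono P (λ q → ≤-trans (∑-mono (allFin m) (λ i → ∣smallComponent∣≤ (flipAt q i))) (≤-reflexive (∑F-const {m} r))) ⟩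
      ∑ P (λ _ → m * r)
        ≡⟨ ∑-const P (m * r) ⟩
      length P * (m * r) ∎
      where
      open ≤-Reasoning
      charge : ∀ {x} → (∃₂ λ q i → q ∈ P × smallComponent (flipAt q i) x ≡ true) →
               1 ≤ ∑ P (λ q → ∑F (λ i → ⟦ smallComponent (flipAt q i) x ⟧))
      charge {x} (q , i , q∈ , s) = ≤-trans (≤-reflexive (sym (⟦⟧-true s)))
        (≤-trans (∑-∈ (λ i → ⟦ smallComponent (flipAt q i) x ⟧) (∈-allFin i))
                 (∑-∈ (λ q → ∑F (λ i → ⟦ smallComponent (flipAt q i) x ⟧)) q∈))

  -- Encodes the large components meeting Y by few vertices, which keeps the union bound small.
  representatives : ∀ {m} {K : Graph m} → Symmetric K → ∀ (Y : VSet m) r →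
    ∃ λ Z → length Z * r ≤ 2 ^ m × (∀ {x} → x ∈ Z → Y x ≡ true) ×
            (∀ {x} → Y x ≡ true → big r K x ≡ true → reach K (elem Z) x ≡ true)
  representatives {m} {K} K-sym Y r with go (vertices m)
    where
    go : ∀ xs → ∃ λ Z → length Z * r ≤ ∣ reach K (elem Z) ∣ × (∀ {x} → x ∈ Z → Y x ≡ true) ×
            (∀ {x} → x ∈ xs → Y x ≡ true → big r K x ≡ true → reach K (elem Z) x ≡ true)
    go [] = [] , z≤n , (λ ()) , (λ ())
    go (x ∷ xs) with go xs
    ... | Z , le , Z⊆ , cov with true? (Y x ∧ (big r K x ∧ not (reach K (elem Z) x)))
    ...   | inj₂ no-new = Z , le , Z⊆ , λ { (here refl) y b → covered y b ; (there p) y b → cov p y b }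
      where
      covered : Y x ≡ true → big r K x ≡ true → reach K (elem Z) x ≡ true
      covered y b with true? (reach K (elem Z) x)
      ... | inj₁ q = q
      ... | inj₂ q = true≢false (∧-intro y (∧-intro b (cong not q))) no-new
    -- `x` is not reached from `Z`, so by symmetry its component is disjoint from everything that
    -- is, and adds at least `r` new vertices.
    ...   | inj₁ new = x ∷ Z
          , (begin
              r + length Z * r
                ≤⟨ +-mono-≤ (does-true (r ≤? ∣ component K x ∣) (∧-elimˡ {big r K x} (∧-elimʳ {Y x} new))) le ⟩
              ∣ component K x ∣ + ∣ reach K (elem Z) ∣
                ≡⟨ sym (∑-+ (vertices m) _ _) ⟩
              ∑V (λ w → ⟦ component K x w ⟧ + ⟦ reach K (elem Z) w ⟧)
                ≤⟨ ∑-mono (vertices m) pt ⟩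
              ∣ reach K (elem (x ∷ Z)) ∣ ∎)
          , (λ { (here refl) → ∧-elimˡ {Y x} new ; (there p) → Z⊆ p })
          , (λ { (here refl) y b → in-x x (∈component K x) ; (there p) y b → in-Z _ (cov p y b) })
      where
      open ≤-Reasoning
      in-x : component K x ⊆ reach K (elem (x ∷ Z))
      in-x = component-min K (reach-⊇ K _ x (∈⇒elem {P = x ∷ Z} (here refl))) (reach-closed K _)
      in-Z : reach K (elem Z) ⊆ reach K (elem (x ∷ Z))
      in-Z = reach-min K _ (λ y e → reach-⊇ K _ y (∈⇒elem {P = x ∷ Z} (there (elem⇒∈ e)))) (reach-closed K _)
      disj : ∀ w → component K x w ≡ true → reach K (elem Z) w ≡ true → ⊥
      disj w a b = not-elim (∧-elimʳ {big r K x} (∧-elimʳ {Y x} new))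
        (component-min K b (reach-closed K _) x (component-sym K-sym a))
      pt : ∀ w → ⟦ component K x w ⟧ + ⟦ reach K (elem Z) w ⟧ ≤ ⟦ reach K (elem (x ∷ Z)) w ⟧
      pt w with true? (component K x w) | true? (reach K (elem Z) w)
      ... | inj₁ a | inj₁ b = ⊥-elim (disj w a b)
      ... | inj₁ a | inj₂ b rewrite a | b | in-x w a = ≤-refl
      ... | inj₂ a | inj₁ b rewrite a | b | in-Z w b = ≤-refl
      ... | inj₂ a | inj₂ b rewrite a | b = z≤n
  ... | Z , le , Z⊆ , cov = Z , ≤-trans le (≤-trans (∣∣-mono {m} {T = λ _ → true} (λ _ _ → refl))
          (≤-reflexive (trans (∑V-const {m} 1) (*-identityʳ _)))) , Z⊆ , cov (∈-vertices _)

  unique⇒AllPairs : ∀ {A : Set} {R : A → A → Set} {xs : List A} →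
    (∀ {x y} → x ∈ xs → y ∈ xs → x ≢ y → R x y) → Unique xs → AllPairs R xs
  unique⇒AllPairs f []       = []
  unique⇒AllPairs f (x∉ ∷ u) = All.tabulate (λ y∈ → f (here refl) (there y∈) (All.lookup x∉ y∈))
    ∷ unique⇒AllPairs (λ p q → f (there p) (there q)) u

  -- Short paths between two vertex sets A and B: a vertex x is attached to its root, which is x itself
  -- if x ∈ A ∪ B and otherwise some neighbour in A ∪ B; link x consists of the edges used for this.
  module Links {m} (A B : VSet m) (P : List (Vertex m))
    (A∩B : ∀ {x} → A x ≡ true → ¬ B x ≡ true)
    (A∩P : ∀ {x} → A x ≡ true → ¬ x ∈ P) (B∩P : ∀ {x} → B x ≡ true → ¬ x ∈ P) where

    data Link (x : Vertex m) : Set where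
      self : (A ∪ B) x ≡ true → Link x
      step : ∀ i → (A ∪ B) x ≡ false → (A ∪ B) (flipAt x i) ≡ true → Link x
      free : (A ∪ B) x ≡ false → (∀ i → (A ∪ B) (flipAt x i) ≡ false) → Link x

    linkOf : ∀ x → Link x
    linkOf x with true? ((A ∪ B) x)
    ... | inj₁ p = self p
    ... | inj₂ p with searchF (λ i → (A ∪ B) (flipAt x i))
    ...   | inj₁ (i , q) = step i p q
    ...   | inj₂ none    = free p none

    rootBy : ∀ {x} → Link x → Vertex m
    rootBy {x} (self _)     = x
    rootBy {x} (step i _ _) = flipAt x i
    rootBy {x} (free _ _)   = x

    edgesBy : ∀ {x} → Link x → List (Fin (numEdges m))
    edgesBy     (self _)     = []
    edgesBy {x} (step i _ _) = edge x i ∷ []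
    edgesBy     (free _ _)   = []

    root : Vertex m → Vertex m
    root x = rootBy (linkOf x)

    link : Vertex m → List (Fin (numEdges m))
    link x = edgesBy (linkOf x)

    -- Enlarges `C` by a layer of attached neighbours, so that the two sides nearly cover the cube.
    -- Vertices of `P` get no side, which keeps the paths away from `P`.
    side : VSet m → VSet m
    side C x = not (elem P x) ∧ C (root x)

    SA SB : VSet m
    SA = side A
    SB = side B

    SA∩SB : ∀ {x} → SA x ≡ true → ¬ SB x ≡ true
    SA∩SB {x} a b = A∩B (∧-elimʳ {not (elem P x)} a) (∧-elimʳ {not (elem P x)} b)

    root-self : ∀ {x} → (A ∪ B) x ≡ true → root x ≡ x
    root-self {x} p with linkOf x
    ... | self _     = refl
    ... | step _ n _ = true≢false p n
    ... | free _ _   = refl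

    A⊆SA : A ⊆ SA
    A⊆SA x a = ∧-intro (not-intro (λ q → A∩P a (elem⇒∈ q))) (trans (cong A (root-self (∨-introˡ a))) a)

    B⊆SB : B ⊆ SB
    B⊆SB x b = ∧-intro (not-intro (λ q → B∩P b (elem⇒∈ q))) (trans (cong B (root-self (∨-introʳ {A x} b))) b)

    root-covered : ∀ {x i} → (A ∪ B) (flipAt x i) ≡ true → (A ∪ B) (root x) ≡ true
    root-covered {x} {i} p with linkOf x
    ... | self q     = q
    ... | step _ _ q = q
    ... | free _ none = true≢false p (none i)

    ∈link : ∀ {x e} → e ∈ link x → ∃ λ i → e ≡ edge x i × root x ≡ flipAt x i × (A ∪ B) x ≡ false
    ∈link {x} e∈ with linkOf x
    ∈link (here refl) | step i n _ = i , refl , refl , n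
    ∈link () | self _
    ∈link () | free _ _

    link-open : ∀ {x v} → allOpen (link x) v ≡ true → root x ≡ x ⊎ (∃ λ i → root x ≡ flipAt x i × graph v x i ≡ true)
    link-open {x} p with linkOf x
    ... | self _     = inj₁ refl
    ... | free _ _   = inj₁ refl
    ... | step i _ _ = inj₂ (i , refl , ∧-elimˡ p)

    length-link : ∀ x → length (link x) ≤ 1
    length-link x with linkOf x
    ... | self _     = z≤n
    ... | step i _ _ = s≤s z≤n
    ... | free _ _   = z≤n

    path : Fin m → Vertex m → List (Fin (numEdges m))
    path i x = edge x i ∷ link x ++ link (flipAt x i)

    length-path : ∀ i x → length (path i x) ≤ 3
    length-path i x = s≤s (≤-trans (≤-reflexive (length-++ (link x))) (+-mono-≤ (length-link x) (length-link (flipAt x i))))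

    crossing : Fin m → VSet m
    crossing i x = SA x ∧ SB (flipAt x i)

    paths : Fin m → List (List (Fin (numEdges m)))
    paths i = map (path i) (filter (λ x → crossing i x ≟ᵇ true) (vertices m))

    length-paths : ∀ i → length (paths i) ≡ ∣ crossing i ∣
    length-paths i = trans (length-map (path i) (filter (λ x → crossing i x ≟ᵇ true) (vertices m))) (sym (∑-filter (crossing i) (vertices m)))

    paths-short : ∀ i → All (λ es → length es ≤ 3) (paths i)
    paths-short i = All.map⁺ (All.tabulate (λ {x} _ → length-path i x))

    data Position (i : Fin m) (x : Vertex m) (e : Fin (numEdges m)) : Set where
      middle : e ≡ edge x i → Position i x e
      left   : ∀ j → e ≡ edge x j → A (flipAt x j) ≡ true → (A ∪ B) x ≡ false → Position i x e
      right  : ∀ j → e ≡ edge (flipAt x i) j → B (flipAt (flipAt x i) j) ≡ true → (A ∪ B) (flipAt x i) ≡ false → Position i x e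

    position : ∀ {i x e} → crossing i x ≡ true → e ∈ path i x → Position i x e
    position c (here e) = middle e
    position {i} {x} c (there e∈) with ∈-++⁻ (link x) e∈
    ... | inj₁ p with ∈link p
    ...   | j , eq , rt , n = left j eq (trans (cong A (sym rt)) (∧-elimʳ {not (elem P x)} (∧-elimˡ {SA x} c))) n
    position {i} {x} c (there e∈) | inj₂ p with ∈link p
    ...   | j , eq , rt , n = right j eq (trans (cong B (sym rt)) (∧-elimʳ {not (elem P (flipAt x i))} (∧-elimʳ {SA x} c))) n

    flipAt-cancel : ∀ {x y : Vertex m} {i} → flipAt x i ≡ flipAt y i → x ≡ y
    flipAt-cancel {x} {y} {i} e = trans (sym (flipAt-involutive x i)) (trans (cong (λ z → flipAt z i) e) (flipAt-involutive y i))

    private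
      -- A middle edge joins the two sides, a left edge stays within `SA` and a right edge within
      -- `SB`, so edges of different kinds never coincide. Two equal left edges of different paths
      -- would make one start vertex the root of the other, but a vertex with a link edge lies
      -- outside `A ∪ B`; right edges are treated alike. Equal middle edges have the same end in
      -- `SA`.
      clash : ∀ {i x y e} → crossing i x ≡ true → crossing i y ≡ true → x ≢ y → Position i x e → Position i y e → ⊥
      clash-lr : ∀ {x z : Vertex m} {j k} → SA x ≡ true → SB z ≡ true → edge x j ≡ edge z k → A (flipAt x j) ≡ true → ⊥
      clash-lr a b eq h with edge-injective eq
      ... | refl , inj₁ refl = SA∩SB a b
      ... | refl , inj₂ refl = SA∩SB (A⊆SA _ h) b
      clash-ml : ∀ {i j x y} → crossing i x ≡ true → crossing i y ≡ true → x ≢ y → edge x i ≡ edge y j → ⊥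
      clash-ml {x = x} {y} c d x≢y eq with edge-injective eq
      ... | refl , inj₁ refl = x≢y refl
      ... | refl , inj₂ refl = SA∩SB (∧-elimˡ d) (∧-elimʳ {SA x} c)
      clash-mr : ∀ {i j x y} → crossing i x ≡ true → crossing i y ≡ true → x ≢ y → edge x i ≡ edge (flipAt y i) j → ⊥
      clash-mr {i} {x = x} {y} c d x≢y eq with edge-injective eq
      ... | refl , inj₁ e = SA∩SB (∧-elimˡ c) (subst (λ z → SB z ≡ true) e (∧-elimʳ {SA y} d))
      ... | refl , inj₂ e = x≢y (sym (flipAt-cancel e))
      clash {i} {x} {y} c d x≢y (middle p) (middle q) = clash-ml {i} c d x≢y (trans (sym p) q)
      clash c d x≢y (middle p) (left j q _ _) = clash-ml c d x≢y (trans (sym p) q)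
      clash c d x≢y (left j p _ _) (middle q) = clash-ml d c (x≢y ∘ sym) (trans (sym q) p)
      clash c d x≢y (middle p) (right j q _ _) = clash-mr c d x≢y (trans (sym p) q)
      clash c d x≢y (right j p _ _) (middle q) = clash-mr d c (x≢y ∘ sym) (trans (sym q) p)
      clash {x = x} {y} c d x≢y (left j p h n) (right k q _ _) = clash-lr (∧-elimˡ c) (∧-elimʳ {SA y} d) (trans (sym p) q) h
      clash {x = x} {y} c d x≢y (right k p _ _) (left j q h n) = clash-lr (∧-elimˡ d) (∧-elimʳ {SA x} c) (trans (sym q) p) h
      clash c d x≢y (left j p h n) (left k q h′ n′) with edge-injective (trans (sym p) q)
      ... | refl , inj₁ refl = x≢y refl
      ... | refl , inj₂ refl = true≢false (∨-introˡ h) n′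
      clash {i} {x} {y} c d x≢y (right j p h n) (right k q h′ n′) with edge-injective (trans (sym p) q)
      ... | refl , inj₁ e = x≢y (flipAt-cancel (sym e))
      ... | refl , inj₂ e = true≢false (∨-introʳ {A (flipAt y i)} (trans (cong B e) h)) n′

    paths-disjoint : ∀ i → AllPairs Disjoint (paths i)
    paths-disjoint i = AllPairs.map⁺ (unique⇒AllPairs
      (λ x∈ y∈ x≢y p q → clash (cr x∈) (cr y∈) x≢y (position (cr x∈) p) (position (cr y∈) q))
      (Unique.filter⁺ (λ x → crossing i x ≟ᵇ true) (vertices-unique m)))
      where
      cr : ∀ {x} → x ∈ filter (λ x → crossing i x ≟ᵇ true) (vertices m) → crossing i x ≡ true
      cr x∈ = proj₂ (∈-filter⁻ (λ x → crossing i x ≟ᵇ true) {xs = vertices m} x∈)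

    unassigned : VSet m
    unassigned x = not (SA x ∨ SB x)

    -- An edge leaving `SA` ends in `SB` or in an unassigned vertex, and at most `m * u` edges end
    -- in the latter. The other boundary edges, at least `m * D` of them, are sorted by direction,
    -- and some direction gets `D`. Fixing one direction is what makes the paths disjoint.
    many-paths : ∀ {a u D} → 1 ≤ m → a ≤ ∣ A ∣ → a ≤ ∣ B ∣ → ∣ unassigned ∣ ≤ u → m * u + m * D ≤ a →
                 ∃ λ i → D ≤ length (paths i)
    many-paths {a} {u} {D} 1≤m a≤A a≤B un≤ le = found (pigeonhole (λ i → ∣ crossing i ∣) D 1≤m total)
      where
      open ≤-Reasoning
      found : (∃ λ i → D ≤ ∣ crossing i ∣) → ∃ λ i → D ≤ length (paths i)
      found (i , q) = i , subst (D ≤_) (sym (length-paths i)) q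
      both : ∣ SA ∣ + ∣ SB ∣ ≤ 2 ^ m
      both = begin
        ∣ SA ∣ + ∣ SB ∣                     ≡⟨ sym (∑-+ (vertices m) _ _) ⟩
        ∑V (λ x → ⟦ SA x ⟧ + ⟦ SB x ⟧)      ≤⟨ ∑-mono (vertices m) one ⟩
        ∑V {m} (λ _ → 1)                    ≡⟨ trans (∑V-const {m} 1) (*-identityʳ _) ⟩
        2 ^ m                               ∎
        where
        one : ∀ x → ⟦ SA x ⟧ + ⟦ SB x ⟧ ≤ 1
        one x with true? (SA x)
        ... | inj₁ p rewrite p | false-intro {SB x} (SA∩SB p) = ≤-refl
        ... | inj₂ p rewrite p = ⟦⟧≤1 (SB x)
      a≤boundary : a ≤ boundary SA
      a≤boundary with isoperimetry SA
      ... | inj₁ p = ≤-trans a≤A (≤-trans (∣∣-mono {m} A⊆SA) p)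
      -- This alternative bounds the complement of `SA`, which contains `SB`.
      ... | inj₂ p = ≤-trans a≤B (≤-trans (∣∣-mono {m} B⊆SB) (+-cancelˡ-≤ ∣ SA ∣ _ _ (≤-trans both p)))
      boundary≤ : boundary SA ≤ m * u + ∑F (λ i → ∣ crossing i ∣)
      boundary≤ = begin
        boundary SA
          ≤⟨ ∑-mono (vertices m) (λ x → ∑-mono (allFin m) (λ i → pt (SA x) (SA (flipAt x i)) (SB (flipAt x i)))) ⟩
        ∑V (λ x → ∑F (λ i → ⟦ unassigned (flipAt x i) ⟧ + ⟦ crossing i x ⟧))
          ≡⟨ trans (∑-cong (vertices m) (λ x → ∑-+ (allFin m) _ _)) (∑-+ (vertices m) _ _) ⟩
        ∑V (λ x → ∑F (λ i → ⟦ unassigned (flipAt x i) ⟧)) + ∑V (λ x → ∑F (λ i → ⟦ crossing i x ⟧))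
          ≡⟨ cong₂ _+_ (∑-∑-flipAt unassigned) (∑-swap (vertices m) (allFin m) _) ⟩
        m * ∣ unassigned ∣ + ∑F (λ i → ∣ crossing i ∣)
          ≤⟨ +-monoˡ-≤ _ (*-monoʳ-≤ m un≤) ⟩
        m * u + ∑F (λ i → ∣ crossing i ∣) ∎
        where
        pt : ∀ s a b → ⟦ s ∧ not a ⟧ ≤ ⟦ not (a ∨ b) ⟧ + ⟦ s ∧ b ⟧
        pt false a     b     = z≤n
        pt true  true  b     = z≤n
        pt true  false true  = s≤s z≤n
        pt true  false false = s≤s z≤n
      total : m * D ≤ ∑F (λ i → ∣ crossing i ∣)
      total = +-cancelˡ-≤ (m * u) _ _ (≤-trans le (≤-trans a≤boundary boundary≤))

    -- An open path would lead from a vertex of `A`, hence of `X`, to a vertex of `B`, hence outside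
    -- `X`. Its vertices avoid `P`, so it could not leave `X`.
    none-open : ∀ {X : VSet m} {v} → (∀ {x} i → X x ≡ true → graph v x i ≡ true → X (flipAt x i) ≡ true ⊎ flipAt x i ∈ P) →
                A ⊆ X → (∀ {x} → B x ≡ true → ¬ X x ≡ true) → ∀ i → noneOpen (paths i) v ≡ true
    none-open {X} {v} X-closed A⊆X B∩X i = go (filter (λ x → crossing i x ≟ᵇ true) (vertices m))
        (λ x∈ → proj₂ (∈-filter⁻ (λ x → crossing i x ≟ᵇ true) {xs = vertices m} x∈))
      where
      allOpen-++ˡ : ∀ es fs → allOpen (es ++ fs) v ≡ true → allOpen es v ≡ true
      allOpen-++ˡ []       fs p = refl
      allOpen-++ˡ (e ∷ es) fs p = ∧-intro (∧-elimˡ p) (allOpen-++ˡ es fs (∧-elimʳ {lookup v e} p))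
      allOpen-++ʳ : ∀ es fs → allOpen (es ++ fs) v ≡ true → allOpen fs v ≡ true
      allOpen-++ʳ []       fs p = p
      allOpen-++ʳ (e ∷ es) fs p = allOpen-++ʳ es fs (∧-elimʳ {lookup v e} p)
      back : ∀ {x j} → X (flipAt x j) ≡ true → graph v x j ≡ true → elem P x ≡ false → X x ≡ true
      back {x} {j} p g n with X-closed j p (graph-sym {m} v x j g)
      ... | inj₁ q = subst (λ z → X z ≡ true) (flipAt-involutive x j) q
      ... | inj₂ q = true≢false (∈⇒elem {P = P} (subst (_∈ P) (flipAt-involutive x j) q)) n
      closed : ∀ {x} → crossing i x ≡ true → ¬ allOpen (path i x) v ≡ true
      closed {x} c o = B∩X By X-root-y
        where
        y = flipAt x i
        x∉P : elem P x ≡ false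
        x∉P = false-intro (not-elim (∧-elimˡ {not (elem P x)} (∧-elimˡ {SA x} c)))
        y∉P : elem P y ≡ false
        y∉P = false-intro (not-elim (∧-elimˡ {not (elem P y)} (∧-elimʳ {SA x} c)))
        Ax : A (root x) ≡ true
        Ax = ∧-elimʳ {not (elem P x)} (∧-elimˡ {SA x} c)
        By : B (root y) ≡ true
        By = ∧-elimʳ {not (elem P y)} (∧-elimʳ {SA x} c)
        links : allOpen (link x ++ link y) v ≡ true
        links = ∧-elimʳ {lookup v (edge x i)} o
        Xx : X x ≡ true
        Xx with link-open {x} (allOpen-++ˡ (link x) (link y) links)
        ... | inj₁ e = subst (λ z → X z ≡ true) e (A⊆X _ Ax)
        ... | inj₂ (j , e , g) = back (subst (λ z → X z ≡ true) e (A⊆X _ Ax)) g x∉P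
        Xy : X y ≡ true
        Xy with X-closed i Xx (∧-elimˡ {lookup v (edge x i)} o)
        ... | inj₁ q = q
        ... | inj₂ q = true≢false (∈⇒elem {P = P} q) y∉P
        X-root-y : X (root y) ≡ true
        X-root-y with link-open {y} (allOpen-++ʳ (link x) (link y) links)
        ... | inj₁ e = subst (λ z → X z ≡ true) (sym e) Xy
        ... | inj₂ (j , e , g) with X-closed j Xy g
        ...   | inj₁ q = subst (λ z → X z ≡ true) (sym e) q
        ...   | inj₂ q = ⊥-elim (B∩P By (subst (_∈ P) (sym e) q))
      go : ∀ xs → (∀ {x} → x ∈ xs → crossing i x ≡ true) → noneOpen (map (path i) xs) v ≡ true
      go []       f = refl
      go (x ∷ xs) f = ∧-intro (not-intro (closed (f (here refl)))) (go xs (f ∘ there))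

-- The deterministic core: a separation yields one of the events of the union bound.

module Separating where

  open Cubes
  open Subgraphs
  open Expectation using (allOpen; noneOpen; Disjoint)
  open Exploring using (neighbours)
  open DepthFirstSearch
  open ShortPaths
  open import Data.Bool using (Bool; true; false; not; _∧_; _∨_)
  open import Data.Bool.Properties using () renaming (_≟_ to _≟ᵇ_)
  open import Data.Nat using (ℕ; zero; suc; _+_; _*_; _^_; _≤_; _<_; s≤s; _≤?_; _<?_; >-nonZero)
  open import Data.Nat.Properties
  open import Data.Fin using (Fin; zero; suc)
  import Data.Fin.Properties as Fin
  open import Data.Vec using (Vec; []; _∷_; lookup; zipWith)
  open import Data.Vec.Properties using (lookup-zipWith)
  open import Data.List using (List; []; _∷_; length; map; allFin)
  open import Data.List.Membership.Propositional using (_∈_)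
  open import Data.List.Membership.Propositional.Properties using (∈-allFin)
  open import Data.List.Relation.Unary.Any using (any?)
  import Data.List.Relation.Unary.Linked as Linked
  open import Data.Product using (∃; ∃₂; _×_; _,_; proj₁; proj₂)
  open import Data.Sum using (_⊎_; inj₁; inj₂)
  open import Data.Empty using (⊥; ⊥-elim)
  open import Function using (_∘_)
  open import Relation.Binary.PropositionalEquality using (_≡_; refl; sym; trans; cong; cong₂; subst)
  open import Relation.Nullary using (¬_; does)
  open import Relation.Nullary.Decidable using (dec-true)

  module _ {m : ℕ} where

    union-left : ∀ (v w : Bits m) x i → graph v x i ≡ true → graph {m} (zipWith _∨_ v w) x i ≡ true
    union-left v w x i p = trans (lookup-zipWith _∨_ (edge x i) v w) (∨-introˡ p)

    union-right : ∀ (v w : Bits m) x i → graph w x i ≡ true → graph {m} (zipWith _∨_ v w) x i ≡ true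
    union-right v w x i p = trans (lookup-zipWith _∨_ (edge x i) v w) (∨-introʳ {lookup v (edge x i)} p)

    bad : ℕ → Bits m → VSet m
    bad r v x = does (∣ reach (graph v) (neighbours x) ∣ <? m * r)

    -- The components of the `m` neighbours cover all that is reached from them, so one has at least
    -- the average size.
    good⇒big : 1 ≤ m → ∀ r v x → bad r v x ≡ false → ∃ λ i → big r (graph v) (flipAt x i) ≡ true
    good⇒big 1≤m r v x good with pigeonhole (λ i → ∣ component H (flipAt x i) ∣) r 1≤m total
      where
      H = graph {m} v
      T : VSet m
      T w = does (Fin.any? (λ i → component H (flipAt x i) w ≟ᵇ true))
      T-intro : ∀ w i → component H (flipAt x i) w ≡ true → T w ≡ true
      T-intro w i p = dec-true (Fin.any? (λ i → component H (flipAt x i) w ≟ᵇ true)) (i , p)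
      T-elim : ∀ w → T w ≡ true → ∃ λ i → component H (flipAt x i) w ≡ true
      T-elim w = does-true (Fin.any? (λ i → component H (flipAt x i) w ≟ᵇ true))
      base : neighbours x ⊆ T
      base w p with does-true (Fin.any? (λ i → w ≟V flipAt x i)) p
      ... | i , refl = T-intro w i (∈component H w)
      closed : Closed H T
      closed w j p h with T-elim w p
      ... | i , q = T-intro (flipAt w j) i (reach-closed H _ w j q h)
      charge : ∀ w → T w ≡ true → 1 ≤ ∑F (λ i → ⟦ component H (flipAt x i) w ⟧)
      charge w p with T-elim w p
      ... | i , q = ≤-trans (≤-reflexive (sym (⟦⟧-true q))) (∑-∈ (λ i → ⟦ component H (flipAt x i) w ⟧) (∈-allFin i))
      total : m * r ≤ ∑F (λ i → ∣ component H (flipAt x i) ∣)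
      total = begin
        m * r
          ≤⟨ ≮⇒≥ (λ q → true≢false (dec-true (∣ reach H (neighbours x) ∣ <? m * r) q) good) ⟩
        ∣ reach H (neighbours x) ∣
          ≤⟨ ∑-mono (vertices m) (λ w → ⟦⟧≤ (λ p → charge w (reach-min H _ base closed w p))) ⟩
        ∑V (λ w → ∑F (λ i → ⟦ component H (flipAt x i) w ⟧))
          ≡⟨ ∑-swap (vertices m) (allFin m) _ ⟩
        ∑F (λ i → ∣ component H (flipAt x i) ∣) ∎
        where open ≤-Reasoning
    ... | i , p = i , dec-true (r ≤? ∣ component (graph v) (flipAt x i) ∣) p

    module Event (v : Bits m) (P Z Z′ : List (Vertex m)) where

      K : Graph m
      K = remove (graph v) P

      -- The union bound ranges over all lists `P`, `Z`, `Z′`. Disjointness from `P` and from each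
      -- other is therefore built into the definition instead of being inherited from a separation.
      A B : VSet m
      A x = reach K (elem Z) x ∧ not (elem P x)
      B x = (reach K (elem Z′) x ∧ not (elem P x)) ∧ not (A x)

      A∩B : ∀ {x} → A x ≡ true → ¬ B x ≡ true
      A∩B {x} a b = not-elim (∧-elimʳ {reach K (elem Z′) x ∧ not (elem P x)} b) a

      A∩P : ∀ {x} → A x ≡ true → ¬ x ∈ P
      A∩P {x} a p = not-elim (∧-elimʳ {reach K (elem Z) x} a) (∈⇒elem p)

      B∩P : ∀ {x} → B x ≡ true → ¬ x ∈ P
      B∩P {x} b p = not-elim (∧-elimʳ {reach K (elem Z′) x} (∧-elimˡ {reach K (elem Z′) x ∧ not (elem P x)} b)) (∈⇒elem p)

      open Links A B P A∩B A∩P B∩P public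

      -- The test on `D` makes the event impossible for certificates with too few paths, so that one
      -- probability bound serves all of them.
      event : ℕ → Fin m → Bits m → Bool
      event D i w = does (D ≤? length (paths i)) ∧ noneOpen (paths i) w

    SomeEvent : (ℓ N D : ℕ) → Bits m → Bits m → Set
    SomeEvent ℓ N D v w = ∃₂ λ P Z → ∃₂ λ Z′ i → length P ≤ ℓ × length Z ≤ N × length Z′ ≤ N × Event.event v P Z Z′ D i w ≡ true

    -- The parameters: r is the size of a large component, ℓ the length of the cycle, N bounds the number
    -- of large components, β the number of bad vertices, D the number of paths.
    module Deterministic (1≤m : 1 ≤ m) (r ℓ N β D : ℕ) (N-large : 2 ^ m < suc N * r) where

      -- `L` bounds the vertices lost by deleting `P`, and `u` those on neither side: they are bad,
      -- or in `P`, or next to a lost vertex or to `P`. `thr` is the weight that each class must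
      -- have, so that after losing `L + ℓ` vertices it keeps the `m * u + m * D` that `many-paths`
      -- asks for.
      L u thr : ℕ
      L = ℓ * (m * r)
      u = (β + ℓ) + m * (L + ℓ)
      thr = (L + ℓ) + (m * u + m * D)

      module _ (enough : β + m * (3 * thr) ≤ 2 ^ m) (v w : Bits m) (few-bad : ∣ bad r v ∣ ≤ β) where

        private
          H₁ G : Graph m
          H₁ = graph v
          G = graph {m} (zipWith _∨_ v w)
          W : VSet m
          W = big r H₁
          open DFS G (graph-sym (zipWith _∨_ v w)) W thr

        -- Double counting: a vertex that is not bad has a neighbour in `W`, and a vertex of `W`
        -- serves `m` times as a neighbour. The factor 3 leaves `thr` for the far class, as the
        -- search may take up to `thr + thr`.
        many-big : 3 * thr ≤ ∣ W ∣
        many-big = *-cancelˡ-≤ m {{>-nonZero 1≤m}} (+-cancelˡ-≤ β _ _ (≤-trans enough (begin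
          2 ^ m
            ≡⟨ sym (trans (∑V-const {m} 1) (*-identityʳ _)) ⟩
          ∑V {m} (λ _ → 1)
            ≤⟨ ∑-mono (vertices m) pt ⟩
          ∑V (λ x → ⟦ bad r v x ⟧ + ∑F (λ i → ⟦ W (flipAt x i) ⟧))
            ≡⟨ trans (∑-+ (vertices m) _ _) (cong (∣ bad r v ∣ +_) (∑-∑-flipAt W)) ⟩
          ∣ bad r v ∣ + m * ∣ W ∣
            ≤⟨ +-monoˡ-≤ _ few-bad ⟩
          β + m * ∣ W ∣ ∎)))
          where
          open ≤-Reasoning
          pt : ∀ x → 1 ≤ ⟦ bad r v x ⟧ + ∑F (λ i → ⟦ W (flipAt x i) ⟧)
          pt x with true? (bad r v x)
          ... | inj₁ p = ≤-trans (≤-reflexive (sym (⟦⟧-true p))) (m≤m+n _ _)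
          ... | inj₂ p with good⇒big 1≤m r v x p
          ...   | i , q = ≤-trans (≤-trans (≤-reflexive (sym (⟦⟧-true q))) (∑-∈ (λ i → ⟦ W (flipAt x i) ⟧) (∈-allFin i))) (m≤n+m _ _)

        -- The separation holds in the union of the rounds, and its closure passes to each of them.
        -- In the first round, no component of `K` is split between `X` and `Y`, so representatives
        -- chosen in `X` and in `Y` generate `A` and `B`; in the second, no path between them is
        -- open.
        separation⇒event : Separation ℓ → SomeEvent ℓ N D v w
        separation⇒event sep = conclude (representatives K-sym X r) (representatives K-sym Y r)
          where
          open Separation sep
          open Lost (graph-sym v) P r
          K-sym : Symmetric K
          K-sym = remove-sym P (graph-sym v)
          Y : VSet m
          Y x = not (X x) ∧ not (elem P x)
          K⇒G : ∀ {x i} → K x i ≡ true → x ~ flipAt x i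
          K⇒G {x} {i} k = i , refl , union-left v w x i (∧-elimˡ k)
          X-closedK : Closed K X
          X-closedK x i x∈ k with X-closed x∈ (K⇒G k)
          ... | inj₁ q = q
          ... | inj₂ q = ⊥-elim (not-elim (∧-elimʳ {not (elem P x)} (∧-elimʳ {H₁ x i} k)) (∈⇒elem q))
          Y-closedK : Closed K Y
          Y-closedK x i y k = ∧-intro (not-intro λ q → leave (X-closed q (~-sym (K⇒G k))))
                                      (∧-elimʳ {not (elem P x)} (∧-elimʳ {H₁ x i} k))
            where
            leave : X x ≡ true ⊎ x ∈ P → ⊥
            leave (inj₁ q) = not-elim (∧-elimˡ y) q
            leave (inj₂ q) = not-elim (∧-elimʳ {not (X x)} y) (∈⇒elem q)
          few : ∀ {Z : List (Vertex m)} → length Z * r ≤ 2 ^ m → length Z ≤ N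
          few {Z} le = ≮⇒≥ λ q → <⇒≱ N-large (≤-trans (*-monoˡ-≤ r q) le)
          lost≤ : ∣ lost ∣ ≤ L
          lost≤ = ≤-trans ∣lost∣≤ (*-monoˡ-≤ (m * r) P-short)
          elemP≤ : ∣ elem P ∣ ≤ ℓ
          elemP≤ = ≤-trans (covers⇒≤length (elem P) {P} elem⇒∈) P-short

          Reps : VSet m → Set
          Reps S = ∃ λ Z → length Z * r ≤ 2 ^ m × (∀ {x} → x ∈ Z → S x ≡ true) ×
            (∀ {x} → S x ≡ true → big r K x ≡ true → reach K (elem Z) x ≡ true)

          conclude : Reps X → Reps Y → SomeEvent ℓ N D v w
          conclude (Z , Z-few , Z⊆X , Z-cover) (Z′ , Z′-few , Z′⊆Y , Z′-cover) =
            P , Z , Z′ , proj₁ direction , P-short , few {Z} Z-few , few {Z′} Z′-few ,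
            ∧-intro (dec-true (D ≤? _) (proj₂ direction))
                    (none-open {X} {w} (λ {x} i p g → X-closed p (i , refl , union-right v w x i g)) A⊆X B∩X (proj₁ direction))
            where
            open Event v P Z Z′ hiding (K)
            A⊆X : A ⊆ X
            A⊆X x a = reach-min K _ (λ y e → Z⊆X (elem⇒∈ e)) X-closedK x (∧-elimˡ a)
            reach′⊆Y : reach K (elem Z′) ⊆ Y
            reach′⊆Y = reach-min K _ (λ y e → Z′⊆Y (elem⇒∈ e)) Y-closedK
            B∩X : ∀ {x} → B x ≡ true → ¬ X x ≡ true
            B∩X {x} b = not-elim (∧-elimˡ (reach′⊆Y x (∧-elimˡ {reach K (elem Z′) x} (∧-elimˡ {reach K (elem Z′) x ∧ not (elem P x)} b))))
            inA : ∀ {x} → X x ≡ true → big r K x ≡ true → A x ≡ true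
            inA p b = ∧-intro (Z-cover p b) (not-intro (λ q → X∩P p (elem⇒∈ q)))
            inB : ∀ {x} → ¬ X x ≡ true → elem P x ≡ false → big r K x ≡ true → B x ≡ true
            inB {x} n e b = ∧-intro (∧-intro (Z′-cover (∧-intro (not-intro n) (cong not e)) b) (cong not e)) (not-intro (n ∘ A⊆X x))
            sort : ∀ {x} → W x ≡ true → (A x ≡ true × X x ≡ true ⊎ B x ≡ true) ⊎ (lost x ≡ true ⊎ elem P x ≡ true)
            sort {x} p with true? (elem P x)
            ... | inj₁ e = inj₂ (inj₂ e)
            ... | inj₂ e with true? (big r K x)
            ...   | inj₂ b = inj₂ (inj₁ (∧-intro p (∧-intro (cong not e) (cong not b))))
            ...   | inj₁ b with true? (X x)
            ...     | inj₁ q = inj₁ (inj₁ (inA q b , q))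
            ...     | inj₂ q = inj₁ (inj₂ (inB (λ q′ → true≢false q′ q) e b))

            thr≤A : thr ≤ ∣ A ∣ + (L + ℓ)
            thr≤A = begin
              thr                          ≤⟨ lower≤ ⟩
              ∣ X ∩ W ∣                    ≤⟨ ∣∣-mono {m} sub ⟩
              ∣ A ∪ (lost ∪ elem P) ∣      ≤⟨ ∣∪∣≤ A _ ⟩
              ∣ A ∣ + ∣ lost ∪ elem P ∣    ≤⟨ +-monoʳ-≤ ∣ A ∣ (≤-trans (∣∪∣≤ lost (elem P)) (+-mono-≤ lost≤ elemP≤)) ⟩
              ∣ A ∣ + (L + ℓ)              ∎
              where
              open ≤-Reasoning
              sub : (X ∩ W) ⊆ (A ∪ (lost ∪ elem P))
              sub x p with sort {x} (∧-elimʳ {X x} p)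
              ... | inj₁ (inj₁ (a , _)) = ∨-introˡ a
              ... | inj₁ (inj₂ b) = ⊥-elim (B∩X b (∧-elimˡ p))
              ... | inj₂ (inj₁ l) = ∨-introʳ {A x} (∨-introˡ l)
              ... | inj₂ (inj₂ e) = ∨-introʳ {A x} (∨-introʳ {lost x} e)

            thr≤B : thr ≤ ∣ B ∣ + (L + ℓ)
            thr≤B = +-cancelˡ-≤ (thr + thr) _ _ (begin
              thr + thr + thr                                ≡⟨ trans (+-assoc thr thr thr) (cong (λ k → thr + (thr + k)) (sym (+-identityʳ thr))) ⟩
              3 * thr                                        ≤⟨ many-big ⟩
              ∣ W ∣                                          ≤⟨ ∣∣-mono {m} sub ⟩
              ∣ (X ∩ W) ∪ (B ∪ (lost ∪ elem P)) ∣            ≤⟨ ∣∪∣≤ (X ∩ W) _ ⟩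
              ∣ X ∩ W ∣ + ∣ B ∪ (lost ∪ elem P) ∣            ≤⟨ +-mono-≤ ≤upper (≤-trans (∣∪∣≤ B _) (+-monoʳ-≤ ∣ B ∣
                                                                 (≤-trans (∣∪∣≤ lost (elem P)) (+-mono-≤ lost≤ elemP≤)))) ⟩
              thr + thr + (∣ B ∣ + (L + ℓ))                  ∎)
              where
              open ≤-Reasoning
              sub : W ⊆ ((X ∩ W) ∪ (B ∪ (lost ∪ elem P)))
              sub x p with sort {x} p
              ... | inj₁ (inj₁ (_ , q)) = ∨-introˡ (∧-intro q p)
              ... | inj₁ (inj₂ b) = ∨-introʳ {(X ∩ W) x} (∨-introˡ b)
              ... | inj₂ (inj₁ l) = ∨-introʳ {(X ∩ W) x} (∨-introʳ {B x} (∨-introˡ l))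
              ... | inj₂ (inj₂ e) = ∨-introʳ {(X ∩ W) x} (∨-introʳ {B x} (∨-introʳ {lost x} e))

            unassigned≤ : ∣ unassigned ∣ ≤ u
            unassigned≤ = begin
              ∣ unassigned ∣
                ≤⟨ ∑-mono (vertices m) (λ x → ⟦⟧≤ (pt x)) ⟩
              ∑V (λ x → (⟦ bad r v x ⟧ + ⟦ elem P x ⟧) + ∑F (λ i → ⟦ (lost ∪ elem P) (flipAt x i) ⟧))
                ≡⟨ trans (∑-+ (vertices m) _ _) (cong₂ _+_ (∑-+ (vertices m) _ _) (∑-∑-flipAt (lost ∪ elem P))) ⟩
              (∣ bad r v ∣ + ∣ elem P ∣) + m * ∣ lost ∪ elem P ∣
                ≤⟨ +-mono-≤ (+-mono-≤ few-bad elemP≤) (*-monoʳ-≤ m (≤-trans (∣∪∣≤ lost (elem P)) (+-mono-≤ lost≤ elemP≤))) ⟩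
              u ∎
              where
              open ≤-Reasoning
              pt : ∀ x → unassigned x ≡ true → 1 ≤ (⟦ bad r v x ⟧ + ⟦ elem P x ⟧) + ∑F (λ i → ⟦ (lost ∪ elem P) (flipAt x i) ⟧)
              pt x n with true? (bad r v x)
              ... | inj₁ b = ≤-trans (≤-trans (≤-reflexive (sym (⟦⟧-true b))) (m≤m+n _ _)) (m≤m+n _ _)
              ... | inj₂ b with true? (elem P x)
              ...   | inj₁ e = ≤-trans (≤-trans (≤-reflexive (sym (⟦⟧-true e))) (m≤n+m _ ⟦ bad r v x ⟧)) (m≤m+n _ _)
              ...   | inj₂ e with good⇒big 1≤m r v x b
              -- A vertex that is not bad has a neighbour in a large component. If that neighbour
              -- were in `A ∪ B`, the vertex would have a root there and thus a side, so the
              -- neighbour is lost or in `P`.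
              ...     | i , q = ≤-trans (≤-trans (≤-reflexive (sym (⟦⟧-true (hit (sort q)))))
                          (∑-∈ (λ i → ⟦ (lost ∪ elem P) (flipAt x i) ⟧) (∈-allFin i))) (m≤n+m _ _)
                where
                assigned : (A ∪ B) (flipAt x i) ≡ true → ⊥
                assigned c with ∨-elim {A (root x)} (root-covered {x} {i} c)
                ... | inj₁ a = not-elim n (∨-introˡ (∧-intro (cong not e) a))
                ... | inj₂ a = not-elim n (∨-introʳ {SA x} (∧-intro (cong not e) a))
                hit : (A (flipAt x i) ≡ true × X (flipAt x i) ≡ true ⊎ B (flipAt x i) ≡ true) ⊎ (lost (flipAt x i) ≡ true ⊎ elem P (flipAt x i) ≡ true) →
                      (lost ∪ elem P) (flipAt x i) ≡ true
                hit (inj₁ (inj₁ (a , _))) = ⊥-elim (assigned (∨-introˡ a))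
                hit (inj₁ (inj₂ a)) = ⊥-elim (assigned (∨-introʳ {A (flipAt x i)} a))
                hit (inj₂ (inj₁ l)) = ∨-introˡ l
                hit (inj₂ (inj₂ l)) = ∨-introʳ {lost (flipAt x i)} l

            enoughPaths : ∀ {c} → thr ≤ c + (L + ℓ) → m * u + m * D ≤ c
            enoughPaths {c} le = +-cancelˡ-≤ (L + ℓ) _ _ (subst (thr ≤_) (+-comm c (L + ℓ)) le)

            direction : ∃ λ i → D ≤ length (paths i)
            direction = many-paths 1≤m (enoughPaths thr≤A) (enoughPaths thr≤B) unassigned≤ ≤-refl

        cycleOrEvent : 2 ≤ ℓ → 2 ^ m ≤ 4 * m ^ 32 * ℓ → HasLongCycle (mkOutcome (zipWith _∨_ v w)) ⊎ SomeEvent ℓ N D v w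
        cycleOrEvent 2≤ℓ long with cycleOrSeparation ℓ (≤-trans (m≤m+n thr _) many-big)
        ... | inj₂ sep = inj₂ (separation⇒event sep)
        ... | inj₁ (x , vs , uq , l , len) = inj₁ (x ∷ vs , (≤-trans (s≤s 2≤ℓ) len , uq , Linked.map adj l)
                , ≤-trans long (*-monoʳ-≤ (4 * m ^ 32) (<⇒≤ len)))
          where
          adj : ∀ {y z} → y ~ z → Adj (mkOutcome (zipWith _∨_ v w)) y z
          adj {y} (i , refl , h) = graph⇒Adj (zipWith _∨_ v w) y i h

-- Polynomials against powers of two, and the choice of parameters.

module Asymptotics where

  open import Data.Nat
  open import Data.Nat.Properties
  open import Data.Nat.DivMod
  open import Data.Product using (∃; _,_)
  open import Relation.Binary.PropositionalEquality using (refl; sym; subst)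
  open import Data.Nat.Solver using (module +-*-Solver)
  open +-*-Solver using (solve; _:+_; _:*_; _:^_; con; _:=_)

  n<2^n : ∀ n → n < 2 ^ n
  n<2^n zero    = s≤s z≤n
  n<2^n (suc n) = ≤-trans (s≤s (n<2^n n)) (subst (_≤ 2 ^ suc n) (+-comm (2 ^ n) 1)
    (+-monoʳ-≤ (2 ^ n) (≤-trans (m^n>0 2 n) (m≤m+n (2 ^ n) 0))))

  m<[1+m/n]*n : ∀ m n .{{_ : NonZero n}} → m < suc (m / n) * n
  m<[1+m/n]*n m n = subst (_< suc (m / n) * n) (sym (m≡m%n+[m/n]*n m n)) (+-monoˡ-< (m / n * n) (m%n<n m n))

  *≤⇒≤/ : ∀ m n o .{{_ : NonZero n}} → m * n ≤ o → m ≤ o / n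
  *≤⇒≤/ m n o le = subst (_≤ o / n) (m*n/n≡m m n) (/-monoˡ-≤ n le)

  -- With `q = m / c`, once `q` is at least `c` the number `m` is below `2 ^ (q + q)`, and `c` is
  -- chosen so that the exponent `(q + q) * suc a` fits into `m / suc K`.
  poly≤exp : ∀ a K → ∃ λ M → ∀ m → M ≤ m → m ^ suc a ≤ 2 ^ (m / suc K)
  poly≤exp a K = c * c , bound
    where
    c = 2 * suc a * suc K
    bound : ∀ m → c * c ≤ m → m ^ suc a ≤ 2 ^ (m / suc K)
    bound m M≤m = begin
      m ^ suc a                ≤⟨ ^-monoˡ-≤ (suc a) m≤ ⟩
      (2 ^ (q + q)) ^ suc a    ≡⟨ ^-*-assoc 2 (q + q) (suc a) ⟩
      2 ^ ((q + q) * suc a)    ≤⟨ ^-monoʳ-≤ 2 (*≤⇒≤/ ((q + q) * suc a) (suc K) m (begin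
          (q + q) * suc a * suc K   ≡⟨ solve 3 (λ q a k → (q :+ q) :* a :* k := q :* (con 2 :* a :* k)) refl q (suc a) (suc K) ⟩
          q * c                     ≤⟨ m/n*n≤m m c ⟩
          m                         ∎)) ⟩
      2 ^ (m / suc K)          ∎
      where
      open ≤-Reasoning
      q = m / c
      c≤q : c ≤ q
      c≤q = *≤⇒≤/ c c m M≤m
      m≤ : m ≤ 2 ^ (q + q)
      m≤ = begin
        m                ≤⟨ <⇒≤ (m<[1+m/n]*n m c) ⟩
        suc q * c        ≤⟨ *-mono-≤ (n<2^n q) (≤-trans c≤q (<⇒≤ (n<2^n q))) ⟩
        2 ^ q * 2 ^ q    ≡⟨ sym (^-distribˡ-+-* 2 q q) ⟩
        2 ^ (q + q)      ∎

  module Parameters (m s : ℕ) .{{_ : NonZero m}} where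

    private
      instance
        nz3 : NonZero (m ^ 3)
        nz3 = m^n≢0 m 3
        nz4 : NonZero (m ^ 4)
        nz4 = m^n≢0 m 4
        nz9 : NonZero (m ^ 9)
        nz9 = m^n≢0 m 9
        nz15 : NonZero (m ^ 15)
        nz15 = m^n≢0 m 15

    Q r : ℕ
    Q = 2 ^ m
    r = m ^ 9

    abstract
      -- In `enough` each quantity collects one factor `m` for every counting of neighbours that it
      -- passes through, and one more to absorb constants: the largest terms are `ℓ * m ^ 14`,
      -- `β * m ^ 3` and `D * m ^ 3`. `N` is governed by `rounds`.
      ℓ N β D : ℕ
      ℓ = Q / m ^ 15
      N = Q / m ^ 9
      β = Q / m ^ 4
      D = Q / m ^ 3

      ℓ*≤ : ℓ * m ^ 15 ≤ Q
      ℓ*≤ = m/n*n≤m Q (m ^ 15)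

      <ℓ* : Q < suc ℓ * m ^ 15
      <ℓ* = m<[1+m/n]*n Q (m ^ 15)

      N*≤ : N * m ^ 9 ≤ Q
      N*≤ = m/n*n≤m Q (m ^ 9)

      N-large : Q < suc N * r
      N-large = m<[1+m/n]*n Q (m ^ 9)

      β*≤ : β * m ^ 4 ≤ Q
      β*≤ = m/n*n≤m Q (m ^ 4)

      <β* : Q < suc β * m ^ 4
      <β* = m<[1+m/n]*n Q (m ^ 4)

      D*≤ : D * m ^ 3 ≤ Q
      D*≤ = m/n*n≤m Q (m ^ 3)

      ≤D : ∀ {x} → x * m ^ 3 ≤ Q → x ≤ D
      ≤D {x} = *≤⇒≤/ x (m ^ 3) Q

      2≤ℓ : m ^ 16 ≤ Q → 2 ≤ m → 2 ≤ ℓ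
      2≤ℓ m^16≤Q 2≤m = *≤⇒≤/ 2 (m ^ 15) Q (≤-trans (*-monoˡ-≤ (m ^ 15) 2≤m) m^16≤Q)

    -- 2^J bounds m times the number of events in the union bound.
    J : ℕ
    J = (m + m) + suc m * (ℓ + (N + N))

    private
      1≤m : 1 ≤ m
      1≤m = n≢0⇒n>0 (≢-nonZero⁻¹ m)

    β-large : ∀ {b} → β < b → Q ≤ m ^ 4 * b
    β-large {b} β<b = ≤-trans (<⇒≤ <β*) (≤-trans (*-monoˡ-≤ (m ^ 4) β<b) (≤-reflexive (*-comm b (m ^ 4))))

    ^≤^ : ∀ {a b} → a ≤ b → m ^ a ≤ m ^ b
    ^≤^ = ^-monoʳ-≤ m

    module _ (m^16≤Q : m ^ 16 ≤ Q) (22≤m : 22 ≤ m) where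

      2≤ℓ′ : 2 ≤ ℓ
      2≤ℓ′ = 2≤ℓ m^16≤Q (≤-trans (s≤s (s≤s z≤n)) 22≤m)

      -- As `ℓ` is positive, rounding down costs at most a factor 2, and the exponents 15 and 32
      -- leave ample room for that.
      long-enough : Q ≤ 4 * m ^ 32 * ℓ
      long-enough = begin
        Q                     ≤⟨ <⇒≤ <ℓ* ⟩
        suc ℓ * m ^ 15        ≤⟨ *-mono-≤ (+-monoˡ-≤ ℓ (≤-trans (s≤s z≤n) 2≤ℓ′)) (^≤^ {15} {32} (m≤m+n 15 17)) ⟩
        (ℓ + ℓ) * m ^ 32      ≡⟨ solve 2 (λ l x → (l :+ l) :* x := con 2 :* x :* l) refl ℓ (m ^ 32) ⟩
        2 * m ^ 32 * ℓ        ≤⟨ *-monoˡ-≤ ℓ (*-monoˡ-≤ (m ^ 32) (s≤s (s≤s (z≤n {2})))) ⟩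
        4 * m ^ 32 * ℓ        ∎
        where open ≤-Reasoning

      private
        ℓ-bound : ∀ k → k ≤ 15 → ℓ * m ^ k ≤ Q
        ℓ-bound k k≤ = ≤-trans (*-monoʳ-≤ ℓ (^≤^ k≤)) ℓ*≤
        β-bound : ∀ k → k ≤ 4 → β * m ^ k ≤ Q
        β-bound k k≤ = ≤-trans (*-monoʳ-≤ β (^≤^ k≤)) β*≤
        le : ∀ a b → a ≤ a + b
        le = m≤m+n

      enough : let L = ℓ * (m * r)
                   u = (β + ℓ) + m * (L + ℓ)
                   thr = (L + ℓ) + (m * u + m * D)
               in β + m * (3 * thr) ≤ Q
      enough = *-cancelˡ-≤ m (begin
        m * (β + m * (3 * thr))
          ≡⟨ solve 4 (λ m l b d → let r = m :^ 9 ; L = l :* (m :* r) ; u = (b :+ l) :+ m :* (L :+ l) ; thr = (L :+ l) :+ (m :* u :+ m :* d) in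
               m :* (b :+ m :* (con 3 :* thr))
               := b :* m :^ 1 :+ con 3 :* (l :* m :^ 12 :+ l :* m :^ 2 :+ b :* m :^ 3 :+ l :* m :^ 3 :+ l :* m :^ 14 :+ l :* m :^ 4 :+ d :* m :^ 3))
               refl m ℓ β D ⟩
        β * m ^ 1 + 3 * (ℓ * m ^ 12 + ℓ * m ^ 2 + β * m ^ 3 + ℓ * m ^ 3 + ℓ * m ^ 14 + ℓ * m ^ 4 + D * m ^ 3)
          ≤⟨ +-mono-≤ (β-bound 1 (le 1 3)) (*-monoʳ-≤ 3 (+-mono-≤ (+-mono-≤ (+-mono-≤ (+-mono-≤ (+-mono-≤ (+-mono-≤
               (ℓ-bound 12 (le 12 3)) (ℓ-bound 2 (le 2 13))) (β-bound 3 (le 3 1))) (ℓ-bound 3 (le 3 12))) (ℓ-bound 14 (le 14 1)))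
               (ℓ-bound 4 (le 4 11))) D*≤)) ⟩
        -- One term and three times seven terms, each at most `Q`: this is the origin of 22.
        Q + 3 * (Q + Q + Q + Q + Q + Q + Q)
          ≡⟨ solve 1 (λ q → q :+ con 3 :* (q :+ q :+ q :+ q :+ q :+ q :+ q) := con 22 :* q) refl Q ⟩
        22 * Q
          ≤⟨ *-monoˡ-≤ Q 22≤m ⟩
        m * Q ∎)
        where
        open ≤-Reasoning
        L = ℓ * (m * r)
        u = (β + ℓ) + m * (L + ℓ)
        thr = (L + ℓ) + (m * u + m * D)

      -- Each batch of `(s * m) ^ 3` paths halves the probability that all paths are closed, and `J`
      -- halvings beat the number of certificates. The main part of `J` is of order `m * N`, about
      -- `2 ^ m / m ^ 8`, against `D` of about `2 ^ m / m ^ 3`.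
      rounds : 8 * s ^ 3 ≤ m → (s * m) ^ 3 * J ≤ D
      rounds s≤m = ≤D (*-cancelˡ-≤ m (begin
        m * ((s * m) ^ 3 * J * m ^ 3)
          ≤⟨ *-monoʳ-≤ m (*-monoˡ-≤ (m ^ 3) (*-monoʳ-≤ ((s * m) ^ 3) (+-monoʳ-≤ (m + m) (*-monoˡ-≤ (ℓ + (N + N)) (+-monoˡ-≤ m 1≤m))))) ⟩
        m * ((s * m) ^ 3 * ((m + m) + (m + m) * (ℓ + (N + N))) * m ^ 3)
          ≡⟨ solve 4 (λ m s l n → m :* ((s :* m) :^ 3 :* ((m :+ m) :+ (m :+ m) :* (l :+ (n :+ n))) :* m :^ 3)
               := s :^ 3 :* (con 2 :* m :^ 8 :+ con 2 :* (l :* m :^ 8) :+ con 4 :* (n :* m :^ 8))) refl m s ℓ N ⟩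
        s ^ 3 * (2 * m ^ 8 + 2 * (ℓ * m ^ 8) + 4 * (N * m ^ 8))
          ≤⟨ *-monoʳ-≤ (s ^ 3) (+-mono-≤ (+-mono-≤ (*-monoʳ-≤ 2 (≤-trans (^≤^ (le 8 8)) m^16≤Q)) (*-monoʳ-≤ 2 (ℓ-bound 8 (le 8 7))))
               (*-monoʳ-≤ 4 (≤-trans (*-monoʳ-≤ N (^≤^ (le 8 1))) N*≤))) ⟩
        s ^ 3 * (2 * Q + 2 * Q + 4 * Q)
          ≡⟨ solve 2 (λ c q → c :* (con 2 :* q :+ con 2 :* q :+ con 4 :* q) := con 8 :* c :* q) refl (s ^ 3) Q ⟩
        8 * s ^ 3 * Q
          ≤⟨ *-monoˡ-≤ Q s≤m ⟩
        m * Q ∎))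
        where open ≤-Reasoning

-- Rational arithmetic and powers of one half.

module Rationals where

  open Expectation
  open Exploring using (^-+; ^-antimonoʳ)
  open import Data.Nat as ℕ using (ℕ; zero; suc)
  import Data.Nat.Properties as ℕ
  import Data.Integer as ℤ
  import Data.Integer.Properties as ℤ
  open import Data.Rational
  open import Data.Rational.Properties
  open import Data.Rational.Unnormalised.Base as ℚᵘ using (mkℚᵘ; *≡*; *≤*)
  import Data.Rational.Unnormalised.Properties as ℚᵘ
  open import Data.Rational.Solver using (module +-*-Solver)
  open +-*-Solver using (solve; _:+_; _:*_; _:-_; con; _:=_)
  open import Data.List using (List; []; _∷_; length)
  open import Data.Product using (∃; _,_)
  open import Relation.Binary.PropositionalEquality

  ι : ℕ → ℚ
  ι zero    = 0ℚ
  ι (suc n) = 1ℚ + ι n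

  0≤ι : ∀ n → 0ℚ ≤ ι n
  0≤ι zero    = ≤-refl
  0≤ι (suc n) = 0≤+ 0≤1 (0≤ι n)

  ι-+ : ∀ a b → ι (a ℕ.+ b) ≡ ι a + ι b
  ι-+ zero    b = sym (+-identityˡ _)
  ι-+ (suc a) b = trans (cong (1ℚ +_) (ι-+ a b)) (sym (+-assoc 1ℚ (ι a) (ι b)))

  ι-* : ∀ a b → ι (a ℕ.* b) ≡ ι a * ι b
  ι-* zero    b = sym (*-zeroˡ (ι b))
  ι-* (suc a) b = trans (ι-+ b (a ℕ.* b)) (trans (cong (ι b +_) (ι-* a b))
    (solve 2 (λ a b → b :+ a :* b := (con 1ℚ :+ a) :* b) refl (ι a) (ι b)))

  ι-^ : ∀ a k → ι (a ℕ.^ k) ≡ ι a ^ k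
  ι-^ a zero    = refl
  ι-^ a (suc k) = trans (ι-* a (a ℕ.^ k)) (cong (ι a *_) (ι-^ a k))

  ι-mono : ∀ {a b} → a ℕ.≤ b → ι a ≤ ι b
  ι-mono {b = b} ℕ.z≤n = 0≤ι b
  ι-mono (ℕ.s≤s a≤b) = +-monoʳ-≤ 1ℚ (ι-mono a≤b)

  1≤ι : ∀ {n} → 1 ℕ.≤ n → 1ℚ ≤ ι n
  1≤ι = ι-mono

  0<1 : 0ℚ < 1ℚ
  0<1 = positive⁻¹ 1ℚ

  0<ι : ∀ {n} → 1 ℕ.≤ n → 0ℚ < ι n
  0<ι 1≤n = <-≤-trans 0<1 (1≤ι 1≤n)

  *-cancelˡ : ∀ {r p q} → 0ℚ < r → r * p ≤ r * q → p ≤ q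
  *-cancelˡ {r} 0<r = *-cancelˡ-≤-pos r {{positive 0<r}}

  ι-toℚᵘ : ∀ n → toℚᵘ (ι n) ℚᵘ.≃ mkℚᵘ (ℤ.+ n) 0
  ι-toℚᵘ zero    = *≡* refl
  ι-toℚᵘ (suc n) = ℚᵘ.≃-trans (toℚᵘ-homo-+ 1ℚ (ι n)) (ℚᵘ.≃-trans (ℚᵘ.+-congʳ (toℚᵘ 1ℚ) (ι-toℚᵘ n))
    (*≡* (cong (ℤ._* ℤ.+ 1) (trans (cong (ℤ._+_ (ℤ.+ 1)) (ℤ.*-identityʳ (ℤ.+ n))) refl))))

  ι*recip : ∀ {n} → 1 ℕ.≤ n → ι n * recipℕ n ≡ 1ℚ
  ι*recip {suc n} _ = toℚᵘ-injective (ℚᵘ.≃-trans (toℚᵘ-homo-* (ι (suc n)) (recipℕ (suc n)))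
    (ℚᵘ.≃-trans (ℚᵘ.*-cong (ι-toℚᵘ (suc n)) (toℚᵘ-fromℚᵘ (mkℚᵘ (ℤ.+ 1) n)))
    (*≡* (trans (ℤ.*-identityʳ _) (trans (ℤ.*-identityʳ (ℤ.+ suc n)) (sym (trans (ℤ.*-identityˡ _) (cong (λ k → ℤ.+ suc k) (ℕ.+-identityʳ n)))))))))

  0≤recip : ∀ n → 0ℚ ≤ recipℕ n
  0≤recip zero    = ≤-refl
  0≤recip (suc n) = *-cancelˡ (0<ι {suc n} (ℕ.s≤s ℕ.z≤n))
    (≤-trans (≤-reflexive (*-zeroʳ (ι (suc n)))) (≤-trans 0≤1 (≤-reflexive (sym (ι*recip {suc n} (ℕ.s≤s ℕ.z≤n))))))

  0<recip : ∀ {n} → 1 ℕ.≤ n → 0ℚ < recipℕ n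
  0<recip {n} 1≤n = *-cancelˡ-<-nonNeg (ι n) {{nonNegative (0≤ι n)}}
    (subst₂ _<_ (sym (*-zeroʳ (ι n))) (sym (ι*recip 1≤n)) 0<1)

  -- Multiplying a positive fraction by its denominator leaves the numerator, which is at least 1.
  archimedes : ∀ ε → 0ℚ < ε → ∃ λ n → 1ℚ ≤ ι (suc n) * ε
  archimedes ε 0<ε with positive 0<ε
  archimedes ε@(mkℚ ℤ.+[1+ a ] b c) 0<ε | _ = b , toℚᵘ-cancel-≤ (ℚᵘ.≤-respʳ-≃
    (ℚᵘ.≃-sym (ℚᵘ.≃-trans (toℚᵘ-homo-* (ι (suc b)) ε) (ℚᵘ.*-congʳ {toℚᵘ ε} (ι-toℚᵘ (suc b))))) (*≤* le))
    where
    le : ℤ.+ 1 ℤ.* (ℤ.+ suc (b ℕ.+ 0)) ℤ.≤ (ℤ.+ suc b ℤ.* ℤ.+ suc a) ℤ.* ℤ.+ 1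
    le = subst₂ ℤ._≤_ (sym (ℤ.*-identityˡ _)) (sym (ℤ.*-identityʳ _))
      (ℤ.+≤+ (ℕ.≤-trans (ℕ.≤-reflexive (cong suc (ℕ.+-identityʳ b))) (ℕ.m≤m*n (suc b) (suc a))))

  upperBound : ∀ q → ∃ λ n → q ≤ ι n
  upperBound q@(mkℚ (ℤ.+ a) b c) = a , toℚᵘ-cancel-≤ (ℚᵘ.≤-respʳ-≃ (ℚᵘ.≃-sym (ι-toℚᵘ a))
    (*≤* (ℤ.*-monoˡ-≤-nonNeg (ℤ.+ a) (ℤ.+≤+ (ℕ.s≤s ℕ.z≤n)))))
  upperBound q@(mkℚ ℤ.-[1+ a ] b c) = 0 , nonPositive⁻¹ q

  Bernoulli : ∀ {x} n → 0ℚ ≤ x → 1ℚ + ι n * x ≤ (1ℚ + x) ^ n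
  Bernoulli {x} zero    0≤x = ≤-reflexive (trans (cong (1ℚ +_) (*-zeroˡ x)) (+-identityʳ 1ℚ))
  Bernoulli {x} (suc n) 0≤x = begin
    1ℚ + (1ℚ + ι n) * x
      ≤⟨ 0≤-⇒≤ (≤-trans (0≤* (0≤ι n) (0≤* 0≤x 0≤x)) (≤-reflexive
           (solve 2 (λ n x → n :* (x :* x) := (con 1ℚ :+ x) :* (con 1ℚ :+ n :* x) :- (con 1ℚ :+ (con 1ℚ :+ n) :* x)) refl (ι n) x))) ⟩
    (1ℚ + x) * (1ℚ + ι n * x)
      ≤⟨ *-monoˡ (0≤+ 0≤1 0≤x) (Bernoulli n 0≤x) ⟩
    (1ℚ + x) * (1ℚ + x) ^ n ∎
    where open ≤-Reasoning

  ^-distrib-* : ∀ a b n → (a * b) ^ n ≡ a ^ n * b ^ n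
  ^-distrib-* a b zero    = refl
  ^-distrib-* a b (suc n) = trans (cong (a * b *_) (^-distrib-* a b n))
    (solve 4 (λ a b x y → a :* b :* (x :* y) := a :* x :* (b :* y)) refl a b (a ^ n) (b ^ n))

  ^-* : ∀ x a b → x ^ (a ℕ.* b) ≡ (x ^ b) ^ a
  ^-* x zero    b = refl
  ^-* x (suc a) b = trans (^-+ x b (a ℕ.* b)) (cong (x ^ b *_) (^-* x a b))

  half : ℚ
  half = recipℕ 2

  0≤half : 0ℚ ≤ half
  0≤half = 0≤recip 2

  half^*2^ : ∀ n → half ^ n * ι (2 ℕ.^ n) ≡ 1ℚ
  half^*2^ n = trans (cong (half ^ n *_) (ι-^ 2 n)) (trans (sym (^-distrib-* half (ι 2) n)) (1^ n))
    where
    1^ : ∀ n → 1ℚ ^ n ≡ 1ℚ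
    1^ zero    = refl
    1^ (suc n) = trans (*-identityˡ _) (1^ n)

  -- A rational substitute for 1 - q ≤ exp(-q): `Bernoulli` makes `(1ℚ + q) ^ k` at least 2, and
  -- `(1ℚ + q) * (1ℚ - q)` is at most 1.
  halving : ∀ {q} k → 0ℚ ≤ q → q ≤ 1ℚ → 1ℚ ≤ ι k * q → (1ℚ - q) ^ k ≤ half
  halving {q} k 0≤q q≤1 1≤kq = *-cancelˡ (0<ι {2} (ℕ.s≤s ℕ.z≤n)) (begin
    ι 2 * (1ℚ - q) ^ k
      ≤⟨ *-monoʳ (0≤^ k 0≤1-q) (≤-trans (+-monoʳ-≤ 1ℚ 1≤kq) (Bernoulli k 0≤q)) ⟩
    (1ℚ + q) ^ k * (1ℚ - q) ^ k
      ≡⟨ sym (^-distrib-* (1ℚ + q) (1ℚ - q) k) ⟩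
    ((1ℚ + q) * (1ℚ - q)) ^ k
      ≤⟨ ^≤1 k (0≤* (0≤+ 0≤1 0≤q) 0≤1-q) (0≤-⇒≤ (≤-trans (0≤* 0≤q 0≤q) (≤-reflexive
           (solve 1 (λ q → q :* q := con 1ℚ :- (con 1ℚ :+ q) :* (con 1ℚ :- q)) refl q)))) ⟩
    1ℚ
      ≡⟨ refl ⟩
    ι 2 * half ∎)
    where
    open ≤-Reasoning
    0≤1-q = ≤⇒0≤- q≤1

  1-q≤1 : ∀ {q} → 0ℚ ≤ q → 1ℚ - q ≤ 1ℚ
  1-q≤1 0≤q = ≤-trans (+-monoʳ-≤ 1ℚ (neg-antimono-≤ 0≤q)) (≤-reflexive (+-identityʳ 1ℚ))

  halving-rounds : ∀ {q} k J {D} → 0ℚ ≤ q → q ≤ 1ℚ → 1ℚ ≤ ι k * q → k ℕ.* J ℕ.≤ D → (1ℚ - q) ^ D ≤ half ^ J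
  halving-rounds {q} k J {D} 0≤q q≤1 1≤kq le = begin
    (1ℚ - q) ^ D           ≤⟨ ^-antimonoʳ 0≤1-q (1-q≤1 0≤q) (subst (ℕ._≤ D) (ℕ.*-comm k J) le) ⟩
    (1ℚ - q) ^ (J ℕ.* k)   ≡⟨ ^-* (1ℚ - q) J k ⟩
    ((1ℚ - q) ^ k) ^ J     ≤⟨ ^-mono J (0≤^ k 0≤1-q) (halving k 0≤q q≤1 1≤kq) ⟩
    half ^ J               ∎
    where
    open ≤-Reasoning
    0≤1-q = ≤⇒0≤- q≤1

  ι*half^≤1 : ∀ {a J} → a ℕ.≤ 2 ℕ.^ J → ι a * half ^ J ≤ 1ℚ
  ι*half^≤1 {a} {J} le = ≤-trans (*-monoʳ (0≤^ J 0≤half) (ι-mono le))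
    (≤-reflexive (trans (*-comm _ (half ^ J)) (half^*2^ J)))

  sumℚ-const : ∀ {A : Set} (xs : List A) c → sumℚ xs (λ _ → c) ≡ ι (length xs) * c
  sumℚ-const []       c = sym (*-zeroˡ c)
  sumℚ-const (x ∷ xs) c = trans (cong (_+_ c) (sumℚ-const xs c)) (solve 2 (λ n c → c :+ n :* c := (con 1ℚ :+ n) :* c) refl (ι (length xs)) c)

  sumℚ-mono : ∀ {A : Set} (xs : List A) {f g : A → ℚ} → (∀ x → f x ≤ g x) → sumℚ xs f ≤ sumℚ xs g
  sumℚ-mono []       h = ≤-refl
  sumℚ-mono (x ∷ xs) h = +-mono-≤ (h x) (sumℚ-mono xs h)

  sumℚ-≤const : ∀ {A : Set} (xs : List A) {f : A → ℚ} {c} → (∀ x → f x ≤ c) → sumℚ xs f ≤ ι (length xs) * c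
  sumℚ-≤const xs {c = c} h = ≤-trans (sumℚ-mono xs h) (≤-reflexive (sumℚ-const xs c))

-- The union bound over both rounds and the choice of probabilities.

module Sprinkling where

  open Cubes
  open Subgraphs
  open Expectation
  open Exploring
  open ShortPaths
  open Separating
  open Asymptotics
  open Rationals
  open import Data.Bool using (Bool; true; false; _∧_; _∨_)
  open import Data.Nat as ℕ using (ℕ; zero; suc)
  import Data.Nat.Properties as ℕ
  import Data.Nat.DivMod as ℕ
  open import Data.Fin using (Fin)
  open import Data.Vec using (zipWith)
  open import Data.List using (List; []; _∷_; length; allFin; cartesianProduct; cartesianProductWith)
  open import Data.List.Properties using (length-tabulate)
  open import Data.List.Membership.Propositional using (_∈_)
  open import Data.List.Membership.Propositional.Properties using (∈-cartesianProductWith⁺; ∈-cartesianProduct⁺; ∈-allFin)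
  open import Data.List.Relation.Unary.Any using (here; there)
  open import Data.List.Relation.Unary.All as All using (All)
  open import Data.Rational hiding (∣_∣)
  open import Data.Rational.Properties
  open import Data.Rational.Solver using (module +-*-Solver)
  open +-*-Solver using (solve; _:+_; _:*_; _:-_; con; _:=_)
  import Data.Nat.Solver as ℕS
  open import Data.Product using (Σ; _×_; _,_; proj₁; proj₂)
  open import Data.Sum using (_⊎_; inj₁; inj₂)
  open import Relation.Binary.PropositionalEquality using (_≡_; refl; sym; trans; cong; cong₂; subst; module ≡-Reasoning)
  open import Relation.Nullary using (Dec; yes; no; does)
  open import Relation.Nullary.Decidable using (dec-true)

  shortLists : ∀ m → ℕ → List (List (Vertex m))
  shortLists m zero    = [] ∷ []
  shortLists m (suc k) = [] ∷ cartesianProductWith _∷_ (vertices m) (shortLists m k)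

  shortLists-complete : ∀ {m k} (xs : List (Vertex m)) → length xs ℕ.≤ k → xs ∈ shortLists m k
  shortLists-complete {k = zero}  []       _           = here refl
  shortLists-complete {k = suc k} []       _           = here refl
  shortLists-complete {k = suc k} (x ∷ xs) (ℕ.s≤s le) =
    there (∈-cartesianProductWith⁺ _∷_ (∈-vertices x) (shortLists-complete xs le))

  shortLists-nonEmpty : ∀ m k → 1 ℕ.≤ length (shortLists m k)
  shortLists-nonEmpty m zero    = ℕ.s≤s ℕ.z≤n
  shortLists-nonEmpty m (suc k) = ℕ.s≤s ℕ.z≤n

  length-shortLists : ∀ m k → length (shortLists m k) ℕ.≤ 2 ℕ.^ (suc m ℕ.* k)
  length-shortLists m zero    = ℕ.≤-reflexive (cong (2 ℕ.^_) (sym (ℕ.*-zeroʳ m)))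
  length-shortLists m (suc k) = begin
    suc (length (cartesianProductWith _∷_ (vertices m) (shortLists m k)))
      ≡⟨ cong suc (trans (length-cpw _∷_ (vertices m) (shortLists m k)) (cong (ℕ._* c) (length-vertices m))) ⟩
    -- The empty list is absorbed by doubling the product, hence `suc m` in the exponent.
    1 ℕ.+ 2 ℕ.^ m ℕ.* c
      ≤⟨ ℕ.+-monoˡ-≤ _ (ℕ.*-mono-≤ (ℕ.m^n>0 2 m) (shortLists-nonEmpty m k)) ⟩
    2 ℕ.^ m ℕ.* c ℕ.+ 2 ℕ.^ m ℕ.* c
      ≡⟨ ℕS.+-*-Solver.solve 2 (λ a c → a :*ₙ c :+ₙ a :*ₙ c :=ₙ (conₙ 2 :*ₙ a) :*ₙ c) refl (2 ℕ.^ m) c ⟩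
    2 ℕ.^ suc m ℕ.* c
      ≤⟨ ℕ.*-monoʳ-≤ (2 ℕ.^ suc m) (length-shortLists m k) ⟩
    2 ℕ.^ suc m ℕ.* 2 ℕ.^ (suc m ℕ.* k)
      ≡⟨ sym (ℕ.^-distribˡ-+-* 2 (suc m) (suc m ℕ.* k)) ⟩
    2 ℕ.^ (suc m ℕ.+ suc m ℕ.* k)
      ≡⟨ cong (2 ℕ.^_) (sym (ℕ.*-suc (suc m) k)) ⟩
    2 ℕ.^ (suc m ℕ.* suc k) ∎
    where
    open ℕ.≤-Reasoning
    open ℕS.+-*-Solver using () renaming (_:*_ to _:*ₙ_; _:+_ to _:+ₙ_; _:=_ to _:=ₙ_; con to conₙ)
    c = length (shortLists m k)

  sumℚ-ind : ∀ {A : Set} (xs : List A) (f : A → Bool) → sumℚ xs (λ x → ind (f x)) ≡ ι (∑ xs (λ x → ⟦ f x ⟧))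
  sumℚ-ind []       f = refl
  sumℚ-ind (x ∷ xs) f = trans (cong₂ _+_ (ind≡ι (f x)) (sumℚ-ind xs f)) (sym (ι-+ ⟦ f x ⟧ _))
    where
    ind≡ι : ∀ b → ind b ≡ ι ⟦ b ⟧
    ind≡ι true  = refl
    ind≡ι false = refl

  module UnionBound (m s : ℕ) .{{nz : ℕ.NonZero m}} (m^16≤ : m ℕ.^ 16 ℕ.≤ 2 ℕ.^ m) (22≤m : 22 ℕ.≤ m)
    {p₁ p₂ z q : ℚ} (0≤p₁ : 0ℚ ≤ p₁) (p₁≤1 : p₁ ≤ 1ℚ) (0≤p₂ : 0ℚ ≤ p₂) (p₂≤1 : p₂ ≤ 1ℚ) (0≤q : 0ℚ ≤ q) (q≤ : q ≤ p₂ ^ 3)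
    (bad-unlikely : ∀ (x : Vertex m) → E {numEdges m} p₁ (λ v → ind (bad {m} (m ℕ.^ 9) v x)) ≤ z ^ m) where

    open Parameters m s

    private
      n = numEdges m
      1≤m : 1 ℕ.≤ m
      1≤m = ℕ.≤-trans (ℕ.s≤s ℕ.z≤n) 22≤m
      q≤1 : q ≤ 1ℚ
      q≤1 = ≤-trans q≤ (^≤1 3 0≤p₂ p₂≤1)

    Index : Set
    Index = List (Vertex m) × (List (Vertex m) × (List (Vertex m) × Fin m))

    indices : List Index
    indices = cartesianProduct (shortLists m ℓ) (cartesianProduct (shortLists m N) (cartesianProduct (shortLists m N) (allFin m)))

    length-indices : m ℕ.* length indices ℕ.≤ 2 ℕ.^ J
    length-indices = begin
      m ℕ.* length indices
        ≡⟨ cong (m ℕ.*_) (trans (length-cpw _,_ (shortLists m ℓ) _) (cong (a ℕ.*_) (trans (length-cpw _,_ (shortLists m N) _)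
             (cong (b ℕ.*_) (trans (length-cpw _,_ (shortLists m N) _) (cong (b ℕ.*_) (length-tabulate {n = m} (λ i → i)))))))) ⟩
      m ℕ.* (a ℕ.* (b ℕ.* (b ℕ.* m)))
        ≡⟨ ℕS.+-*-Solver.solve 3 (λ m a b → m :*ₙ (a :*ₙ (b :*ₙ (b :*ₙ m))) :=ₙ (m :*ₙ m) :*ₙ (a :*ₙ (b :*ₙ b))) refl m a b ⟩
      (m ℕ.* m) ℕ.* (a ℕ.* (b ℕ.* b))
        ≤⟨ ℕ.*-mono-≤ (ℕ.*-mono-≤ (ℕ.<⇒≤ (n<2^n m)) (ℕ.<⇒≤ (n<2^n m)))
             (ℕ.*-mono-≤ (length-shortLists m ℓ) (ℕ.*-mono-≤ (length-shortLists m N) (length-shortLists m N))) ⟩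
      (2 ℕ.^ m ℕ.* 2 ℕ.^ m) ℕ.* (2 ℕ.^ (suc m ℕ.* ℓ) ℕ.* (2 ℕ.^ (suc m ℕ.* N) ℕ.* 2 ℕ.^ (suc m ℕ.* N)))
        ≡⟨ sym (trans (ℕ.^-distribˡ-+-* 2 (m ℕ.+ m) _) (cong₂ ℕ._*_ (ℕ.^-distribˡ-+-* 2 m m)
             (trans (cong (2 ℕ.^_) (trans (ℕ.*-distribˡ-+ (suc m) ℓ (N ℕ.+ N)) (cong (suc m ℕ.* ℓ ℕ.+_) (ℕ.*-distribˡ-+ (suc m) N N))))
               (trans (ℕ.^-distribˡ-+-* 2 (suc m ℕ.* ℓ) _) (cong (2 ℕ.^ (suc m ℕ.* ℓ) ℕ.*_) (ℕ.^-distribˡ-+-* 2 (suc m ℕ.* N) _)))))) ⟩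
      2 ℕ.^ J ∎
      where
      open ℕ.≤-Reasoning
      open ℕS.+-*-Solver using () renaming (_:*_ to _:*ₙ_; _:=_ to _:=ₙ_)
      a = length (shortLists m ℓ)
      b = length (shortLists m N)

    ev : Bits m → Index → Bits m → Bool
    ev v (P , Z , Z′ , i) w = Event.event v P Z Z′ D i w

    -- The paths depend on `v` and the certificate alone, so for the second round they form a fixed
    -- family of disjoint edge lists.
    E-ev : ∀ v t → E {n} p₂ (λ w → ind (ev v t w)) ≤ (1ℚ - q) ^ D
    E-ev v (P , Z , Z′ , i) = by (D ℕ.≤? length (paths i)) refl
      where
      open Event v P Z Z′
      by : (d : Dec (D ℕ.≤ length (paths i))) → does d ≡ does (D ℕ.≤? length (paths i)) →
           E {n} p₂ (λ w → ind (event D i w)) ≤ (1ℚ - q) ^ D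
      by (yes le) _ = ≤-trans (E-mono 0≤p₂ p₂≤1 {n} (λ w → ind-mono (λ e → ∧-elimʳ {does (D ℕ.≤? length (paths i))} e)))
        (≤-trans (E-noneOpen 0≤p₂ p₂≤1 (paths i) q≤1 (All.map (λ short → ≤-trans q≤ (^-antimonoʳ 0≤p₂ p₂≤1 short)) (paths-short i)) (paths-disjoint i))
                 (^-antimonoʳ (≤⇒0≤- q≤1) (1-q≤1 0≤q) le))
      by (no ¬le) e = ≤-trans (E-≤const 0≤p₂ p₂≤1 {n} (λ w → ≤-reflexive (cong (λ b → ind (b ∧ noneOpen (paths i) w)) (sym e))))
        (0≤^ D (≤⇒0≤- q≤1))

    -- Markov's inequality in pointwise form: this multiple of the number of bad vertices is at
    -- least 1 once that number exceeds `β`, and its expectation is at most `T₁`.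
    badTerm : Bits m → ℚ
    badTerm v = ι (m ℕ.^ 4) * half ^ m * sumℚ (vertices m) (λ x → ind (bad {m} r v x))

    eventTerm : Bits m → Bits m → ℚ
    eventTerm v w = sumℚ indices (λ t → ind (ev v t w))

    cycle : Bits m → Bool
    cycle v = does (HasLongCycle? {m} (mkOutcome v))

    0≤badTerm : ∀ v → 0ℚ ≤ badTerm v
    0≤badTerm v = 0≤* (0≤* (0≤ι (m ℕ.^ 4)) (0≤^ m 0≤half)) (0≤sumℚ (vertices m) (λ x → 0≤ind (bad {m} r v x)))

    0≤eventTerm : ∀ v w → 0ℚ ≤ eventTerm v w
    0≤eventTerm v w = 0≤sumℚ indices (λ t → 0≤ind (ev v t w))

    large : ∀ v → β ℕ.< ∣ bad {m} r v ∣ → 1ℚ ≤ badTerm v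
    large v many = begin
      1ℚ                                                  ≡⟨ sym (half^*2^ m) ⟩
      half ^ m * ι (2 ℕ.^ m)                              ≤⟨ *-monoˡ (0≤^ m 0≤half) (ι-mono (β-large many)) ⟩
      half ^ m * ι (m ℕ.^ 4 ℕ.* ∣ bad {m} r v ∣)          ≡⟨ cong (half ^ m *_) (ι-* (m ℕ.^ 4) ∣ bad {m} r v ∣) ⟩
      half ^ m * (ι (m ℕ.^ 4) * ι ∣ bad {m} r v ∣)        ≡⟨ solve 3 (λ h a b → h :* (a :* b) := a :* h :* b) refl (half ^ m) (ι (m ℕ.^ 4)) (ι ∣ bad {m} r v ∣) ⟩
      ι (m ℕ.^ 4) * half ^ m * ι ∣ bad {m} r v ∣          ≡⟨ cong (ι (m ℕ.^ 4) * half ^ m *_) (sym (sumℚ-ind (vertices m) (bad {m} r v))) ⟩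
      badTerm v                                           ∎
      where open ≤-Reasoning

    -- Both ways of failing are charged pointwise. Taking expectations of this one inequality, over
    -- `w` and then over `v`, is the whole union bound.
    cover : ∀ v w → 1ℚ ≤ ind (cycle (zipWith _∨_ v w)) + (badTerm v + eventTerm v w)
    cover v w = byBad (∣ bad {m} r v ∣ ℕ.≤? β)
      where
      Goal : Set
      Goal = 1ℚ ≤ ind (cycle (zipWith _∨_ v w)) + (badTerm v + eventTerm v w)
      0≤ind-cycle = 0≤ind (cycle (zipWith _∨_ v w))
      byEvent : HasLongCycle {m} (mkOutcome (zipWith _∨_ v w)) ⊎ SomeEvent ℓ N D v w → Goal
      byEvent (inj₁ h) = ≤-trans (≤-reflexive (sym (+-identityʳ 1ℚ))) (+-mono-≤
        (≤-reflexive (sym (cong ind (dec-true (HasLongCycle? {m} (mkOutcome (zipWith _∨_ v w))) h)))) (0≤+ (0≤badTerm v) (0≤eventTerm v w)))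
      byEvent (inj₂ (P , Z , Z′ , i , lP , lZ , lZ′ , e)) = ≤-trans (≤-reflexive (sym (+-identityˡ 1ℚ))) (+-mono-≤ 0≤ind-cycle
        (≤-trans (≤-reflexive (sym (+-identityˡ 1ℚ))) (+-mono-≤ (0≤badTerm v)
              (≤-trans (≤-reflexive (sym (cong ind e))) (∈⇒≤sumℚ (λ t → 0≤ind (ev v t w))
                (∈-cartesianProduct⁺ (shortLists-complete P lP) (∈-cartesianProduct⁺ (shortLists-complete Z lZ)
                  (∈-cartesianProduct⁺ (shortLists-complete Z′ lZ′) (∈-allFin i)))))))))
      byBad : Dec (∣ bad {m} r v ∣ ℕ.≤ β) → Goal
      byBad (no many) = ≤-trans (≤-reflexive (sym (+-identityˡ 1ℚ))) (+-mono-≤ 0≤ind-cycle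
        (≤-trans (≤-reflexive (sym (+-identityʳ 1ℚ))) (+-mono-≤ (large v (ℕ.≰⇒> many)) (0≤eventTerm v w))))
      byBad (yes few) = byEvent (Deterministic.cycleOrEvent 1≤m r ℓ N β D N-large (enough m^16≤ 22≤m) v w few (2≤ℓ′ m^16≤ 22≤m) (long-enough m^16≤ 22≤m))

    T₁ T₂ : ℚ
    T₁ = ι (m ℕ.^ 4) * z ^ m
    T₂ = ι (length indices) * (1ℚ - q) ^ D

    E-badTerm : E {n} p₁ badTerm ≤ T₁
    E-badTerm = begin
      E {n} p₁ badTerm
        ≡⟨ E-* {n} p₁ (ι (m ℕ.^ 4) * half ^ m) _ ⟩
      ι (m ℕ.^ 4) * half ^ m * E {n} p₁ (λ v → sumℚ (vertices m) (λ x → ind (bad {m} r v x)))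
        ≡⟨ cong (ι (m ℕ.^ 4) * half ^ m *_) (E-sumℚ {n} p₁ (vertices m) (λ x v → ind (bad {m} r v x))) ⟩
      ι (m ℕ.^ 4) * half ^ m * sumℚ (vertices m) (λ x → E {n} p₁ (λ v → ind (bad {m} r v x)))
        ≤⟨ *-monoˡ (0≤* (0≤ι (m ℕ.^ 4)) (0≤^ m 0≤half)) (sumℚ-≤const (vertices m) bad-unlikely) ⟩
      ι (m ℕ.^ 4) * half ^ m * (ι (length (vertices m)) * z ^ m)
        ≡⟨ cong (λ k → ι (m ℕ.^ 4) * half ^ m * (ι k * z ^ m)) (length-vertices m) ⟩
      ι (m ℕ.^ 4) * half ^ m * (ι (2 ℕ.^ m) * z ^ m)
        ≡⟨ solve 4 (λ a h b z → a :* h :* (b :* z) := a :* (h :* b) :* z) refl (ι (m ℕ.^ 4)) (half ^ m) (ι (2 ℕ.^ m)) (z ^ m) ⟩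
      ι (m ℕ.^ 4) * (half ^ m * ι (2 ℕ.^ m)) * z ^ m
        ≡⟨ cong (λ k → ι (m ℕ.^ 4) * k * z ^ m) (half^*2^ m) ⟩
      ι (m ℕ.^ 4) * 1ℚ * z ^ m
        ≡⟨ cong (_* z ^ m) (*-identityʳ (ι (m ℕ.^ 4))) ⟩
      T₁ ∎
      where open ≤-Reasoning

    E-eventTerm : ∀ v → E {n} p₂ (eventTerm v) ≤ T₂
    E-eventTerm v = ≤-trans (≤-reflexive (E-sumℚ {n} p₂ indices (λ t w → ind (ev v t w)))) (sumℚ-≤const indices (E-ev v))

    cycle-likely : 1ℚ ≤ E {n} (1ℚ - (1ℚ - p₁) * (1ℚ - p₂)) (λ v → ind (cycle v)) + (T₁ + T₂)
    cycle-likely = begin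
      1ℚ
        ≡⟨ sym (E-const {n} p₁ 1ℚ) ⟩
      E {n} p₁ (λ _ → 1ℚ)
        ≤⟨ E-mono 0≤p₁ p₁≤1 {n} round₂ ⟩
      E {n} p₁ (λ v → F v + (badTerm v + T₂))
        ≡⟨ trans (E-+ {n} p₁ F _) (cong (E {n} p₁ F +_) (trans (E-+ {n} p₁ badTerm _) (cong (E {n} p₁ badTerm +_) (E-const {n} p₁ T₂)))) ⟩
      E {n} p₁ F + (E {n} p₁ badTerm + T₂)
        ≤⟨ +-monoʳ-≤ (E {n} p₁ F) (+-monoˡ-≤ T₂ E-badTerm) ⟩
      E {n} p₁ F + (T₁ + T₂)
        ≡⟨ cong (_+ (T₁ + T₂)) (sym (E-∨ {n} p₁ p₂ (λ v → ind (cycle v)))) ⟩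
      E {n} (1ℚ - (1ℚ - p₁) * (1ℚ - p₂)) (λ v → ind (cycle v)) + (T₁ + T₂) ∎
      where
      open ≤-Reasoning
      F : Bits m → ℚ
      F v = E {n} p₂ (λ w → ind (cycle (zipWith _∨_ v w)))
      round₂ : ∀ v → 1ℚ ≤ F v + (badTerm v + T₂)
      round₂ v = begin
        1ℚ
          ≡⟨ sym (E-const {n} p₂ 1ℚ) ⟩
        E {n} p₂ (λ _ → 1ℚ)
          ≤⟨ E-mono 0≤p₂ p₂≤1 {n} (cover v) ⟩
        E {n} p₂ (λ w → ind (cycle (zipWith _∨_ v w)) + (badTerm v + eventTerm v w))
          ≡⟨ trans (E-+ {n} p₂ (λ w → ind (cycle (zipWith _∨_ v w))) _) (cong (F v +_) (trans (E-+ {n} p₂ (λ _ → badTerm v) (eventTerm v))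
               (cong (_+ E {n} p₂ (eventTerm v)) (E-const {n} p₂ (badTerm v))))) ⟩
        F v + (badTerm v + E {n} p₂ (eventTerm v))
          ≤⟨ +-monoʳ-≤ (F v) (+-monoʳ-≤ (badTerm v) (E-eventTerm v)) ⟩
        F v + (badTerm v + T₂) ∎

  module Constants (m s : ℕ) (1≤s : 1 ℕ.≤ s) (22≤m : 22 ℕ.≤ m)
    (m^16≤ : m ℕ.^ 16 ℕ.≤ 2 ℕ.^ m) (m^10≤ : m ℕ.^ 10 ℕ.≤ 2 ℕ.^ (m ℕ./ (4 ℕ.+ 4 ℕ.* s)))
    (m^5≤ : m ℕ.^ 5 ℕ.≤ 2 ℕ.^ (m ℕ./ (1 ℕ.+ 2 ℕ.* s))) (s≤m : 8 ℕ.* s ℕ.^ 3 ℕ.≤ m)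
    {ε : ℚ} (2σ≤ε : recipℕ s + recipℕ s ≤ ε) (ε≤m : 1ℚ + ε ≤ ι m) where

    private
      1≤m : 1 ℕ.≤ m
      1≤m = ℕ.≤-trans (ℕ.s≤s ℕ.z≤n) 22≤m
      instance
        nz : ℕ.NonZero m
        nz = ℕ.>-nonZero 1≤m
      t = 1 ℕ.+ 2 ℕ.* s
      1≤t : 1 ℕ.≤ t
      1≤t = ℕ.s≤s ℕ.z≤n

    -- `z` is the reciprocal of 1 + σ/2. A vertex has 1 + σ expected open edges in the first round,
    -- and passing from `m` to `d` boundary edges per vertex costs at most half of the surplus. `y`
    -- is 1 + p₁(1 - z), which makes the left side of `super` equal to 1 - p₁²η.
    μ σ η p p₁ y z : ℚ
    μ = recipℕ m
    σ = recipℕ s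
    η = recipℕ t
    p = (1ℚ + ε) * μ
    p₁ = (1ℚ + σ) * μ
    z = 1ℚ - η
    y = 1ℚ + p₁ * η

    0≤μ : 0ℚ ≤ μ
    0≤μ = 0≤recip m

    0≤σ : 0ℚ ≤ σ
    0≤σ = 0≤recip s

    0≤η : 0ℚ ≤ η
    0≤η = 0≤recip t

    0<σμ : 0ℚ < σ * μ
    0<σμ = subst (_< σ * μ) (*-zeroʳ σ) (*-monoʳ-<-pos σ {{positive (0<recip 1≤s)}} (0<recip 1≤m))

    0≤σμ : 0ℚ ≤ σ * μ
    0≤σμ = <⇒≤ 0<σμ

    p≤1 : p ≤ 1ℚ
    p≤1 = ≤-trans (*-monoʳ 0≤μ ε≤m) (≤-reflexive (ι*recip 1≤m))

    gap : σ * μ ≤ p - p₁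
    gap = ≤-trans (*-monoʳ 0≤μ (≤-trans (≤-reflexive (solve 1 (λ s → s := s :+ s :- s) refl σ)) (+-monoˡ-≤ (- σ) 2σ≤ε)))
      (≤-reflexive (solve 3 (λ e s u → (e :- s) :* u := (con 1ℚ :+ e) :* u :- (con 1ℚ :+ s) :* u) refl ε σ μ))

    0≤p₁ : 0ℚ ≤ p₁
    0≤p₁ = 0≤* (0≤+ 0≤1 0≤σ) 0≤μ

    c : ℚ
    c = 1ℚ - p₁

    p-p₁≤c : p - p₁ ≤ c
    p-p₁≤c = +-monoˡ-≤ (- p₁) p≤1

    0<c : 0ℚ < c
    0<c = <-≤-trans 0<σμ (≤-trans gap p-p₁≤c)

    p₁≤1 : p₁ ≤ 1ℚ
    p₁≤1 = 0≤-⇒≤ (<⇒≤ 0<c)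

    c⁻¹ : ℚ
    c⁻¹ = (1/ c) {{pos⇒nonZero c {{positive 0<c}}}}

    cc⁻¹ : c * c⁻¹ ≡ 1ℚ
    cc⁻¹ = *-inverseʳ c {{pos⇒nonZero c {{positive 0<c}}}}

    1≤c⁻¹ : 1ℚ ≤ c⁻¹
    1≤c⁻¹ = *-cancelˡ 0<c (≤-trans (≤-reflexive (*-identityʳ c)) (≤-trans (1-q≤1 0≤p₁) (≤-reflexive (sym cc⁻¹))))

    -- Solves for the probability with which the union of both rounds has density exactly `p`, see
    -- `p≡`. It is at least `σ * μ` because dividing by `c` only enlarges the gap.
    p₂ : ℚ
    p₂ = (p - p₁) * c⁻¹

    cp₂ : c * p₂ ≡ p - p₁
    cp₂ = trans (solve 3 (λ c g i → c :* (g :* i) := g :* (c :* i)) refl c (p - p₁) c⁻¹)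
      (trans (cong ((p - p₁) *_) cc⁻¹) (*-identityʳ _))

    σμ≤p₂ : σ * μ ≤ p₂
    σμ≤p₂ = ≤-trans gap (≤-trans (≤-reflexive (sym (*-identityʳ (p - p₁)))) (*-monoˡ (≤-trans 0≤σμ gap) 1≤c⁻¹))

    0≤p₂ : 0ℚ ≤ p₂
    0≤p₂ = ≤-trans 0≤σμ σμ≤p₂

    p₂≤1 : p₂ ≤ 1ℚ
    p₂≤1 = *-cancelˡ 0<c (≤-trans (≤-reflexive cp₂) (≤-trans p-p₁≤c (≤-reflexive (sym (*-identityʳ c)))))

    p≡ : 1ℚ - (1ℚ - p₁) * (1ℚ - p₂) ≡ p
    p≡ = trans (solve 2 (λ p₁ p₂ → con 1ℚ :- (con 1ℚ :- p₁) :* (con 1ℚ :- p₂) := p₁ :+ (con 1ℚ :- p₁) :* p₂) refl p₁ p₂)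
      (trans (cong (p₁ +_) cp₂) (solve 2 (λ a b → a :+ (b :- a) := b) refl p₁ p))

    q : ℚ
    q = (σ * μ) ^ 3

    0≤q : 0ℚ ≤ q
    0≤q = 0≤^ 3 0≤σμ

    q≤ : q ≤ p₂ ^ 3
    q≤ = ^-mono 3 0≤σμ σμ≤p₂

    1≤kq : 1ℚ ≤ ι ((s ℕ.* m) ℕ.^ 3) * q
    1≤kq = ≤-reflexive (sym (trans (cong (_* q) (trans (ι-^ (s ℕ.* m) 3) (cong (_^ 3) (ι-* s m))))
      (trans (sym (^-distrib-* (ι s * ι m) (σ * μ) 3)) (cong (_^ 3) (trans
        (solve 4 (λ a b c d → a :* b :* (c :* d) := a :* c :* (b :* d)) refl (ι s) (ι m) σ μ)
        (cong₂ _*_ (ι*recip 1≤s) (ι*recip 1≤m)))))))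

    -- The explored set is kept below `2 ^ k`. Then `2 * k` is at most the share 1/(2 + 2s) of `m`,
    -- just what `d-large` can spare.
    k d : ℕ
    k = m ℕ./ (4 ℕ.+ 4 ℕ.* s)
    d = m ℕ.∸ 2 ℕ.* k

    4k≤m : k ℕ.* (4 ℕ.+ 4 ℕ.* s) ℕ.≤ m
    4k≤m = ℕ.m/n*n≤m m (4 ℕ.+ 4 ℕ.* s)

    d+2k : d ℕ.+ 2 ℕ.* k ≡ m
    d+2k = ℕ.m∸n+n≡m (ℕ.≤-trans (ℕ.*-monoˡ-≤ k (ℕ.s≤s (ℕ.s≤s (ℕ.z≤n {2 ℕ.+ 4 ℕ.* s})))) (subst (ℕ._≤ m) (ℕ.*-comm k _) 4k≤m))

    d-large : t ℕ.* m ℕ.≤ d ℕ.* (1 ℕ.+ t)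
    d-large = ℕ.+-cancelʳ-≤ m _ _ (begin
      t ℕ.* m ℕ.+ m
        ≡⟨ trans (ℕ.+-comm (t ℕ.* m) m) (cong (suc t ℕ.*_) (sym d+2k)) ⟩
      suc t ℕ.* (d ℕ.+ 2 ℕ.* k)
        ≡⟨ ℕS.+-*-Solver.solve 3 (λ s d k → (conₙ 2 :+ₙ conₙ 2 :*ₙ s) :*ₙ (d :+ₙ conₙ 2 :*ₙ k)
              :=ₙ d :*ₙ (conₙ 2 :+ₙ conₙ 2 :*ₙ s) :+ₙ k :*ₙ (conₙ 4 :+ₙ conₙ 4 :*ₙ s)) refl s d k ⟩
      d ℕ.* suc t ℕ.+ k ℕ.* (4 ℕ.+ 4 ℕ.* s)
        ≤⟨ ℕ.+-monoʳ-≤ (d ℕ.* suc t) 4k≤m ⟩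
      d ℕ.* suc t ℕ.+ m ∎)
      where
      open ℕ.≤-Reasoning
      open ℕS.+-*-Solver using () renaming (_:*_ to _:*ₙ_; _:+_ to _:+ₙ_; _:=_ to _:=ₙ_; con to conₙ)

    -- Expected number of open edges among d boundary edges.
    g : ℚ
    g = ι d * p₁

    ι2s : ι (2 ℕ.* s) ≡ ι s + ι s
    ι2s = trans (ι-+ s (s ℕ.+ 0)) (cong (λ x → ι s + ι x) (ℕ.+-identityʳ s))

    -- In fractions, g ≥ (1 + 2s)/(2s) = 1/z: by `d-large`, d/m is at least (1 + 2s)/(2 + 2s), and 1
    -- + σ is (1 + s)/s.
    2sg : ι t ≤ ι (2 ℕ.* s) * g
    2sg = begin
      ι t
        ≡⟨ sym (*-identityʳ (ι t)) ⟩
      ι t * 1ℚ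
        ≡⟨ cong (ι t *_) (sym (ι*recip 1≤m)) ⟩
      ι t * (ι m * μ)
        ≡⟨ trans (sym (*-assoc (ι t) (ι m) μ)) (cong (_* μ) (sym (ι-* t m))) ⟩
      ι (t ℕ.* m) * μ
        ≤⟨ *-monoʳ 0≤μ (ι-mono d-large) ⟩
      ι (d ℕ.* suc t) * μ
        ≡⟨ cong (_* μ) (trans (ι-* d (suc t)) (cong (λ x → ι d * (1ℚ + (1ℚ + x))) ι2s)) ⟩
      ι d * (1ℚ + (1ℚ + (ι s + ι s))) * μ
        ≡⟨ cong (λ x → ι d * (x + (x + (ι s + ι s))) * μ) (sym (ι*recip 1≤s)) ⟩
      ι d * (ι s * σ + (ι s * σ + (ι s + ι s))) * μ
        ≡⟨ solve 4 (λ d s σ μ → d :* (s :* σ :+ (s :* σ :+ (s :+ s))) :* μ := (s :+ s) :* (d :* ((con 1ℚ :+ σ) :* μ))) refl (ι d) (ι s) σ μ ⟩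
      (ι s + ι s) * g
        ≡⟨ cong (_* g) (sym ι2s) ⟩
      ι (2 ℕ.* s) * g ∎
      where open ≤-Reasoning

    tz : ι t * z ≡ ι (2 ℕ.* s)
    tz = trans (solve 2 (λ t e → t :* (con 1ℚ :- e) := t :- t :* e) refl (ι t) η)
      (trans (cong (λ x → ι t - x) (ι*recip 1≤t)) (solve 1 (λ a → con 1ℚ :+ a :- con 1ℚ := a) refl (ι (2 ℕ.* s))))

    1≤zg : 1ℚ ≤ z * g
    1≤zg = *-cancelˡ (0<ι 1≤t) (≤-trans (≤-reflexive (*-identityʳ (ι t))) (≤-trans 2sg
      (≤-reflexive (trans (cong (_* g) (sym tz)) (*-assoc (ι t) z g)))))

    η≤1 : η ≤ 1ℚ
    η≤1 = *-cancelˡ (0<ι 1≤t) (≤-trans (≤-reflexive (ι*recip 1≤t)) (≤-trans (1≤ι 1≤t) (≤-reflexive (sym (*-identityʳ (ι t))))))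

    0≤z : 0ℚ ≤ z
    0≤z = ≤⇒0≤- η≤1

    z≤1 : z ≤ 1ℚ
    z≤1 = 1-q≤1 0≤η

    1≤y : 1ℚ ≤ y
    1≤y = ≤-trans (≤-reflexive (sym (+-identityʳ 1ℚ))) (+-monoʳ-≤ 1ℚ (0≤* 0≤p₁ 0≤η))

    super : p₁ * z + (1ℚ - p₁) * y ≤ 1ℚ
    super = 0≤-⇒≤ (≤-trans (0≤* (0≤* 0≤p₁ 0≤p₁) 0≤η) (≤-reflexive
      (solve 2 (λ p e → p :* p :* e := con 1ℚ :- (p :* (con 1ℚ :- e) :+ (con 1ℚ :- p) :* (con 1ℚ :+ p :* e))) refl p₁ η)))

    -- By `Bernoulli`, `y ^ d` is at least 1 + gη, and (1 + gη)z = z + η(zg) is at least z + η = 1.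
    drift : 1ℚ ≤ y ^ d * z
    drift = begin
      1ℚ
        ≡⟨ solve 1 (λ e → con 1ℚ := (con 1ℚ :- e) :+ e :* con 1ℚ) refl η ⟩
      z + η * 1ℚ
        ≤⟨ +-monoʳ-≤ z (*-monoˡ 0≤η 1≤zg) ⟩
      z + η * (z * g)
        ≡⟨ solve 4 (λ z e d p → z :+ e :* (z :* (d :* p)) := (con 1ℚ :+ d :* (p :* e)) :* z) refl z η (ι d) p₁ ⟩
      (1ℚ + ι d * (p₁ * η)) * z
        ≤⟨ *-monoʳ 0≤z (Bernoulli d (0≤* 0≤p₁ 0≤η)) ⟩
      y ^ d * z ∎
      where open ≤-Reasoning

    -- A start set of at least `m` neighbours gives the exponent `m`. The target size `m * m ^ 9` is
    -- `m ^ 10` by computation, and `m^10≤` puts it below `2 ^ k`.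
    bad-unlikely : ∀ (x : Vertex m) → E {numEdges m} p₁ (λ v → ind (bad {m} (m ℕ.^ 9) v x)) ≤ z ^ m
    bad-unlikely x = Exploration.E-small {m} {m ℕ.* m ℕ.^ 9} {k} {d} m^10≤ (ℕ.≤-reflexive d+2k)
      0≤p₁ p₁≤1 1≤y 0≤z z≤1 super drift (neighbours x) m (∣neighbours∣ x)

    open UnionBound m s m^16≤ 22≤m 0≤p₁ p₁≤1 0≤p₂ p₂≤1 0≤q q≤ bad-unlikely
    open Parameters m s using (D; J; rounds)

    -- As `η` is the reciprocal of `t`, every `t` factors of `z` contribute a half, which beats the
    -- polynomial `m ^ 5`.
    mT₁≤1 : ι m * T₁ ≤ 1ℚ
    mT₁≤1 = begin
      ι m * (ι (m ℕ.^ 4) * z ^ m)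
        ≡⟨ trans (sym (*-assoc (ι m) (ι (m ℕ.^ 4)) (z ^ m))) (cong (_* z ^ m) (sym (ι-* m (m ℕ.^ 4)))) ⟩
      ι (m ℕ.^ 5) * z ^ m
        ≤⟨ *-monoˡ (0≤ι (m ℕ.^ 5)) (halving-rounds t (m ℕ./ t) 0≤η η≤1 (≤-reflexive (sym (ι*recip 1≤t)))
             (subst (ℕ._≤ m) (ℕ.*-comm (m ℕ./ t) t) (ℕ.m/n*n≤m m t))) ⟩
      ι (m ℕ.^ 5) * half ^ (m ℕ./ t)
        ≤⟨ ι*half^≤1 {m ℕ.^ 5} {m ℕ./ t} m^5≤ ⟩
      1ℚ ∎
      where open ≤-Reasoning

    mT₂≤1 : ι m * T₂ ≤ 1ℚ
    mT₂≤1 = begin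
      ι m * (ι (length indices) * (1ℚ - q) ^ D)
        ≡⟨ trans (sym (*-assoc (ι m) (ι (length indices)) ((1ℚ - q) ^ D))) (cong (_* (1ℚ - q) ^ D) (sym (ι-* m (length indices)))) ⟩
      ι (m ℕ.* length indices) * (1ℚ - q) ^ D
        ≤⟨ *-monoˡ (0≤ι (m ℕ.* length indices)) (halving-rounds ((s ℕ.* m) ℕ.^ 3) J 0≤q (≤-trans q≤ (^≤1 3 0≤p₂ p₂≤1)) 1≤kq (rounds m^16≤ 22≤m s≤m)) ⟩
      ι (m ℕ.* length indices) * half ^ J
        ≤⟨ ι*half^≤1 {m ℕ.* length indices} {J} length-indices ⟩
      1ℚ ∎
      where open ≤-Reasoning

    conclusion : ∀ {δ} → 1ℚ + 1ℚ ≤ ι m * δ → 1ℚ - δ ≤ ProbLongCycle ε m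
    conclusion {δ} 2≤mδ = begin
      1ℚ - δ
        ≤⟨ +-monoʳ-≤ 1ℚ (neg-antimono-≤ T≤δ) ⟩
      1ℚ - (T₁ + T₂)
        ≤⟨ +-monoˡ-≤ (- (T₁ + T₂)) cycle-likely ⟩
      E {numEdges m} (1ℚ - (1ℚ - p₁) * (1ℚ - p₂)) (λ v → ind (cycle v)) + (T₁ + T₂) - (T₁ + T₂)
        ≡⟨ solve 2 (λ a b → a :+ b :- b := a) refl (E {numEdges m} (1ℚ - (1ℚ - p₁) * (1ℚ - p₂)) (λ v → ind (cycle v))) (T₁ + T₂) ⟩
      E {numEdges m} (1ℚ - (1ℚ - p₁) * (1ℚ - p₂)) (λ v → ind (cycle v))
        ≡⟨ cong (λ x → E {numEdges m} x (λ v → ind (cycle v))) p≡ ⟩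
      E {numEdges m} p (λ v → ind (cycle v))
        ≡⟨ sym (Prob≡E m p (HasLongCycle? {m})) ⟩
      ProbLongCycle ε m ∎
      where
      open ≤-Reasoning
      T≤δ : T₁ + T₂ ≤ δ
      T≤δ = *-cancelˡ (0<ι 1≤m) (≤-trans (≤-reflexive (*-distribˡ-+ (ι m) T₁ T₂)) (≤-trans (+-mono-≤ mT₁≤1 mT₂≤1) 2≤mδ))

  twice : ∀ {n x} → 1ℚ ≤ ι n * x → 1ℚ + 1ℚ ≤ ι (n ℕ.+ n) * x
  twice {n} {x} h = ≤-trans (+-mono-≤ h h) (≤-reflexive (sym (trans (cong (_* x) (ι-+ n n)) (*-distribʳ-+ x (ι n) (ι n)))))

  Eventually : (ℕ → Set) → Set
  Eventually P = Σ ℕ λ M → (m : ℕ) → M ℕ.≤ m → P m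

  infixr 4 _and_
  _and_ : ∀ {P Q : ℕ → Set} → Eventually P → Eventually Q → Eventually (λ m → P m × Q m)
  (M , f) and (M′ , g) = M ℕ.⊔ M′ , λ m le → f m (ℕ.m⊔n≤o⇒m≤o M M′ le) , g m (ℕ.m⊔n≤o⇒n≤o M M′ le)

  eventually-≥ : ∀ a → Eventually (a ℕ.≤_)
  eventually-≥ a = a , λ m a≤m → a≤m

  2recip≤ : ∀ {a ε} → 1 ℕ.≤ a → 1ℚ ≤ ι a * ε → recipℕ (a ℕ.+ a) + recipℕ (a ℕ.+ a) ≤ ε
  2recip≤ {a} {ε} 1≤a 1≤aε = *-cancelˡ (0<ι 1≤a) (≤-trans (≤-reflexive (begin
    ι a * (x + x)      ≡⟨ solve 2 (λ a x → a :* (x :+ x) := (a :+ a) :* x) refl (ι a) x ⟩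
    (ι a + ι a) * x    ≡⟨ cong (_* x) (sym (ι-+ a a)) ⟩
    ι (a ℕ.+ a) * x    ≡⟨ ι*recip (ℕ.≤-trans 1≤a (ℕ.m≤m+n a a)) ⟩
    1ℚ                 ∎)) 1≤aε)
    where
    open ≡-Reasoning
    x = recipℕ (a ℕ.+ a)

  likely : ∀ {ε δ a b e} → 1 ℕ.≤ a → 0ℚ ≤ δ → 1ℚ ≤ ι a * ε → 1ℚ ≤ ι b * δ → 1ℚ + ε ≤ ι e →
           Eventually (λ m → 1ℚ - δ ≤ ProbLongCycle ε m)
  likely {ε} {δ} {a} {b} {e} 1≤a 0≤δ 1≤aε 1≤bδ 1+ε≤e = proj₁ all , λ m le → finish m (proj₂ all m le)
    where
    -- With σ = 1/(2a), the sum of two copies of σ is 1/a, which is at most ε.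
    s = a ℕ.+ a
    -- Here `e ≤ m` makes `p` at most 1, and `b + b ≤ m` lets the two error terms, at most 1/m each,
    -- fit into δ.
    Large : ℕ → Set
    Large m = 22 ℕ.≤ m × m ℕ.^ 16 ℕ.≤ 2 ℕ.^ (m ℕ./ 1) × m ℕ.^ 10 ℕ.≤ 2 ℕ.^ (m ℕ./ (4 ℕ.+ 4 ℕ.* s))
      × m ℕ.^ 5 ℕ.≤ 2 ℕ.^ (m ℕ./ (1 ℕ.+ 2 ℕ.* s)) × 8 ℕ.* s ℕ.^ 3 ℕ.≤ m × e ℕ.≤ m × b ℕ.+ b ℕ.≤ m
    all : Eventually Large
    all = eventually-≥ 22 and poly≤exp 15 0 and poly≤exp 9 (3 ℕ.+ 4 ℕ.* s) and poly≤exp 4 (2 ℕ.* s)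
      and eventually-≥ (8 ℕ.* s ℕ.^ 3) and eventually-≥ e and eventually-≥ (b ℕ.+ b)
    finish : ∀ m → Large m → 1ℚ - δ ≤ ProbLongCycle ε m
    finish m (22≤m , m^16≤ , m^10≤ , m^5≤ , s≤m , e≤m , b≤m) =
      Constants.conclusion m s (ℕ.≤-trans 1≤a (ℕ.m≤m+n a a)) 22≤m
        (subst (λ x → m ℕ.^ 16 ℕ.≤ 2 ℕ.^ x) (ℕ.n/1≡n m) m^16≤) m^10≤ m^5≤ s≤m (2recip≤ 1≤a 1≤aε) (≤-trans 1+ε≤e (ι-mono e≤m))
        (≤-trans (twice {b} {δ} 1≤bδ) (*-monoʳ 0≤δ (ι-mono b≤m)))

open Rationals using (archimedes; upperBound)
open Sprinkling using (likely)
open import Data.Nat using (ℕ; suc; s≤s; z≤n) renaming (_≤_ to _≤ℕ_)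
open import Data.Rational using (ℚ; 0ℚ; 1ℚ; _<_; _≤_; _-_; _+_)
open import Data.Rational.Properties using (<⇒≤)
open import Data.Product using (Σ; _,_)

theorem1p9 : (ε : ℚ) → 0ℚ < ε → (δ : ℚ) → 0ℚ < δ →
    Σ ℕ (λ M → (m : ℕ) → M ≤ℕ m → 1ℚ - δ ≤ ProbLongCycle ε m)
theorem1p9 ε 0<ε δ 0<δ with archimedes ε 0<ε | archimedes δ 0<δ | upperBound (1ℚ + ε)
... | a , 1≤aε | b , 1≤bδ | e , 1+ε≤e =
  likely {ε} {δ} {suc a} {suc b} {e} (s≤s z≤n) (<⇒≤ 0<δ) 1≤aε 1≤bδ 1+ε≤e
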